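{- Let $\varphi$ be a formula of Presburger arithmetic (in the extended language described in the context) of length $n$, with free variables $x_1,\dots,x_r$. Then the minimal deterministic word automaton representing $\{(a_1,\dots,a_r)\in\mathbb{Z}^r : (\mathbb{Z},<,+)\models\varphi[a_1,\dots,a_r]\}$ has at most $2^{n^{(\operatorname{qbl}(\varphi)+1)^{\operatorname{qa}(\varphi)+4}}}$ states.
   Context: Presburger arithmetic (PA) is first-order logic over $(\mathbb{Z},<,+)$; we use the extended language with constants $0,1$, unary negation $-$, binary $+$, the relations $=,\neq,<,\leq,>,\geq$, and unary predicates $d\mid\cdot$ ("divisible by $d$") for each integer $d\geq 2$; formulas use $\neg,\wedge,\vee,\rightarrow,\leftrightarrow,\exists,\forall$. A constant $c$ abbreviates $1+\dots+1$ ($c$ times) or $-(1+\dots+1)$, and $k\cdot x$ abbreviates $x+\dots+x$ ($k$ times) or $-(x+\dots+x)$ (and $x+(-x)$ if $k=0$). The length of a formula is the number of letters needed to write it, where constants and coefficients are counted in this expanded (unary) form, and the length of $d\mid t$ is the length of $t$ plus $d+1$. Quantifier alternations: $\operatorname{qa}(\varphi)=\min\{\operatorname{qa}_\exists(\varphi),\operatorname{qa}_\forall(\varphi)\}$ where, with $\overline{Q}$ the dual quantifier of $Q$: $\operatorname{qa}_Q(\neg\psi)=\operatorname{qa}_{\overline Q}(\psi)$; $\operatorname{qa}_Q(\psi_1\oplus\psi_2)=\max\{\operatorname{qa}_Q(\psi_1),\operatorname{qa}_Q(\psi_2)\}$ for $\oplus\in\{\wedge,\vee\}$; $\operatorname{qa}_Q(\psi_1\to\psi_2)=\operatorname{qa}_Q(\neg\psi_1\vee\psi_2)$;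 $\operatorname{qa}_Q(\psi_1\leftrightarrow\psi_2)=\operatorname{qa}_Q((\psi_1\to\psi_2)\wedge(\psi_2\to\psi_1))$; $\operatorname{qa}_Q(\overline{Q}x\psi)=1+\operatorname{qa}_{\overline Q}(\psi)$; $\operatorname{qa}_Q(Qx\psi)=\max\{1,\operatorname{qa}_Q(\psi)\}$; and $0$ for atomic formulas. Quantifier block length: $\operatorname{qbl}(\varphi)=\max\{\operatorname{qbl}_Q(\psi): Q\in\{\exists,\forall\},\ \psi \text{ a subformula of }\varphi\}$ where $\operatorname{qbl}_Q(\neg\psi)=\operatorname{qbl}_{\overline Q}(\psi)$; $\operatorname{qbl}_Q(\psi_1\oplus\psi_2)=\operatorname{qbl}_Q(\psi_1)+\operatorname{qbl}_Q(\psi_2)$ for $\oplus\in\{\wedge,\vee\}$; $\to$ and $\leftrightarrow$ are treated via the same rewritings as for $\operatorname{qa}$; $\operatorname{qbl}_Q(Qx\psi)=1+\operatorname{qbl}_Q(\psi)$; and $0$ otherwise (including $\overline{Q}x\psi$ and atomic formulas). Encoding: fix an integer base $\varrho\geq 2$ and $\Sigma=\{0,\dots,\varrho-1\}$. For $b_{n-1}\dots b_0\in\Sigma^*$ let $\langle b_{n-1}\dots b_0\rangle_{\mathbb N}=\sum_{i<n}\varrho^i b_i$; for $b_nb_{n-1}\dots b_0\in\Sigma^+$ let $\langle b_n\dots b_0\rangle_{\mathbb Z}=\langle b_{n-1}\dots b_0\rangle_{\mathbb N}$ if $b_n=0$ and $\langle b_{n-1}\dots b_0\rangle_{\mathbb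 N}-\varrho^n$ if $b_n\neq 0$. A word over $\Sigma^r$ is read componentwise (track $i$ encodes the $i$th integer) giving $\langle w\rangle_{\mathbb Z}\in\mathbb{Z}^r$ for $w\in(\Sigma^r)^+$. A deterministic word automaton (DWA) $\mathcal A$ over $\Sigma^r$ represents $U\subseteq\mathbb{Z}^r$ if $L(\mathcal A)=\{w\in(\Sigma^r)^+:\langle w\rangle_{\mathbb Z}\in U\}$. The size of a DWA is its number of states. -}

module Defs where

open import Data.Nat as ℕ using (ℕ; zero; suc; _≤_; _<_; _⊔_; _⊓_; _^_)
open import Data.Nat.Properties using (_<?_)
open import Data.Integer as ℤ using (ℤ)
open import Data.Integer.Divisibility using () renaming (_∣_ to _∣ℤ_)
open import Data.Fin using (Fin; toℕ; fromℕ<)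
open import Data.List using (List; []; _∷_; foldl; map; length)
open import Data.Product using (Σ; _×_; _,_)
open import Data.Empty using (⊥)
open import Data.Unit using (⊤)
open import Data.Bool using (Bool; true; false; if_then_else_)
open import Relation.Nullary using (¬_; does; yes; no)
open import Relation.Binary.PropositionalEquality using (_≡_; _≢_)
open import Function.Bundles using (_⇔_)

-- Syntax of Presburger arithmetic (extended language).
-- Variables are named by natural numbers: variable x_i is  var i.
-- Constants c and coefficients k·x are abbreviations written out with
-- 0, 1, -, + so they are automatically in unary (expanded) form.

Var : Set
Var = ℕ

data Term : Set where
  `0  : Term
  `1  : Term
  var : Var → Term
  -_  : Term → Term
  _⊕_ : Term → Term → Term

data Rel : Set where
  EQ NE LT LE GT GE : Rel

data Formula : Set where
  atom : Rel → Term → Term → Formula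
  dvd  : (d : ℕ) → 2 ≤ d → Term → Formula
  ¬'   : Formula → Formula
  _∧'_ _∨'_ _⇒'_ _⇔'_ : Formula → Formula → Formula
  ∃' ∀' : Var → Formula → Formula

-- Length: number of letters needed to write the formula (no brackets).

lenT : Term → ℕ
lenT `0 = 1
lenT `1 = 1
lenT (var x) = 1
lenT (- t) = 1 ℕ.+ lenT t
lenT (t ⊕ u) = lenT t ℕ.+ 1 ℕ.+ lenT u

len : Formula → ℕ
len (atom R t u) = lenT t ℕ.+ 1 ℕ.+ lenT u
len (dvd d _ t) = lenT t ℕ.+ (d ℕ.+ 1)
len (¬' φ) = 1 ℕ.+ len φ
len (φ ∧' ψ) = len φ ℕ.+ 1 ℕ.+ len ψ
len (φ ∨' ψ) = len φ ℕ.+ 1 ℕ.+ len ψ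
len (φ ⇒' ψ) = len φ ℕ.+ 1 ℕ.+ len ψ
len (φ ⇔' ψ) = len φ ℕ.+ 1 ℕ.+ len ψ
len (∃' x φ) = 2 ℕ.+ len φ
len (∀' x φ) = 2 ℕ.+ len φ

data Q : Set where
  E A : Q

dual : Q → Q
dual E = A
dual A = E

qaQ : Q → Formula → ℕ
qaQ q (atom _ _ _) = 0
qaQ q (dvd _ _ _) = 0
qaQ q (¬' φ) = qaQ (dual q) φ
qaQ q (φ ∧' ψ) = qaQ q φ ⊔ qaQ q ψ
qaQ q (φ ∨' ψ) = qaQ q φ ⊔ qaQ q ψ
qaQ q (φ ⇒' ψ) = qaQ (dual q) φ ⊔ qaQ q ψ
qaQ q (φ ⇔' ψ) = (qaQ (dual q) φ ⊔ qaQ q ψ) ⊔ (qaQ (dual q) ψ ⊔ qaQ q φ)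
qaQ E (∃' x φ) = 1 ⊔ qaQ E φ
qaQ A (∃' x φ) = 1 ℕ.+ qaQ E φ
qaQ A (∀' x φ) = 1 ⊔ qaQ A φ
qaQ E (∀' x φ) = 1 ℕ.+ qaQ A φ

qa : Formula → ℕ
qa φ = qaQ E φ ⊓ qaQ A φ

qblQ : Q → Formula → ℕ
qblQ q (atom _ _ _) = 0
qblQ q (dvd _ _ _) = 0
qblQ q (¬' φ) = qblQ (dual q) φ
qblQ q (φ ∧' ψ) = qblQ q φ ℕ.+ qblQ q ψ
qblQ q (φ ∨' ψ) = qblQ q φ ℕ.+ qblQ q ψ
qblQ q (φ ⇒' ψ) = qblQ (dual q) φ ℕ.+ qblQ q ψ
qblQ q (φ ⇔' ψ) = (qblQ (dual q) φ ℕ.+ qblQ q ψ) ℕ.+ (qblQ (dual q) ψ ℕ.+ qblQ q φ)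
qblQ E (∃' x φ) = 1 ℕ.+ qblQ E φ
qblQ A (∃' x φ) = 0
qblQ A (∀' x φ) = 1 ℕ.+ qblQ A φ
qblQ E (∀' x φ) = 0

qbl : Formula → ℕ
qbl φ = (qblQ E φ ⊔ qblQ A φ) ⊔ sub φ
  where
  sub : Formula → ℕ
  sub (atom _ _ _) = 0
  sub (dvd _ _ _) = 0
  sub (¬' φ) = qbl φ
  sub (φ ∧' ψ) = qbl φ ⊔ qbl ψ
  sub (φ ∨' ψ) = qbl φ ⊔ qbl ψ
  sub (φ ⇒' ψ) = qbl φ ⊔ qbl ψ
  sub (φ ⇔' ψ) = qbl φ ⊔ qbl ψ
  sub (∃' x φ) = qbl φ
  sub (∀' x φ) = qbl φ

Env : Set
Env = Var → ℤ

_[_↦_] : Env → Var → ℤ → Env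
(ρ [ x ↦ v ]) y = if does (y ℕ.≟ x) then v else ρ y

evalT : Env → Term → ℤ
evalT ρ `0 = ℤ.0ℤ
evalT ρ `1 = ℤ.1ℤ
evalT ρ (var x) = ρ x
evalT ρ (- t) = ℤ.- evalT ρ t
evalT ρ (t ⊕ u) = evalT ρ t ℤ.+ evalT ρ u

evalR : Rel → ℤ → ℤ → Set
evalR EQ a b = a ≡ b
evalR NE a b = a ≢ b
evalR LT a b = a ℤ.< b
evalR LE a b = a ℤ.≤ b
evalR GT a b = a ℤ.> b
evalR GE a b = a ℤ.≥ b

Sat : Env → Formula → Set
Sat ρ (atom R t u) = evalR R (evalT ρ t) (evalT ρ u)
Sat ρ (dvd d _ t) = ℤ.+ d ∣ℤ evalT ρ t
Sat ρ (¬' φ) = ¬ Sat ρ φ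
Sat ρ (φ ∧' ψ) = Sat ρ φ × Sat ρ ψ
Sat ρ (φ ∨' ψ) = Data.Sum._⊎_ (Sat ρ φ) (Sat ρ ψ)
  where import Data.Sum
Sat ρ (φ ⇒' ψ) = Sat ρ φ → Sat ρ ψ
Sat ρ (φ ⇔' ψ) = (Sat ρ φ → Sat ρ ψ) × (Sat ρ ψ → Sat ρ φ)
Sat ρ (∃' x φ) = Σ ℤ λ v → Sat (ρ [ x ↦ v ]) φ
Sat ρ (∀' x φ) = (v : ℤ) → Sat (ρ [ x ↦ v ]) φ

OccT : Var → Term → Set
OccT x `0 = ⊥
OccT x `1 = ⊥
OccT x (var y) = x ≡ y
OccT x (- t) = OccT x t
OccT x (t ⊕ u) = Data.Sum._⊎_ (OccT x t) (OccT x u)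
  where import Data.Sum

Free : Var → Formula → Set
Free x (atom _ t u) = Data.Sum._⊎_ (OccT x t) (OccT x u)
  where import Data.Sum
Free x (dvd _ _ t) = OccT x t
Free x (¬' φ) = Free x φ
Free x (φ ∧' ψ) = Data.Sum._⊎_ (Free x φ) (Free x ψ)
  where import Data.Sum
Free x (φ ∨' ψ) = Data.Sum._⊎_ (Free x φ) (Free x ψ)
  where import Data.Sum
Free x (φ ⇒' ψ) = Data.Sum._⊎_ (Free x φ) (Free x ψ)
  where import Data.Sum
Free x (φ ⇔' ψ) = Data.Sum._⊎_ (Free x φ) (Free x ψ)
  where import Data.Sum
Free x (∃' y φ) = x ≢ y × Free x φ
Free x (∀' y φ) = x ≢ y × Free x φ

FreeVarsAmong : ℕ → Formula → Set
FreeVarsAmong r φ = (x : Var) → Free x φ → x < r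

envOf : {r : ℕ} → (Fin r → ℤ) → Env
envOf {r} a x with x <? r
... | yes x<r = a (fromℕ< x<r)
... | no _ = ℤ.0ℤ

⟦_⟧ : (φ : Formula) → {r : ℕ} → (Fin r → ℤ) → Set
⟦ φ ⟧ a = Sat (envOf a) φ

-- Encoding of integers (base ϱ, most significant digit first,
-- two's-complement style sign digit).

Digit : ℕ → Set
Digit ϱ = Fin ϱ

valℕ : (ϱ : ℕ) → List (Digit ϱ) → ℕ
valℕ ϱ = foldl (λ acc b → acc ℕ.* ϱ ℕ.+ toℕ b) 0

valℤ : (ϱ : ℕ) → Digit ϱ → List (Digit ϱ) → ℤ
valℤ ϱ bₙ bs with toℕ bₙ
... | zero  = ℤ.+ valℕ ϱ bs
... | suc _ = ℤ.+ valℕ ϱ bs ℤ.- ℤ.+ (ϱ ^ length bs)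

Letter : ℕ → ℕ → Set
Letter ϱ r = Fin r → Digit ϱ

decode : (ϱ r : ℕ) → Letter ϱ r → List (Letter ϱ r) → Fin r → ℤ
decode ϱ r b bs i = valℤ ϱ (b i) (map (λ l → l i) bs)

record DWA (ϱ r : ℕ) : Set where
  field
    size  : ℕ
    init  : Fin size
    δ     : Fin size → Letter ϱ r → Fin size
    final : Fin size → Bool

  δ* : Fin size → List (Letter ϱ r) → Fin size
  δ* q [] = q
  δ* q (a ∷ w) = δ* (δ q a) w

  Accepts : List (Letter ϱ r) → Set
  Accepts w = final (δ* init w) ≡ true

Represents : {ϱ r : ℕ} → DWA ϱ r → ((Fin r → ℤ) → Set) → Set
Represents {ϱ} {r} 𝒜 U =
  (¬ DWA.Accepts 𝒜 [])
  × ((b : Letter ϱ r) (bs : List (Letter ϱ r)) →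
       DWA.Accepts 𝒜 (b ∷ bs) ⇔ U (decode ϱ r b bs))

bound : Formula → ℕ
bound φ = 2 ^ (len φ ^ ((qbl φ ℕ.+ 1) ^ (qa φ ℕ.+ 4)))

{-# OPTIONS --safe #-}
module Submission where

-- Quantifiers are eliminated from equivalences of assignments rather than from formulas: two
-- assignments are equivalent if their entries agree modulo D and finitely many linear forms take
-- the same values on them, where all values beyond a threshold 2 ^ w are identified.
-- To eliminate a quantified variable, lower its value by multiples of D until some form f that
-- contains it becomes small (then f serves as a pivot that determines the variable, and every other
-- form h is replaced by the combination of h and f that cancels it), or until no form bounds it from
-- below (then the forms containing it can be dropped). So N forms branch into N + 1 lists of at
-- most N forms, and a block of b like quantifiers turns N forms into at most (N + 1) ^ b * N. After
-- k blocks there are at most n ^ ((b + 1) ^ k) forms, and the logarithms of the thresholds and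
-- moduli are polynomial in that number. An automaton can store the clamped values of the surviving
-- forms and the residues of the free variables, because both are updated digit by digit.
-- The two sides of an equivalence are treated as leaves of the block that contains it; this costs no
-- additional alternation and keeps each atom in a single role.
-- Without quantifiers the bound is only 2 ^ n, which is met by a product of automata for the atoms.

open import Defs
open import Data.Nat as ℕ using (ℕ; zero; suc; _+_; _*_; _∸_; _^_; _≤_; _<_; _⊔_; _⊓_; z≤n; s≤s; NonZero)
open import Data.Nat.Properties as ℕₚ hiding (_≟_; _<?_; _≤?_)
open import Data.Nat.Divisibility as ∣ using (_∣_; divides)
open import Data.Nat.ListAction using (sum; product)
open import Data.Nat.ListAction.Properties using (∈⇒∣product)
open import Data.Nat.Tactic.RingSolver using () renaming (solve-∀ to solveℕ-∀)
open import Data.Integer as ℤ using (ℤ; +_; -[1+_]; ∣_∣; 0ℤ; 1ℤ)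
  renaming (_+_ to _+ᶻ_; _*_ to _*ᶻ_; _-_ to _-ᶻ_; -_ to -ᶻ_; _≤_ to _≤ᶻ_; _<_ to _<ᶻ_)
import Data.Integer.Properties as ℤₚ
open import Data.Integer.DivMod using (_%ℕ_; _/ℕ_; n%ℕd<d; a≡a%ℕn+[a/ℕn]*n)
import Data.Integer.Divisibility as Unsigned
import Data.Integer.Divisibility.Signed as Signed
open import Data.Integer.Tactic.RingSolver using (solve-∀)
open import Data.Bool using (Bool; true; false; if_then_else_; not; _∧_; _∨_)
open import Data.Empty using (⊥; ⊥-elim)
open import Data.Fin as Fin using (Fin; toℕ; fromℕ<; combine; remQuot)
open import Data.Fin.Properties
  using (toℕ-fromℕ<; fromℕ<-cong; toℕ<n; remQuot-combine; combine-injectiveˡ; combine-injectiveʳ)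
open import Data.List using (List; []; _∷_; _++_; map; filter; length; concat; concatMap; foldl)
open import Data.List.Membership.Propositional using (_∈_)
open import Data.List.Membership.Propositional.Properties
  using (∈-map⁺; ∈-map⁻; ∈-filter⁺; ∈-filter⁻; ∈-++⁺ˡ; ∈-++⁺ʳ; ∈-++⁻; ∈-concat⁺′; ∈-concat⁻′)
open import Data.List.Properties using (length-map; length-filter; length-++; ++-identityʳ)
open import Data.List.Relation.Unary.Any using (here; there)
open import Data.Product using (Σ; _×_; _,_; proj₁; proj₂)
open import Data.Sum using (_⊎_; inj₁; inj₂)
open import Data.Unit using (⊤; tt)
open import Function using (_∘_; id; _⇔_; mk⇔; Equivalence)
open import Relation.Nullary using (¬_; Dec; yes; no; does; proof; Reflects; ofʸ; ofⁿ)
open import Relation.Nullary.Decidable using (dec-true; dec-false; map′; _×-dec_; _⊎-dec_; _→-dec_; ¬?)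
open import Relation.Nullary.Reflects using (¬-reflects; _×-reflects_; _⊎-reflects_; _→-reflects_)
open import Relation.Binary.PropositionalEquality
  using (_≡_; _≢_; refl; sym; trans; cong; cong₂; subst; subst₂)

-- Integers up to clamping and up to congruence

-- Equivalences keep small what a quantifier-free formula would have to spell out: residues enter
-- only through the modulus and constants only through the threshold, so neither multiplies the
-- number of forms, and that number governs the exponent of the bound. Within a block the lists stay
-- separate, and a pivot is combined only with forms of its own list. Uniting the lists after every
-- variable would roughly square the number of forms each time and give about N ^ (2 ^ b) instead of
-- N ^ (b + 1). The union is taken only at the end of the block, where the equivalence has to serve
-- every choice of pivots. The exponent `qa φ + 4` consists of `qa φ + 1` levels and of 3 for the
-- passage from forms, thresholds and moduli to states: a factor 8 that `(b + 1) ^ 3` absorbs once a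
-- quantifier is present. Satisfaction is constructive here, so the decidability of Presburger
-- arithmetic is itself proved, by the same elimination for single variables and without regard to
-- size. It supplies counterexamples to false universal statements and the accepting states.

data _≈[_]_ (x : ℤ) (C : ℕ) (y : ℤ) : Set where
  same : x ≡ y → x ≈[ C ] y
  high : + C ≤ᶻ x → + C ≤ᶻ y → x ≈[ C ] y
  low  : x ≤ᶻ -ᶻ + C → y ≤ᶻ -ᶻ + C → x ≈[ C ] y

≈-sym : ∀ {C x y} → x ≈[ C ] y → y ≈[ C ] x
≈-sym (same e)   = same (sym e)
≈-sym (high p q) = high q p
≈-sym (low p q)  = low q p

high-low-absurd : ∀ {C x} → 1 ≤ C → + C ≤ᶻ x → x ≤ᶻ -ᶻ + C → ⊥
high-low-absurd {suc C} _ p q with ℤₚ.≤-trans p q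
... | ()

-- For `C` equal to 0 the two saturated classes share 0, and 1, 0, -1 would be a counterexample.
≈-trans : ∀ {C x y z} → 1 ≤ C → x ≈[ C ] y → y ≈[ C ] z → x ≈[ C ] z
≈-trans 1≤C (same refl) q            = q
≈-trans 1≤C p          (same refl)   = p
≈-trans 1≤C (high a b) (high c d)    = high a d
≈-trans 1≤C (high a b) (low c d)     = ⊥-elim (high-low-absurd 1≤C b c)
≈-trans 1≤C (low a b)  (high c d)    = ⊥-elim (high-low-absurd 1≤C c b)
≈-trans 1≤C (low a b)  (low c d)     = low a d

≈-weaken : ∀ {C C′ x y} → C ≤ C′ → x ≈[ C′ ] y → x ≈[ C ] y
≈-weaken C≤ (same e)   = same e
≈-weaken C≤ (high p q) = high (ℤₚ.≤-trans (ℤ.+≤+ C≤) p) (ℤₚ.≤-trans (ℤ.+≤+ C≤) q)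
≈-weaken C≤ (low p q)  = low (ℤₚ.≤-trans p m) (ℤₚ.≤-trans q m)
  where m = ℤₚ.neg-mono-≤ (ℤ.+≤+ C≤)

i≤∣i∣ : ∀ i → i ≤ᶻ + ∣ i ∣
i≤∣i∣ (+ n)    = ℤₚ.≤-refl
i≤∣i∣ -[1+ n ] = ℤ.-≤+

-∣i∣≤i : ∀ i → -ᶻ + ∣ i ∣ ≤ᶻ i
-∣i∣≤i (+ n)    = ℤₚ.neg-≤-pos
-∣i∣≤i -[1+ n ] = ℤₚ.≤-refl

∣i∣≥⇒ : ∀ {C} i → C ≤ ∣ i ∣ → + C ≤ᶻ i ⊎ i ≤ᶻ -ᶻ + C
∣i∣≥⇒ (+ n)    p = inj₁ (ℤ.+≤+ p)
∣i∣≥⇒ -[1+ n ] p = inj₂ (ℤₚ.neg-mono-≤ (ℤ.+≤+ p))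

≤-translate : ∀ {B C C′ x} z → B + C ≤ C′ → ∣ z ∣ ≤ B → + C′ ≤ᶻ x → + C ≤ᶻ x +ᶻ z
≤-translate {B} {C} z B+C≤ z≤B p =
  subst (_≤ᶻ _) (trans (cong (_+ᶻ -ᶻ + B) (ℤₚ.pos-+ B C)) (solve′ (+ B) (+ C)))
    (ℤₚ.+-mono-≤ (ℤₚ.≤-trans (ℤ.+≤+ B+C≤) p)
                 (ℤₚ.≤-trans (ℤₚ.neg-mono-≤ (ℤ.+≤+ z≤B)) (-∣i∣≤i z)))
  where
  solve′ : ∀ b c → (b +ᶻ c) +ᶻ -ᶻ b ≡ c
  solve′ = solve-∀

≤-translate⁻ : ∀ {B C C′ x} z → B + C ≤ C′ → ∣ z ∣ ≤ B → x ≤ᶻ -ᶻ + C′ → x +ᶻ z ≤ᶻ -ᶻ + C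
≤-translate⁻ {B} {C} z B+C≤ z≤B p =
  subst (_ ≤ᶻ_) (trans (cong (λ t → -ᶻ t +ᶻ + B) (ℤₚ.pos-+ B C)) (solve′ (+ B) (+ C)))
    (ℤₚ.+-mono-≤ (ℤₚ.≤-trans p (ℤₚ.neg-mono-≤ (ℤ.+≤+ B+C≤)))
                 (ℤₚ.≤-trans (i≤∣i∣ z) (ℤ.+≤+ z≤B)))
  where
  solve′ : ∀ b c → -ᶻ (b +ᶻ c) +ᶻ b ≡ -ᶻ c
  solve′ = solve-∀

≈-translate : ∀ {B C C′ x y} z → B + C ≤ C′ → ∣ z ∣ ≤ B →
              x ≈[ C′ ] y → (x +ᶻ z) ≈[ C ] (y +ᶻ z)
≈-translate z a b (same e)   = same (cong (_+ᶻ z) e)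
≈-translate z a b (high p q) = high (≤-translate z a b p) (≤-translate z a b q)
≈-translate z a b (low p q)  = low (≤-translate⁻ z a b p) (≤-translate⁻ z a b q)

-- A value at distance at least `∣ δ ∣ + C` from 0 cannot be moved across the window by `δ`, so both
-- values are saturated with the same sign.
≈-shift : ∀ {C} x δ → ∣ δ ∣ + C ≤ ∣ x ∣ → x ≈[ C ] (x +ᶻ δ)
≈-shift {C} x δ p with ∣i∣≥⇒ x p
... | inj₁ q = high (ℤₚ.≤-trans (ℤ.+≤+ (m≤n+m C ∣ δ ∣)) q) (≤-translate δ ≤-refl ≤-refl q)
... | inj₂ q = low (ℤₚ.≤-trans q (ℤₚ.neg-mono-≤ (ℤ.+≤+ (m≤n+m C ∣ δ ∣)))) (≤-translate⁻ δ ≤-refl ≤-refl q)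

-- Division by `p` divides the threshold by its absolute value; a negative `p` exchanges `high` and
-- `low`.
≈-cancel : ∀ {C x y} p → p ≢ 0ℤ → (p *ᶻ x) ≈[ ∣ p ∣ * C ] (p *ᶻ y) → x ≈[ C ] y
≈-cancel {C} {x} {y} (+ zero) p≢0 _ = ⊥-elim (p≢0 refl)
≈-cancel {C} {x} {y} p@(+ suc n) _ (same e) = same (ℤₚ.*-cancelˡ-≡ p x y e)
≈-cancel {C} {x} {y} p@(+ suc n) _ (high a b) = high (c a) (c b)
  where
  c : ∀ {z} → + (suc n * C) ≤ᶻ p *ᶻ z → + C ≤ᶻ z
  c {z} h = ℤₚ.*-cancelˡ-≤-pos (+ C) z p (subst (_≤ᶻ p *ᶻ z) (ℤₚ.pos-* (suc n) C) h)
≈-cancel {C} {x} {y} p@(+ suc n) _ (low a b) = low (c a) (c b)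
  where
  c : ∀ {z} → p *ᶻ z ≤ᶻ -ᶻ + (suc n * C) → z ≤ᶻ -ᶻ + C
  c {z} h = ℤₚ.*-cancelˡ-≤-pos z (-ᶻ + C) p
    (subst (p *ᶻ z ≤ᶻ_) (trans (cong -ᶻ_ (ℤₚ.pos-* (suc n) C)) (ℤₚ.neg-distribʳ-* p (+ C))) h)
≈-cancel {C} {x} {y} p@(-[1+ n ]) _ (same e) = same (ℤₚ.*-cancelˡ-≡ p x y e)
≈-cancel {C} {x} {y} p@(-[1+ n ]) _ (high a b) = low (c a) (c b)
  where
  flip : ∀ i j → i *ᶻ j ≡ (-ᶻ i) *ᶻ (-ᶻ j)
  flip = solve-∀
  c : ∀ {z} → + (suc n * C) ≤ᶻ p *ᶻ z → z ≤ᶻ -ᶻ + C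
  c {z} h = ℤₚ.*-cancelˡ-≤-neg p (-ᶻ + C) z
    (subst (_≤ᶻ p *ᶻ z) (trans (ℤₚ.pos-* (suc n) C) (flip (+ suc n) (+ C))) h)
≈-cancel {C} {x} {y} p@(-[1+ n ]) _ (low a b) = high (c a) (c b)
  where
  c : ∀ {z} → p *ᶻ z ≤ᶻ -ᶻ + (suc n * C) → + C ≤ᶻ z
  c {z} h = ℤₚ.*-cancelˡ-≤-neg p z (+ C)
    (subst (p *ᶻ z ≤ᶻ_) (trans (cong -ᶻ_ (ℤₚ.pos-* (suc n) C)) (ℤₚ.neg-distribˡ-* (+ suc n) (+ C))) h)

-- The quotient is data because `congruent-scaled` turns it into the amount by which the quantified
-- value has to move.
record Congruent (D : ℕ) (x y : ℤ) : Set where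
  constructor by
  field
    quotient : ℤ
    equality : y ≡ x +ᶻ quotient *ᶻ + D

open Congruent

cong-reflexive : ∀ {D x y} → x ≡ y → Congruent D x y
cong-reflexive {D} {x} refl = by 0ℤ (lem x (+ D))
  where
  lem : ∀ x d → x ≡ x +ᶻ 0ℤ *ᶻ d
  lem = solve-∀

cong-sym : ∀ {D x y} → Congruent D x y → Congruent D y x
cong-sym {D} {x} (by t refl) = by (-ᶻ t) (lem x t (+ D))
  where
  lem : ∀ x t d → x ≡ (x +ᶻ t *ᶻ d) +ᶻ (-ᶻ t) *ᶻ d
  lem = solve-∀

cong-trans : ∀ {D x y z} → Congruent D x y → Congruent D y z → Congruent D x z
cong-trans {D} {x} (by t refl) (by s refl) = by (t +ᶻ s) (lem x t s (+ D))
  where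
  lem : ∀ x t s d → (x +ᶻ t *ᶻ d) +ᶻ s *ᶻ d ≡ x +ᶻ (t +ᶻ s) *ᶻ d
  lem = solve-∀

cong-+ : ∀ {D x y u v} → Congruent D x y → Congruent D u v → Congruent D (x +ᶻ u) (y +ᶻ v)
cong-+ {D} {x} {u = u} (by t refl) (by s refl) = by (t +ᶻ s) (lem x u t s (+ D))
  where
  lem : ∀ x u t s d → (x +ᶻ t *ᶻ d) +ᶻ (u +ᶻ s *ᶻ d) ≡ (x +ᶻ u) +ᶻ (t +ᶻ s) *ᶻ d
  lem = solve-∀

cong-* : ∀ {D x y} k → Congruent D x y → Congruent D (k *ᶻ x) (k *ᶻ y)
cong-* {D} {x} k (by t refl) = by (k *ᶻ t) (lem k x t (+ D))
  where
  lem : ∀ k x t d → k *ᶻ (x +ᶻ t *ᶻ d) ≡ k *ᶻ x +ᶻ (k *ᶻ t) *ᶻ d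
  lem = solve-∀

cong-weaken : ∀ {D D′ x y} → D ∣ D′ → Congruent D′ x y → Congruent D x y
cong-weaken {D} {x = x} (divides q refl) (by t refl) =
  by (t *ᶻ + q) (cong (x +ᶻ_) (trans (cong (t *ᶻ_) (ℤₚ.pos-* q D)) (sym (ℤₚ.*-assoc t (+ q) (+ D)))))

-- Elimination of one slot

-- The coefficients of a linear form, indexed by slots.
Form : Set
Form = ℕ → ℤ

-- There is no constant term: the constants of atoms are absorbed by the threshold in
-- `atom-invariant`. Slots from the bound on are ignored, so forms need no truncation when slots
-- disappear.
ev : ℕ → Form → Env → ℤ
ev zero    f σ = 0ℤ
ev (suc m) f σ = ev m f σ +ᶻ f m *ᶻ σ m

norm : ℕ → Form → ℕ
norm zero    f = 0
norm (suc m) f = norm m f + ∣ f m ∣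

AgreeBelow : ℕ → Env → Env → Set
AgreeBelow m σ σ′ = ∀ {i} → i < m → σ i ≡ σ′ i

CongruentBelow : ℕ → ℕ → Env → Env → Set
CongruentBelow D m σ σ′ = ∀ {i} → i < m → Congruent D (σ i) (σ′ i)

ev-agree : ∀ m f {σ σ′} → AgreeBelow m σ σ′ → ev m f σ ≡ ev m f σ′
ev-agree zero    f p = refl
ev-agree (suc m) f p = cong₂ _+ᶻ_ (ev-agree m f (λ i<m → p (m<n⇒m<1+n i<m))) (cong (f m *ᶻ_) (p ≤-refl))

ev-congruent : ∀ {D} m f {σ σ′} → CongruentBelow D m σ σ′ → Congruent D (ev m f σ) (ev m f σ′)
ev-congruent zero    f p = cong-reflexive refl
ev-congruent (suc m) f p = cong-+ (ev-congruent m f (λ i<m → p (m<n⇒m<1+n i<m))) (cong-* (f m) (p ≤-refl))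

elim : ℕ → Form → Form → Form
elim m f h i = f m *ᶻ h i -ᶻ h m *ᶻ f i

ev-combination : ∀ k a b f h σ →
  ev k (λ i → a *ᶻ h i -ᶻ b *ᶻ f i) σ ≡ a *ᶻ ev k h σ -ᶻ b *ᶻ ev k f σ
ev-combination zero    a b f h σ = lem a b
  where
  lem : ∀ a b → 0ℤ ≡ a *ᶻ 0ℤ -ᶻ b *ᶻ 0ℤ
  lem = solve-∀
ev-combination (suc k) a b f h σ =
  trans (cong (_+ᶻ (a *ᶻ h k -ᶻ b *ᶻ f k) *ᶻ σ k) (ev-combination k a b f h σ)) (lem a b (ev k h σ) (ev k f σ) (h k) (f k) (σ k))
  where
  lem : ∀ a b H F h f s → (a *ᶻ H -ᶻ b *ᶻ F) +ᶻ (a *ᶻ h -ᶻ b *ᶻ f) *ᶻ s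
                        ≡ a *ᶻ (H +ᶻ h *ᶻ s) -ᶻ b *ᶻ (F +ᶻ f *ᶻ s)
  lem = solve-∀

-- The first list serves the case without a pivot. Forms with coefficient 0 also get a list, which
-- is never selected; the number of lists then depends only on the length of `T`.
branches : ℕ → List Form → List (List Form)
branches m T = filter (λ h → h m ℤ.≟ 0ℤ) T ∷ map (λ f → map (elim m f) T) T

evAt : ℕ → Form → Env → ℤ → ℤ
evAt m h σ v = ev m h σ +ᶻ h m *ᶻ v

-- A step of `D` in the slot changes `f` by `∣ f m ∣ * D`, so a form that contains the slot and is
-- not a pivot stays saturated at `C`, on the same side, after such a step.
IsPivot : ℕ → ℕ → ℕ → Env → ℤ → Form → Set
IsPivot m C D σ v f = f m ≢ 0ℤ × ∣ evAt m f σ v ∣ < ∣ f m ∣ * D + C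

findPivot : ∀ T m C D σ v →
  (Σ Form λ f → f ∈ T × IsPivot m C D σ v f) ⊎
  (∀ {h} → h ∈ T → h m ≢ 0ℤ → ∣ h m ∣ * D + C ≤ ∣ evAt m h σ v ∣)
findPivot [] m C D σ v = inj₂ λ ()
findPivot (h ∷ T) m C D σ v with findPivot T m C D σ v
... | inj₁ (f , f∈T , p) = inj₁ (f , there f∈T , p)
... | inj₂ none with h m ℤ.≟ 0ℤ
...   | yes h≡0 = inj₂ λ { (here refl) h≢0 → ⊥-elim (h≢0 h≡0) ; (there i) → none i }
...   | no h≢0 with suc ∣ evAt m h σ v ∣ ℕ.≤? ∣ h m ∣ * D + C
...     | yes p = inj₁ (h , here refl , h≢0 , p)
...     | no ¬p = inj₂ λ { (here refl) _ → ≮⇒≥ ¬p ; (there i) → none i }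

-- Coefficient and value have the same sign: lowering `v` moves the value of `h` towards 0, at least
-- initially. Such forms bound `v` from below.
Descending : ℕ → Env → ℤ → Form → Set
Descending m σ v h = 0ℤ <ᶻ h m *ᶻ evAt m h σ v

findDescending : ∀ T m σ v →
  (Σ Form λ h → h ∈ T × Descending m σ v h) ⊎ (∀ {h} → h ∈ T → h m *ᶻ evAt m h σ v ≤ᶻ 0ℤ)
findDescending [] m σ v = inj₂ λ ()
findDescending (h ∷ T) m σ v with findDescending T m σ v
... | inj₁ (f , f∈T , p) = inj₁ (f , there f∈T , p)
... | inj₂ none with 0ℤ ℤₚ.<? h m *ᶻ evAt m h σ v
...   | yes p = inj₁ (h , here refl , p)
...   | no ¬p = inj₂ λ { (here refl) → ℤₚ.≮⇒≥ ¬p ; (there i) → none i }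

evAt-shift : ∀ m h σ v δ → evAt m h σ v +ᶻ h m *ᶻ δ ≡ evAt m h σ (v +ᶻ δ)
evAt-shift m h σ v δ = lem (ev m h σ) (h m) v δ
  where
  lem : ∀ e p v δ → (e +ᶻ p *ᶻ v) +ᶻ p *ᶻ δ ≡ e +ᶻ p *ᶻ (v +ᶻ δ)
  lem = solve-∀

shift-≈ : ∀ {C D} m h σ v δ → ∣ δ ∣ ≡ D → (h m ≢ 0ℤ → ∣ h m ∣ * D + C ≤ ∣ evAt m h σ v ∣) →
          evAt m h σ v ≈[ C ] evAt m h σ (v +ᶻ δ)
shift-≈ {C} m h σ v δ refl large with h m ℤ.≟ 0ℤ
... | no h≢0 = subst (evAt m h σ v ≈[ C ]_) (evAt-shift m h σ v δ)
  (≈-shift (evAt m h σ v) (h m *ᶻ δ)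
    (subst (λ t → t + C ≤ ∣ evAt m h σ v ∣) (sym (ℤₚ.abs-* (h m) δ)) (large h≢0)))
... | yes h≡0 = same (trans (sym (ℤₚ.+-identityʳ _))
  (trans (cong (evAt m h σ v +ᶻ_) (sym (cong (_*ᶻ δ) h≡0))) (evAt-shift m h σ v δ)))

i≤0⇒i≡-∣i∣ : ∀ {i} → i ≤ᶻ 0ℤ → i ≡ -ᶻ + ∣ i ∣
i≤0⇒i≡-∣i∣ { + zero}   p = refl
i≤0⇒i≡-∣i∣ { + suc n}  (ℤ.+≤+ ())
i≤0⇒i≡-∣i∣ { -[1+ n ]} p = refl

≢0⇒1≤∣i∣ : ∀ {i} → i ≢ 0ℤ → 1 ≤ ∣ i ∣
≢0⇒1≤∣i∣ {i} i≢0 = n≢0⇒n>0 (λ e → i≢0 (ℤₚ.∣i∣≡0⇒i≡0 e))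

square-∣∣ : ∀ i → i *ᶻ i ≡ + ∣ i ∣ *ᶻ + ∣ i ∣
square-∣∣ (+ n)    = refl
square-∣∣ -[1+ n ] = refl

-i≡-1*i : ∀ i → -ᶻ i ≡ (-ᶻ + 1) *ᶻ i
-i≡-1*i = solve-∀

-- This makes the search for a pivot in settle terminate.
descend : ∀ {C D} m h σ v → 1 ≤ C → 1 ≤ D → ∣ h m ∣ * D + C ≤ ∣ evAt m h σ v ∣ → Descending m σ v h →
  Descending m σ (v +ᶻ -ᶻ + D) h ×
  ∣ h m *ᶻ evAt m h σ (v +ᶻ -ᶻ + D) ∣ < ∣ h m *ᶻ evAt m h σ v ∣
descend {C} {D} m h σ v 1≤C 1≤D large pos =
  subst (0ℤ <ᶻ_) (sym px′) (ℤ.+<+ (*-mono-≤ 1≤p (≤-trans 1≤C (m≤m+n C j)))) ,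
  subst₂ _<_ (sym (cong ∣_∣ px′)) (sym (ℤₚ.abs-* p x))
    (*-monoʳ-< ∣ p ∣ {{ℕ.>-nonZero 1≤p}}
      (subst (C + j <_) (sym x-split) (m<n+m (C + j) (*-mono-≤ 1≤p 1≤D))))
  where
  p = h m
  x = evAt m h σ v
  j = ∣ x ∣ ∸ (∣ p ∣ * D + C)
  x-split : ∣ x ∣ ≡ ∣ p ∣ * D + (C + j)
  x-split = trans (sym (m+[n∸m]≡n large)) (ℕₚ.+-assoc (∣ p ∣ * D) C j)
  p≢0 : p ≢ 0ℤ
  p≢0 p≡0 = ℤₚ.i≮i (subst (0ℤ <ᶻ_) (trans (cong (_*ᶻ x) p≡0) (ℤₚ.*-zeroˡ x)) pos)
  1≤p : 1 ≤ ∣ p ∣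
  1≤p = ≢0⇒1≤∣i∣ p≢0
  px : p *ᶻ x ≡ + (∣ p ∣ * ∣ x ∣)
  px = trans (sym (ℤₚ.0≤i⇒+∣i∣≡i (ℤₚ.<⇒≤ pos))) (cong +_ (ℤₚ.abs-* p x))
  lem₁ : ∀ p e v d → p *ᶻ (e +ᶻ p *ᶻ (v +ᶻ -ᶻ d)) ≡ p *ᶻ (e +ᶻ p *ᶻ v) +ᶻ -ᶻ (p *ᶻ p *ᶻ d)
  lem₁ = solve-∀
  lem₂ : ∀ p d c → p *ᶻ (p *ᶻ d +ᶻ c) +ᶻ -ᶻ (p *ᶻ p *ᶻ d) ≡ p *ᶻ c
  lem₂ = solve-∀
  px′ : p *ᶻ evAt m h σ (v +ᶻ -ᶻ + D) ≡ + (∣ p ∣ * (C + j))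
  px′ = trans (lem₁ p (ev m h σ) v (+ D))
    (trans (cong₂ (λ s t → s +ᶻ -ᶻ (t *ᶻ + D))
             (trans px (trans (cong (λ t → + (∣ p ∣ * t)) x-split)
               (trans (ℤₚ.pos-* ∣ p ∣ _) (cong (+ ∣ p ∣ *ᶻ_) (cong (_+ᶻ + (C + j)) (ℤₚ.pos-* ∣ p ∣ D))))))
             (square-∣∣ p))
      (trans (lem₂ (+ ∣ p ∣) (+ D) (+ (C + j))) (sym (ℤₚ.pos-* ∣ p ∣ (C + j)))))

-- In the second case every form containing the slot is saturated on the side towards which lowering
-- the value drives it, so the value may be lowered indefinitely.
Settled : List Form → ℕ → ℕ → ℕ → Env → ℤ → Set
Settled T m C D σ v =
  (Σ Form λ f → f ∈ T × IsPivot m C D σ v f) ⊎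
  (∀ {h} → h ∈ T → h m ≢ 0ℤ → h m *ᶻ evAt m h σ v ≤ᶻ -ᶻ + (∣ h m ∣ * C))

-- If no form is descending, `v` itself will do. Otherwise one descending form `g` is watched: while
-- no form is a pivot, a step of `-D` brings `g` closer to 0 without changing its sign and preserves
-- all forms up to `C`. A pivot turns up at the latest when `g` is small.
settle : ∀ T m {C D} σ → 1 ≤ C → 1 ≤ D → ∀ v → Σ ℤ λ v₁ →
  Congruent D v v₁ × (∀ {h} → h ∈ T → evAt m h σ v ≈[ C ] evAt m h σ v₁) × Settled T m C D σ v₁
settle T m {C} {D} σ 1≤C 1≤D v with findDescending T m σ v
... | inj₂ none with findPivot T m C D σ v
...   | inj₁ pivot = v , cong-reflexive refl , (λ _ → same refl) , inj₁ pivot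
...   | inj₂ large = v , cong-reflexive refl , (λ _ → same refl) , inj₂ λ {h} h∈T h≢0 →
        subst (_≤ᶻ -ᶻ + (∣ h m ∣ * C))
          (sym (trans (i≤0⇒i≡-∣i∣ (none h∈T)) (cong (λ t → -ᶻ + t) (ℤₚ.abs-* (h m) _))))
          (ℤₚ.neg-mono-≤ (ℤ.+≤+ (*-monoʳ-≤ ∣ h m ∣ (≤-trans (m≤n+m C (∣ h m ∣ * D)) (large h∈T h≢0)))))
settle T m {C} {D} σ 1≤C 1≤D v | inj₁ (g , g∈T , desc) = go _ v desc ≤-refl
  where
  go : ∀ n v → Descending m σ v g → ∣ g m *ᶻ evAt m g σ v ∣ < n → Σ ℤ λ v₁ →
    Congruent D v v₁ × (∀ {h} → h ∈ T → evAt m h σ v ≈[ C ] evAt m h σ v₁) × Settled T m C D σ v₁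
  go (suc n) v desc (s≤s bound) with findPivot T m C D σ v
  ... | inj₁ pivot = v , cong-reflexive refl , (λ _ → same refl) , inj₁ pivot
  ... | inj₂ large with descend m g σ v 1≤C 1≤D (large g∈T g≢0) desc
    where
    g≢0 : g m ≢ 0ℤ
    g≢0 e = ℤₚ.i≮i (subst (0ℤ <ᶻ_) (trans (cong (_*ᶻ evAt m g σ v) e) (ℤₚ.*-zeroˡ (evAt m g σ v))) desc)
  ...   | desc′ , smaller with go n (v +ᶻ -ᶻ + D) desc′ (<-≤-trans smaller bound)
  ...     | v₁ , v′≡v₁ , v′≈v₁ , settled =
    v₁ , cong-trans (by (-ᶻ + 1) (cong (v +ᶻ_) (-i≡-1*i (+ D)))) v′≡v₁ ,
    (λ {h} h∈T → ≈-trans 1≤C (shift-≈ m h σ v (-ᶻ + D) (ℤₚ.∣-i∣≡∣i∣ (+ D)) (large h∈T)) (v′≈v₁ h∈T)) ,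
    settled

open Congruent

module _ (m C D : ℕ) (σ : Env) (w : ℤ) (1≤D : 1 ≤ D) where

  -- Since `D` and every nonzero coefficient have absolute value at least 1, each step moves every
  -- form that contains the slot by at least 1; the sum of all distances is thus enough for all
  -- forms at once.
  steps : List Form → ℕ
  steps T = sum (map (λ h → ∣ evAt m h σ w ∣ + C) T)

  steps-∈ : ∀ {T h} → h ∈ T → ∣ evAt m h σ w ∣ + C ≤ steps T
  steps-∈ (here refl) = m≤m+n _ _
  steps-∈ {g ∷ T} (there i) = ≤-trans (steps-∈ i) (m≤n+m (steps T) (∣ evAt m g σ w ∣ + C))

  descend-far : ∀ h t → ∣ evAt m h σ w ∣ + C ≤ t → h m ≢ 0ℤ →
    h m *ᶻ evAt m h σ (w +ᶻ (-ᶻ + t) *ᶻ + D) ≤ᶻ -ᶻ + (∣ h m ∣ * C)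
  descend-far h t large p≢0 = subst (_≤ᶻ -ᶻ + (∣ p ∣ * C)) (sym expand)
    (subst (p *ᶻ x +ᶻ -ᶻ + (∣ p ∣ * ∣ p ∣ * (t * D)) ≤ᶻ_) cancel
      (ℤₚ.+-mono-≤ (ℤₚ.≤-trans (i≤∣i∣ (p *ᶻ x)) (ℤₚ.≤-reflexive (cong +_ (ℤₚ.abs-* p x))))
                   (ℤₚ.neg-mono-≤ (ℤ.+≤+ growth))))
    where
    p = h m
    x = evAt m h σ w
    1≤p = ≢0⇒1≤∣i∣ p≢0
    growth : ∣ p ∣ * ∣ x ∣ + ∣ p ∣ * C ≤ ∣ p ∣ * ∣ p ∣ * (t * D)
    growth = begin
      ∣ p ∣ * ∣ x ∣ + ∣ p ∣ * C   ≡⟨ sym (*-distribˡ-+ ∣ p ∣ ∣ x ∣ C) ⟩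
      ∣ p ∣ * (∣ x ∣ + C)        ≤⟨ *-mono-≤ {∣ p ∣} {∣ p ∣ * ∣ p ∣}
                                    (m≤m*n ∣ p ∣ ∣ p ∣ {{ℕ.>-nonZero 1≤p}})
                                    (≤-trans large (m≤m*n t D {{ℕ.>-nonZero 1≤D}})) ⟩
      ∣ p ∣ * ∣ p ∣ * (t * D)    ∎
      where open ≤-Reasoning
    lem : ∀ a b → a +ᶻ -ᶻ (a +ᶻ b) ≡ -ᶻ b
    lem = solve-∀
    cancel : + (∣ p ∣ * ∣ x ∣) +ᶻ -ᶻ + (∣ p ∣ * ∣ x ∣ + ∣ p ∣ * C) ≡ -ᶻ + (∣ p ∣ * C)
    cancel = trans (cong (λ s → + (∣ p ∣ * ∣ x ∣) +ᶻ -ᶻ s) (ℤₚ.pos-+ (∣ p ∣ * ∣ x ∣) (∣ p ∣ * C)))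
                   (lem (+ (∣ p ∣ * ∣ x ∣)) (+ (∣ p ∣ * C)))
    lem₂ : ∀ p e v t d → p *ᶻ (e +ᶻ p *ᶻ (v +ᶻ (-ᶻ t) *ᶻ d)) ≡ p *ᶻ (e +ᶻ p *ᶻ v) +ᶻ -ᶻ (p *ᶻ p *ᶻ (t *ᶻ d))
    lem₂ = solve-∀
    expand : p *ᶻ evAt m h σ (w +ᶻ (-ᶻ + t) *ᶻ + D) ≡ p *ᶻ x +ᶻ -ᶻ + (∣ p ∣ * ∣ p ∣ * (t * D))
    expand = trans (lem₂ p (ev m h σ) w (+ t) (+ D))
      (cong (λ s → p *ᶻ x +ᶻ -ᶻ s)
        (trans (cong₂ _*ᶻ_ (trans (square-∣∣ p) (sym (ℤₚ.pos-* ∣ p ∣ ∣ p ∣))) (sym (ℤₚ.pos-* t D))) (sym (ℤₚ.pos-* (∣ p ∣ * ∣ p ∣) (t * D)))))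

-- The factor `∣ p ∣` in the modulus makes the pivot equation solvable over the integers, with a
-- solution in the prescribed class modulo `D`.
congruent-scaled : ∀ p D {x y} → Congruent (∣ p ∣ * D) x y → Σ ℤ λ s → y ≡ x +ᶻ p *ᶻ (s *ᶻ + D)
congruent-scaled (+ n) D {x} (by t eq) =
  t , trans eq (cong (x +ᶻ_) (trans (cong (t *ᶻ_) (ℤₚ.pos-* n D)) (lem t (+ n) (+ D))))
  where
  lem : ∀ t n d → t *ᶻ (n *ᶻ d) ≡ n *ᶻ (t *ᶻ d)
  lem = solve-∀
congruent-scaled -[1+ n ] D {x} (by t eq) =
  -ᶻ t , trans eq (cong (x +ᶻ_) (trans (cong (t *ᶻ_) (ℤₚ.pos-* (suc n) D)) (lem t (+ suc n) (+ D))))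
  where
  lem : ∀ t n d → t *ᶻ (n *ᶻ d) ≡ (-ᶻ n) *ᶻ ((-ᶻ t) *ᶻ d)
  lem = solve-∀

-- `σ′` is quantified after `T₁`, so the branch depends on `σ` only. This is what lets a block keep
-- its lists apart.
BranchTransfers : ℕ → List Form → (C D C′ D′ : ℕ) → Env → List Form → Set
BranchTransfers m T C D C′ D′ σ T₁ = ∀ σ′ → CongruentBelow D′ m σ σ′ →
  (∀ {h} → h ∈ T₁ → ev m h σ ≈[ C′ ] ev m h σ′) →
  Σ ℤ λ y → Congruent D (σ m) y × (∀ {h} → h ∈ T → evAt m h σ (σ m) ≈[ C ] evAt m h σ′ y)

module _ {m C D C′ D′ A : ℕ} {T : List Form} (1≤C : 1 ≤ C) (1≤D : 1 ≤ D) (1≤A : 1 ≤ A)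
  (coefficients : ∀ {h} → h ∈ T → ∣ h m ∣ ≤ A)
  (C′-large : A * (A * D + C) + A * C ≤ C′)
  (D∣D′ : D ∣ D′) (multiples : ∀ {h} → h ∈ T → h m ≢ 0ℤ → ∣ h m ∣ * D ∣ D′) where

  -- `y` is chosen so that `f` has exactly the value `e` on both sides. Then `p` times any form `h`
  -- is its eliminated form plus the same number `h m * e`, whose size is at most `A * (A * D + C)`.
  -- Translating by it must leave the threshold `∣ p ∣ * C`, at most `A * C`, for the division by
  -- `p`. These are the two summands in `C′-large`.
  pivot-transfers : ∀ σ v {f} → Congruent D (σ m) v →
    (∀ {h} → h ∈ T → evAt m h σ (σ m) ≈[ C ] evAt m h σ v) →
    f ∈ T → IsPivot m C D σ v f → BranchTransfers m T C D C′ D′ σ (map (elim m f) T)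
  pivot-transfers σ v {f} σm≡v T≈ f∈T (p≢0 , e-small) σ′ σ≡σ′ T₁≈ =
    y , cong-trans σm≡v (by (-ᶻ s) refl) , λ h∈T → ≈-trans 1≤C (T≈ h∈T) (transfer h∈T)
    where
    p = f m
    e = evAt m f σ v
    signed = congruent-scaled p D (cong-weaken (multiples f∈T p≢0) (ev-congruent m f σ≡σ′))
    s = proj₁ signed
    y = v +ᶻ (-ᶻ s) *ᶻ + D
    y-solves : evAt m f σ′ y ≡ e
    y-solves = trans (cong (_+ᶻ p *ᶻ y) (proj₂ signed)) (lem (ev m f σ) p s (+ D) v)
      where
      lem : ∀ e p s d v → (e +ᶻ p *ᶻ (s *ᶻ d)) +ᶻ p *ᶻ (v +ᶻ (-ᶻ s) *ᶻ d) ≡ e +ᶻ p *ᶻ v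
      lem = solve-∀
    scaled : ∀ h τ u → ev m (elim m f h) τ +ᶻ h m *ᶻ evAt m f τ u ≡ p *ᶻ evAt m h τ u
    scaled h τ u = trans (cong (_+ᶻ h m *ᶻ evAt m f τ u) (ev-combination m p (h m) f h τ))
                         (lem p (ev m h τ) (h m) (ev m f τ) u)
      where
      lem : ∀ p H h F u → (p *ᶻ H -ᶻ h *ᶻ F) +ᶻ h *ᶻ (F +ᶻ p *ᶻ u) ≡ p *ᶻ (H +ᶻ h *ᶻ u)
      lem = solve-∀
    transfer : ∀ {h} → h ∈ T → evAt m h σ v ≈[ C ] evAt m h σ′ y
    transfer {h} h∈T = ≈-cancel p p≢0
      (subst₂ (_≈[ ∣ p ∣ * C ]_) (scaled h σ v)
        (trans (cong (λ t → ev m (elim m f h) σ′ +ᶻ h m *ᶻ t) (sym y-solves)) (scaled h σ′ y))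
        (≈-translate (h m *ᶻ e)
          (≤-trans (+-mono-≤ (*-mono-≤ (coefficients h∈T)
                      (≤-trans (<⇒≤ e-small) (+-monoˡ-≤ C (*-monoˡ-≤ D (coefficients f∈T)))))
                    (*-monoˡ-≤ C (coefficients f∈T))) C′-large)
          (≤-reflexive (ℤₚ.abs-* (h m) e))
          (T₁≈ (∈-map⁺ (elim m f) h∈T))))

  -- Forms without the slot are compared directly. All others are saturated at `v`, and `y` lies so
  -- far below that over `σ′` they are saturated on the same side.
  free-transfers : ∀ σ v → Congruent D (σ m) v →
    (∀ {h} → h ∈ T → evAt m h σ (σ m) ≈[ C ] evAt m h σ v) →
    (∀ {h} → h ∈ T → h m ≢ 0ℤ → h m *ᶻ evAt m h σ v ≤ᶻ -ᶻ + (∣ h m ∣ * C)) →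
    BranchTransfers m T C D C′ D′ σ (filter (λ h → h m ℤ.≟ 0ℤ) T)
  free-transfers σ v σm≡v T≈ negative σ′ σ≡σ′ T₁≈ =
    y , cong-trans σm≡v (by (-ᶻ + t) refl) , λ h∈T → ≈-trans 1≤C (T≈ h∈T) (transfer h∈T)
    where
    t = steps m C D σ′ v 1≤D T
    y = v +ᶻ (-ᶻ + t) *ᶻ + D
    drop : ∀ h τ u → h m ≡ 0ℤ → evAt m h τ u ≡ ev m h τ
    drop h τ u e = trans (cong (λ a → ev m h τ +ᶻ a *ᶻ u) e)
                         (trans (cong (ev m h τ +ᶻ_) (ℤₚ.*-zeroˡ u)) (ℤₚ.+-identityʳ _))
    C≤C′ : C ≤ C′
    C≤C′ = ≤-trans (≤-trans (m≤n*m C A {{ℕ.>-nonZero 1≤A}}) (m≤n+m (A * C) (A * (A * D + C)))) C′-large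
    transfer : ∀ {h} → h ∈ T → evAt m h σ v ≈[ C ] evAt m h σ′ y
    transfer {h} h∈T with h m ℤ.≟ 0ℤ
    ... | yes h≡0 = subst₂ (_≈[ C ]_) (sym (drop h σ v h≡0)) (sym (drop h σ′ y h≡0))
          (≈-weaken C≤C′ (T₁≈ (∈-filter⁺ (λ h → h m ℤ.≟ 0ℤ) h∈T h≡0)))
    ... | no h≢0 = ≈-cancel (h m) h≢0
          (low (negative h∈T h≢0) (descend-far m C D σ′ v 1≤D h t (steps-∈ m C D σ′ v 1≤D h∈T) h≢0))

  some-branch-transfers : ∀ σ → Σ (List Form) λ T₁ → T₁ ∈ branches m T × BranchTransfers m T C D C′ D′ σ T₁
  some-branch-transfers σ with settle T m σ 1≤C 1≤D (σ m)
  ... | v , σm≡v , T≈ , inj₁ (f , f∈T , pivot) =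
    _ , there (∈-map⁺ (λ f → map (elim m f) T) f∈T) , pivot-transfers σ v σm≡v T≈ f∈T pivot
  ... | v , σm≡v , T≈ , inj₂ negative =
    _ , here refl , free-transfers σ v σm≡v T≈ negative

-- Blocks and levels

-- Clamping threshold 2 ^ w and modulus D; the coefficients are bounded by 2 ^ α.
record Sys : Set where
  constructor sys
  field
    forms : List Form
    α w D : ℕ

-- `D≤` lets one exponent control threshold and modulus, so the size estimates follow `w` without a
-- separate recursion for the modulus.
record Good (S : Sys) : Set where
  open Sys S
  field
    norm≤ : ∀ {h} → h ∈ forms → ∀ m → norm m h ≤ 2 ^ α
    1≤D   : 1 ≤ D
    D≤    : D ≤ 2 ^ w

record _≋[_,_]_ (σ : Env) (S : Sys) (m : ℕ) (σ′ : Env) : Set where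
  constructor _&_
  field
    congruent : CongruentBelow (Sys.D S) m σ σ′
    close     : ∀ {h} → h ∈ Sys.forms S → ev m h σ ≈[ 2 ^ Sys.w S ] ev m h σ′

≋-sym : ∀ {S m σ σ′} → σ ≋[ S , m ] σ′ → σ′ ≋[ S , m ] σ
≋-sym (p & q) = (λ i<m → cong-sym (p i<m)) & (λ h∈ → ≈-sym (q h∈))

≋-agree : ∀ {S m σ τ σ′} → AgreeBelow m σ τ → τ ≋[ S , m ] σ′ → σ ≋[ S , m ] σ′
≋-agree {S} {m} {σ} {τ} {σ′} a (p & q) =
  (λ {i} i<m → subst (λ x → Congruent (Sys.D S) x (σ′ i)) (sym (a i<m)) (p i<m)) &
  (λ {h} h∈ → subst (_≈[ 2 ^ Sys.w S ] ev m h σ′) (sym (ev-agree m h a)) (q h∈))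

≋-refl : ∀ {S m σ} → σ ≋[ S , m ] σ
≋-refl = (λ _ → cong-reflexive refl) & (λ _ → same refl)

update-same : ∀ (σ : Env) m v → (σ [ m ↦ v ]) m ≡ v
update-same σ m v = cong (if_then v else σ m) (dec-true (m ℕₚ.≟ m) refl)

update-other : ∀ (σ : Env) {m i} v → i ≢ m → (σ [ m ↦ v ]) i ≡ σ i
update-other σ {m} {i} v i≢m = cong (if_then v else σ i) (dec-false (i ℕₚ.≟ m) i≢m)

update-below : ∀ σ m v → AgreeBelow m σ (σ [ m ↦ v ])
update-below σ m v i<m = sym (update-other σ v (<⇒≢ i<m))

ev-update : ∀ m h σ v → evAt m h σ v ≡ ev (suc m) h (σ [ m ↦ v ])
ev-update m h σ v = cong₂ (λ e x → e +ᶻ h m *ᶻ x) (ev-agree m h (update-below σ m v)) (sym (update-same σ m v))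

-- At any time one of the lists suffices, depending on the assignment; the pivots of one list never
-- meet the forms of another. The modulus, unlike the forms, is shared by all lists.
record Stage : Set where
  constructor stage
  field
    alternatives : List (List Form)
    α w D : ℕ
  all-forms : List Form
  all-forms = concat alternatives

_at_ : Stage → List Form → Sys
st at T = sys T (Stage.α st) (Stage.w st) (Stage.D st)

flatten : Stage → Sys
flatten st = st at Stage.all-forms st

-- suc (pred ∣ h m ∣) is ∣ h m ∣, except that a zero coefficient is replaced by 1.
multiplier : ℕ → List Form → ℕ
multiplier m T = product (map (λ h → suc (ℕ.pred ∣ h m ∣)) T)

-- An eliminated form has norm at most `2 * 2 ^ α * 2 ^ α`, which gives the new `α`. In the new `w`,
-- the summand `α + α + 2` pays for `C′-large` (see `threshold-large`) and `α * length all-forms`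
-- for the growth of the modulus, with one factor of at most `2 ^ α` per form.
next : ℕ → Stage → Stage
next m st = stage (concatMap (branches m) alternatives)
  (suc (α + α)) (w + (α + α + 2) + α * length all-forms) (D * multiplier m all-forms)
  where open Stage st

stages : ℕ → ℕ → Stage → Stage
stages zero    m st = st
stages (suc j) m st = stages j m (next (j + m) st)

block : ℕ → ℕ → Sys → Sys
block b m (sys T α w D) = flatten (stages b m (stage (T ∷ []) α w D))

-- `m` counts the slots that remain: `S` lives on `k * b + m` slots, and every block occupies `b` of
-- them, even where the formula has fewer quantifiers.
level : ℕ → Sys → ℕ → ℕ → Sys
level b S zero    m = S
level b S (suc k) m = block b m (level b S k (b + m))

1≤2^ : ∀ n → 1 ≤ 2 ^ n
1≤2^ n = m^n>0 2 n

coefficient≤norm : ∀ m h → ∣ h m ∣ ≤ norm (suc m) h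
coefficient≤norm m h = m≤n+m ∣ h m ∣ (norm m h)

norm-elim : ∀ k m f h → norm k (elim m f h) ≤ ∣ f m ∣ * norm k h + ∣ h m ∣ * norm k f
norm-elim zero    m f h = z≤n
norm-elim (suc k) m f h = begin
  norm k (elim m f h) + ∣ elim m f h k ∣
    ≤⟨ +-mono-≤ (norm-elim k m f h) (≤-trans (ℤₚ.∣i-j∣≤∣i∣+∣j∣ (f m *ᶻ h k) (h m *ᶻ f k))
        (≤-reflexive (cong₂ _+_ (ℤₚ.abs-* (f m) (h k)) (ℤₚ.abs-* (h m) (f k))))) ⟩
  (∣ f m ∣ * norm k h + ∣ h m ∣ * norm k f) + (∣ f m ∣ * ∣ h k ∣ + ∣ h m ∣ * ∣ f k ∣)
    ≡⟨ lem (∣ f m ∣) (norm k h) (∣ h m ∣) (norm k f) (∣ h k ∣) (∣ f k ∣) ⟩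
  ∣ f m ∣ * (norm k h + ∣ h k ∣) + ∣ h m ∣ * (norm k f + ∣ f k ∣) ∎
  where
  open ≤-Reasoning
  lem : ∀ a b c d e f → (a * b + c * d) + (a * e + c * f) ≡ a * (b + e) + c * (d + f)
  lem = solveℕ-∀

multiplier-≥1 : ∀ m T → 1 ≤ multiplier m T
multiplier-≥1 m []      = ≤-refl
multiplier-≥1 m (h ∷ T) = *-mono-≤ {1} {suc (ℕ.pred ∣ h m ∣)} (s≤s z≤n) (multiplier-≥1 m T)

multiplier-≤ : ∀ m T α → (∀ {h} → h ∈ T → ∣ h m ∣ ≤ 2 ^ α) → multiplier m T ≤ 2 ^ (α * length T)
multiplier-≤ m []      α bound = subst (λ e → 1 ≤ 2 ^ e) (sym (*-zeroʳ α)) ≤-refl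
multiplier-≤ m (h ∷ T) α bound = begin
  suc (ℕ.pred ∣ h m ∣) * multiplier m T ≤⟨ *-mono-≤ (sp≤ (bound (here refl))) (multiplier-≤ m T α (λ i → bound (there i))) ⟩
  2 ^ α * 2 ^ (α * length T)     ≡⟨ sym (^-distribˡ-+-* 2 α (α * length T)) ⟩
  2 ^ (α + α * length T)         ≡⟨ cong (2 ^_) (sym (*-suc α (length T))) ⟩
  2 ^ (α * suc (length T))       ∎
  where
  open ≤-Reasoning
  sp≤ : ∀ {n} → n ≤ 2 ^ α → suc (ℕ.pred n) ≤ 2 ^ α
  sp≤ {zero}  p = 1≤2^ α
  sp≤ {suc n} p = p

multiplier-∣ : ∀ m T {h} → h ∈ T → h m ≢ 0ℤ → ∣ h m ∣ ∣ multiplier m T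
multiplier-∣ m T {h} h∈T h≢0 = subst (_∣ multiplier m T) (suc-pred ∣ h m ∣ {{ℕ.>-nonZero (≢0⇒1≤∣i∣ h≢0)}})
  (∈⇒∣product (∈-map⁺ (λ h → suc (ℕ.pred ∣ h m ∣)) h∈T))

module _ (m : ℕ) (st : Stage) (good : Good (flatten st)) where
  open Stage st
  open Good good

  private
    coefficient≤ : ∀ {h} → h ∈ all-forms → ∣ h m ∣ ≤ 2 ^ α
    coefficient≤ {h} h∈ = ≤-trans (coefficient≤norm m h) (norm≤ h∈ (suc m))

  next-forms-norm : ∀ {h} → h ∈ Stage.all-forms (next m st) → ∀ k → norm k h ≤ 2 ^ suc (α + α)
  next-forms-norm {h} h∈ k with ∈-concat⁻′ (concatMap (branches m) alternatives) h∈
  ... | T₁ , h∈T₁ , T₁∈ with ∈-concat⁻′ (map (branches m) alternatives) T₁∈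
  ...   | Ts , T₁∈Ts , Ts∈ with ∈-map⁻ (branches m) Ts∈
  ...     | T , T∈ , refl with T₁∈Ts
  ...       | here refl = ≤-trans (norm≤ (∈-concat⁺′ (proj₁ (∈-filter⁻ (λ h → h m ℤ.≟ 0ℤ) h∈T₁)) T∈) k)
                            (^-monoʳ-≤ 2 (≤-trans (m≤m+n α α) (n≤1+n (α + α))))
  ...       | there T₁∈′ with ∈-map⁻ (λ f → map (elim m f) T) T₁∈′
  ...         | f , f∈T , refl with ∈-map⁻ (elim m f) h∈T₁
  ...           | g , g∈T , refl = begin
    norm k (elim m f g)                         ≤⟨ norm-elim k m f g ⟩
    ∣ f m ∣ * norm k g + ∣ g m ∣ * norm k f     ≤⟨ +-mono-≤ (*-mono-≤ (coefficient≤ f∈) (norm≤ g∈ k))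
                                                            (*-mono-≤ (coefficient≤ g∈) (norm≤ f∈ k)) ⟩
    2 ^ α * 2 ^ α + 2 ^ α * 2 ^ α               ≡⟨ cong₂ _+_ (sym (^-distribˡ-+-* 2 α α))
                                                       (trans (sym (^-distribˡ-+-* 2 α α)) (sym (+-identityʳ _))) ⟩
    2 ^ suc (α + α)                             ∎
    where
    open ≤-Reasoning
    f∈ = ∈-concat⁺′ f∈T T∈
    g∈ = ∈-concat⁺′ g∈T T∈

  next-good : Good (flatten (next m st))
  next-good = record
    { norm≤ = next-forms-norm
    ; 1≤D = *-mono-≤ 1≤D (multiplier-≥1 m all-forms)
    ; D≤ = begin
        D * multiplier m all-forms       ≤⟨ *-mono-≤ D≤ (multiplier-≤ m all-forms α coefficient≤) ⟩
        2 ^ w * 2 ^ (α * length all-forms) ≡⟨ sym (^-distribˡ-+-* 2 w _) ⟩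
        2 ^ (w + α * length all-forms)   ≤⟨ ^-monoʳ-≤ 2 (+-monoˡ-≤ (α * length all-forms) (m≤m+n w (α + α + 2))) ⟩
        2 ^ (w + (α + α + 2) + α * length all-forms) ∎
    }
    where open ≤-Reasoning

  threshold-large : 2 ^ α * (2 ^ α * D + 2 ^ w) + 2 ^ α * 2 ^ w ≤ 2 ^ Stage.w (next m st)
  threshold-large = begin
    2 ^ α * (2 ^ α * D + 2 ^ w) + 2 ^ α * 2 ^ w
      ≤⟨ +-mono-≤ (*-monoʳ-≤ (2 ^ α) (+-mono-≤ (*-monoʳ-≤ (2 ^ α) D≤) (m≤n*m (2 ^ w) (2 ^ α) {{m^n≢0 2 α}})))
                  (*-monoʳ-≤ (2 ^ α) (m≤n*m (2 ^ w) (2 ^ α) {{m^n≢0 2 α}})) ⟩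
    2 ^ α * (2 ^ α * 2 ^ w + 2 ^ α * 2 ^ w) + 2 ^ α * (2 ^ α * 2 ^ w)
      -- A fourth copy completes the factor 3 to a power of 2.
      ≤⟨ m≤m+n _ (2 ^ α * (2 ^ α * 2 ^ w)) ⟩
    2 ^ α * (2 ^ α * 2 ^ w + 2 ^ α * 2 ^ w) + 2 ^ α * (2 ^ α * 2 ^ w) + 2 ^ α * (2 ^ α * 2 ^ w)
      ≡⟨ lem (2 ^ α) (2 ^ w) ⟩
    2 ^ w * (2 ^ α * 2 ^ α * 4)
      ≡⟨ sym (trans (^-distribˡ-+-* 2 w _) (cong (2 ^ w *_) (trans (^-distribˡ-+-* 2 (α + α) 2)
           (cong (_* 4) (^-distribˡ-+-* 2 α α))))) ⟩
    2 ^ (w + (α + α + 2))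
      ≤⟨ ^-monoʳ-≤ 2 (m≤m+n (w + (α + α + 2)) (α * length all-forms)) ⟩
    2 ^ (w + (α + α + 2) + α * length all-forms) ∎
    where
    open ≤-Reasoning
    lem : ∀ a w → a * (a * w + a * w) + a * (a * w) + a * (a * w) ≡ w * (a * a * 4)
    lem = solveℕ-∀

  next-transfers : ∀ {T} → T ∈ alternatives → ∀ σ → Σ (List Form) λ T₁ →
    T₁ ∈ Stage.alternatives (next m st) ×
    (∀ σ′ → σ ≋[ next m st at T₁ , m ] σ′ → Σ ℤ λ y → σ ≋[ st at T , suc m ] (σ′ [ m ↦ y ]))
  next-transfers {T} T∈ σ
    with some-branch-transfers {m} {2 ^ w} {D} {2 ^ Stage.w (next m st)} {Stage.D (next m st)} {2 ^ α} {T}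
           (1≤2^ w) 1≤D (1≤2^ α)
           (λ h∈T → coefficient≤ (∈-concat⁺′ h∈T T∈)) threshold-large
           (∣.m∣m*n (multiplier m all-forms))
           (λ {h} h∈T h≢0 → subst (_∣ D * multiplier m all-forms) (*-comm D ∣ h m ∣)
             (∣.*-monoʳ-∣ D (multiplier-∣ m all-forms (∈-concat⁺′ h∈T T∈) h≢0))) σ
  ... | T₁ , T₁∈ , transfers = T₁ , ∈-concat⁺′ T₁∈ (∈-map⁺ (branches m) T∈) , λ { σ′ (σ≡σ′ & σ≈σ′) →
    let y , σm≡y , T≈ = transfers σ′ σ≡σ′ σ≈σ′ in
    y ,
    (λ {i} i<sm → congruent′ i σ′ y σ≡σ′ σm≡y i<sm) &
    (λ {h} h∈T → subst (ev (suc m) h σ ≈[ 2 ^ w ]_) (ev-update m h σ′ y) (T≈ h∈T)) }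
    where
    congruent′ : ∀ i σ′ y → CongruentBelow (Stage.D (next m st)) m σ σ′ → Congruent D (σ m) y →
                i < suc m → Congruent D (σ i) ((σ′ [ m ↦ y ]) i)
    congruent′ i σ′ y σ≡σ′ σm≡y i<sm with i ℕₚ.≟ m
    ... | yes refl = subst (Congruent D (σ m)) (sym (update-same σ′ m y)) σm≡y
    ... | no i≢m   = subst (Congruent D (σ i)) (sym (update-other σ′ y i≢m))
      (cong-weaken (∣.m∣m*n (multiplier m all-forms)) (σ≡σ′ (≤∧≢⇒< (ℕ.s≤s⁻¹ i<sm) i≢m)))

stages-good : ∀ j m st → Good (flatten st) → Good (flatten (stages j m st))
stages-good zero    m st good = good
stages-good (suc j) m st good = stages-good j m (next (j + m) st) (next-good (j + m) st good)

-- Only the last stage is flattened. Each step moves from `T` to the one list that `σ` selects, and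
-- the hypothesis about all forms is applied at the end to the list where these choices lead.
stages-transfers : ∀ j m st → Good (flatten st) → ∀ {T} → T ∈ Stage.alternatives st → ∀ σ σ′ →
  σ ≋[ flatten (stages j m st) , m ] σ′ →
  Σ Env λ σ″ → AgreeBelow m σ′ σ″ × σ ≋[ st at T , j + m ] σ″
stages-transfers zero m st good T∈ σ σ′ (p & q) = σ′ , (λ _ → refl) , p & λ h∈T → q (∈-concat⁺′ h∈T T∈)
stages-transfers (suc j) m st good T∈ σ σ′ σ≋σ′ with next-transfers (j + m) st good T∈ σ
... | T₁ , T₁∈ , transfers
  with stages-transfers j m (next (j + m) st) (next-good (j + m) st good) T₁∈ σ σ′ σ≋σ′
...   | τ , σ′~τ , σ≋τ with transfers τ σ≋τ
...     | y , σ≋τ[y] = τ [ j + m ↦ y ] ,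
  (λ i<m → trans (σ′~τ i<m) (update-below τ (j + m) y (<-≤-trans i<m (m≤n+m m j)))) , σ≋τ[y]

-- The forth condition of an Ehrenfeucht-Fraïssé game in which a move fixes `b` slots at once.
block-transfers : ∀ b m S → Good S → ∀ σ σ′ → σ ≋[ block b m S , m ] σ′ →
  Σ Env λ σ″ → AgreeBelow m σ′ σ″ × σ ≋[ S , b + m ] σ″
block-transfers b m S@(sys T α w D) good σ σ′ σ≋σ′ =
  stages-transfers b m (stage (T ∷ []) α w D) (subst (λ Z → Good (sys Z α w D)) (sym (++-identityʳ T)) good) (here refl) σ σ′ σ≋σ′

block-good : ∀ b m S → Good S → Good (block b m S)
block-good b m S@(sys T α w D) good =
  stages-good b m (stage (T ∷ []) α w D) (subst (λ Z → Good (sys Z α w D)) (sym (++-identityʳ T)) good)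

level-good : ∀ b S k m → Good S → Good (level b S k m)
level-good b S zero    m good = good
level-good b S (suc k) m good = block-good b m _ (level-good b S k (b + m) good)

-- Atoms as linear forms

unit : ℕ → Form
unit j i = if i ℕ.≡ᵇ j then 1ℤ else 0ℤ

unit-same : ∀ j → unit j j ≡ 1ℤ
unit-same j = cong (if_then 1ℤ else 0ℤ) (dec-true (j ℕₚ.≟ j) refl)

unit-other : ∀ {i j} → i ≢ j → unit j i ≡ 0ℤ
unit-other {i} {j} i≢j = cong (if_then 1ℤ else 0ℤ) (dec-false (i ℕₚ.≟ j) i≢j)

ev-unit-≥ : ∀ m {j} σ → m ≤ j → ev m (unit j) σ ≡ 0ℤ
ev-unit-≥ zero    σ m≤j = refl
ev-unit-≥ (suc m) σ m<j = cong₂ (λ e c → e +ᶻ c *ᶻ σ m) (ev-unit-≥ m σ (<⇒≤ m<j)) (unit-other (<⇒≢ m<j))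

ev-unit : ∀ m {j} σ → j < m → ev m (unit j) σ ≡ σ j
ev-unit (suc m) {j} σ j<sm with m ℕₚ.≟ j
... | yes refl = trans (cong₂ (λ e c → e +ᶻ c *ᶻ σ m) (ev-unit-≥ m σ ≤-refl) (unit-same m))
                       (trans (ℤₚ.+-identityˡ _) (ℤₚ.*-identityˡ (σ m)))
... | no m≢j   = trans (cong₂ (λ e c → e +ᶻ c *ᶻ σ m) (ev-unit m σ (≤∧≢⇒< (ℕ.s≤s⁻¹ j<sm) (m≢j ∘ sym))) (unit-other m≢j))
                       (ℤₚ.+-identityʳ (σ j))

norm-unit-≥ : ∀ m {j} → m ≤ j → norm m (unit j) ≡ 0
norm-unit-≥ zero    m≤j = refl
norm-unit-≥ (suc m) m<j = cong₂ (λ e c → e + ∣ c ∣) (norm-unit-≥ m (<⇒≤ m<j)) (unit-other (<⇒≢ m<j))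

norm-unit : ∀ m j → norm m (unit j) ≤ 1
norm-unit zero    j = z≤n
norm-unit (suc m) j with m ℕₚ.≟ j
... | yes refl = ≤-reflexive (cong₂ (λ e c → e + ∣ c ∣) (norm-unit-≥ m ≤-refl) (unit-same m))
... | no m≢j   = subst (_≤ 1) (trans (sym (+-identityʳ _)) (cong (λ c → norm m (unit j) + ∣ c ∣) (sym (unit-other m≢j))))
                       (norm-unit m j)

coefficients : (Var → ℕ) → Term → Form
coefficients ν `0      i = 0ℤ
coefficients ν `1      i = 0ℤ
coefficients ν (var x) i = unit (ν x) i
coefficients ν (- t)   i = -ᶻ coefficients ν t i
coefficients ν (t ⊕ u) i = coefficients ν t i +ᶻ coefficients ν u i

constant : Term → ℤ
constant `0      = 0ℤ
constant `1      = 1ℤ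
constant (var x) = 0ℤ
constant (- t)   = -ᶻ constant t
constant (t ⊕ u) = constant t +ᶻ constant u

leaves : Term → ℕ
leaves `0      = 1
leaves `1      = 1
leaves (var x) = 1
leaves (- t)   = leaves t
leaves (t ⊕ u) = leaves t + leaves u

constant≤leaves : ∀ t → ∣ constant t ∣ ≤ leaves t
constant≤leaves `0      = z≤n
constant≤leaves `1      = ≤-refl
constant≤leaves (var x) = z≤n
constant≤leaves (- t)   = subst (_≤ leaves t) (sym (ℤₚ.∣-i∣≡∣i∣ (constant t))) (constant≤leaves t)
constant≤leaves (t ⊕ u) = ≤-trans (ℤₚ.∣i+j∣≤∣i∣+∣j∣ (constant t) (constant u)) (+-mono-≤ (constant≤leaves t) (constant≤leaves u))

norm-zero : ∀ m → norm m (λ _ → 0ℤ) ≡ 0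
norm-zero zero    = refl
norm-zero (suc m) = trans (+-identityʳ _) (norm-zero m)

norm≤leaves : ∀ ν t m → norm m (coefficients ν t) ≤ leaves t
norm≤leaves ν `0      m = ≤-trans (≤-reflexive (norm-zero m)) z≤n
norm≤leaves ν `1      m = ≤-trans (≤-reflexive (norm-zero m)) z≤n
norm≤leaves ν (var x) m = norm-unit m (ν x)
norm≤leaves ν (- t)   m = ≤-trans (≤-reflexive (norm-neg m)) (norm≤leaves ν t m)
  where
  norm-neg : ∀ m → norm m (coefficients ν (- t)) ≡ norm m (coefficients ν t)
  norm-neg zero    = refl
  norm-neg (suc m) = cong₂ _+_ (norm-neg m) (ℤₚ.∣-i∣≡∣i∣ (coefficients ν t m))
norm≤leaves ν (t ⊕ u) m = ≤-trans (norm-+ m) (+-mono-≤ (norm≤leaves ν t m) (norm≤leaves ν u m))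
  where
  f = coefficients ν t
  g = coefficients ν u
  norm-+ : ∀ m → norm m (coefficients ν (t ⊕ u)) ≤ norm m f + norm m g
  norm-+ zero    = z≤n
  norm-+ (suc m) = ≤-trans (+-mono-≤ (norm-+ m) (ℤₚ.∣i+j∣≤∣i∣+∣j∣ (f m) (g m)))
                           (≤-reflexive (lem (norm m f) (norm m g) (∣ f m ∣) (∣ g m ∣)))
    where
    lem : ∀ a b c d → (a + b) + (c + d) ≡ (a + c) + (b + d)
    lem = solveℕ-∀

ev-coefficients : ∀ m ν t {σ} → (∀ {x} → OccT x t → ν x < m) →
                  evalT (σ ∘ ν) t ≡ ev m (coefficients ν t) σ +ᶻ constant t
ev-coefficients m ν t {σ} = go t
  where
  ev-zero : ∀ m → ev m (λ _ → 0ℤ) σ ≡ 0ℤ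
  ev-zero zero    = refl
  ev-zero (suc m) = trans (ℤₚ.+-identityʳ _) (ev-zero m)
  ev-neg : ∀ t m → ev m (coefficients ν (- t)) σ ≡ -ᶻ ev m (coefficients ν t) σ
  ev-neg t zero    = refl
  ev-neg t (suc m) = trans (cong (_+ᶻ (-ᶻ coefficients ν t m) *ᶻ σ m) (ev-neg t m))
                           (lem (ev m (coefficients ν t) σ) (coefficients ν t m) (σ m))
    where
    lem : ∀ e c s → -ᶻ e +ᶻ (-ᶻ c) *ᶻ s ≡ -ᶻ (e +ᶻ c *ᶻ s)
    lem = solve-∀
  ev-+ : ∀ t u m → ev m (coefficients ν (t ⊕ u)) σ ≡ ev m (coefficients ν t) σ +ᶻ ev m (coefficients ν u) σ
  ev-+ t u zero    = refl
  ev-+ t u (suc m) = trans (cong (_+ᶻ (coefficients ν t m +ᶻ coefficients ν u m) *ᶻ σ m) (ev-+ t u m))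
    (lem (ev m (coefficients ν t) σ) (ev m (coefficients ν u) σ) (coefficients ν t m) (coefficients ν u m) (σ m))
    where
    lem : ∀ e e′ c c′ s → (e +ᶻ e′) +ᶻ (c +ᶻ c′) *ᶻ s ≡ (e +ᶻ c *ᶻ s) +ᶻ (e′ +ᶻ c′ *ᶻ s)
    lem = solve-∀
  go : ∀ t → (∀ {x} → OccT x t → ν x < m) → evalT (σ ∘ ν) t ≡ ev m (coefficients ν t) σ +ᶻ constant t
  go `0 _ = sym (trans (ℤₚ.+-identityʳ _) (ev-zero m))
  go `1 _ = sym (cong (_+ᶻ 1ℤ) (ev-zero m))
  go (var x) ν< = sym (trans (ℤₚ.+-identityʳ _) (ev-unit m σ (ν< refl)))
  go (- t) ν< = trans (cong -ᶻ_ (go t ν<)) (trans (ℤₚ.neg-distrib-+ (ev m (coefficients ν t) σ) (constant t))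
                      (cong (_+ᶻ -ᶻ constant t) (sym (ev-neg t m))))
  go (t ⊕ u) ν< = trans (cong₂ _+ᶻ_ (go t (ν< ∘ inj₁)) (go u (ν< ∘ inj₂)))
    (trans (lem (ev m (coefficients ν t) σ) (ev m (coefficients ν u) σ) (constant t) (constant u))
           (cong (_+ᶻ (constant t +ᶻ constant u)) (sym (ev-+ t u m))))
    where
    lem : ∀ a b c d → (a +ᶻ c) +ᶻ (b +ᶻ d) ≡ (a +ᶻ b) +ᶻ (c +ᶻ d)
    lem = solve-∀

evalR-difference : ∀ R {a b} → evalR R a b → evalR R (a +ᶻ -ᶻ b) 0ℤ
evalR-difference EQ {a} refl = ℤₚ.+-inverseʳ a
evalR-difference NE {a} {b} a≢b = a≢b ∘ ℤₚ.i-j≡0⇒i≡j a b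
evalR-difference LT {a} {b} p = subst (a +ᶻ -ᶻ b <ᶻ_) (ℤₚ.+-inverseʳ b) (ℤₚ.+-monoˡ-< (-ᶻ b) p)
evalR-difference LE {a} {b} p = ℤₚ.i≤j⇒i-j≤0 p
evalR-difference GT {a} {b} p = subst (_<ᶻ a +ᶻ -ᶻ b) (ℤₚ.+-inverseʳ b) (ℤₚ.+-monoˡ-< (-ᶻ b) p)
evalR-difference GE {a} {b} p = ℤₚ.i≤j⇒0≤j-i p

difference-evalR : ∀ R {a b} → evalR R (a +ᶻ -ᶻ b) 0ℤ → evalR R a b
difference-evalR EQ {a} {b} p = ℤₚ.i-j≡0⇒i≡j a b p
difference-evalR NE {a} p refl = p (ℤₚ.+-inverseʳ a)
difference-evalR LT {a} {b} p = subst₂ _<ᶻ_ (lem a b) (ℤₚ.+-identityˡ b) (ℤₚ.+-monoˡ-< b p)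
  where
  lem : ∀ a b → (a +ᶻ -ᶻ b) +ᶻ b ≡ a
  lem = solve-∀
difference-evalR LE p = ℤₚ.i-j≤0⇒i≤j p
difference-evalR GT {a} {b} p = subst₂ _<ᶻ_ (ℤₚ.+-identityˡ b) (lem a b) (ℤₚ.+-monoˡ-< b p)
  where
  lem : ∀ a b → (a +ᶻ -ᶻ b) +ᶻ b ≡ a
  lem = solve-∀
difference-evalR GE p = ℤₚ.0≤i-j⇒j≤i p

-- The classes for threshold 1 are the three signs, and a comparison with 0 depends on the sign
-- alone.
evalR-≈ : ∀ R {x y} → x ≈[ 1 ] y → evalR R x 0ℤ → evalR R y 0ℤ
evalR-≈ R (same refl) r = r
evalR-≈ EQ (high (ℤ.+≤+ ()) _) refl
evalR-≈ NE (high _ (ℤ.+≤+ ())) _ refl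
evalR-≈ LT (high (ℤ.+≤+ (s≤s _)) _) (ℤ.+<+ ())
evalR-≈ LE (high (ℤ.+≤+ (s≤s _)) _) (ℤ.+≤+ ())
evalR-≈ GT (high _ (ℤ.+≤+ p)) _ = ℤ.+<+ p
evalR-≈ GE (high _ (ℤ.+≤+ p)) _ = ℤ.+≤+ z≤n
evalR-≈ EQ (low () _) refl
evalR-≈ NE (low _ ()) _ refl
evalR-≈ LT (low _ (ℤ.-≤- _)) _ = ℤ.-<+
evalR-≈ LE (low _ (ℤ.-≤- _)) _ = ℤ.-≤+
evalR-≈ GT (low (ℤ.-≤- _) _) ()
evalR-≈ GE (low (ℤ.-≤- _) _) ()

evalR? : ∀ R a b → Dec (evalR R a b)
evalR? EQ a b = a ℤₚ.≟ b
evalR? NE a b = ¬? (a ℤₚ.≟ b)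
evalR? LT a b = a ℤₚ.<? b
evalR? LE a b = a ℤₚ.≤? b
evalR? GT a b = b ℤₚ.<? a
evalR? GE a b = b ℤₚ.≤? a

difference : Term → Term → Term
difference t u = t ⊕ (- u)

n<2^n : ∀ n → n < 2 ^ n
n<2^n zero    = s≤s z≤n
n<2^n (suc n) = begin
  suc (suc n)     ≤⟨ +-mono-≤ (1≤2^ n) (n<2^n n) ⟩
  2 ^ n + 2 ^ n   ≡⟨ cong (λ k → 2 ^ n + k) (sym (+-identityʳ (2 ^ n))) ⟩
  2 ^ suc n       ∎
  where open ≤-Reasoning

-- The form omits the constant of the difference. Adding it back costs at most `w` of the threshold
-- `2 ^ w`, which leaves at least 1, as `w < 2 ^ w`.
atom-invariant : ∀ S m ν R t u → (∀ {x} → OccT x t ⊎ OccT x u → ν x < m) →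
  coefficients ν (difference t u) ∈ Sys.forms S → leaves t + leaves u ≤ Sys.w S → ∀ {σ σ′} →
  σ ≋[ S , m ] σ′ → Sat (σ ∘ ν) (atom R t u) → Sat (σ′ ∘ ν) (atom R t u)
atom-invariant S m ν R t u ν< h∈ ≤w {σ} {σ′} (_ & σ≈σ′) r =
  difference-evalR R (evalR-≈ R
    (subst₂ (_≈[ 1 ]_) (sym (ev-coefficients m ν d ν<)) (sym (ev-coefficients m ν d ν<))
      (≈-translate (constant d) (≤-trans (≤-reflexive (+-comm ∣ constant d ∣ 1))
          (≤-trans (s≤s (≤-trans (constant≤leaves d) ≤w)) (n<2^n (Sys.w S))))
        ≤-refl (σ≈σ′ h∈)))
    (evalR-difference R r))
  where d = difference t u

evalT-congruent : ∀ {D} ν m t {σ σ′} → (∀ {x} → OccT x t → ν x < m) → CongruentBelow D m σ σ′ →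
                  Congruent D (evalT (σ ∘ ν) t) (evalT (σ′ ∘ ν) t)
evalT-congruent ν m t ν< c = subst₂ (Congruent _) (sym (ev-coefficients m ν t ν<)) (sym (ev-coefficients m ν t ν<))
  (cong-+ (ev-congruent m (coefficients ν t) c) (cong-reflexive refl))

congruent-∣ : ∀ {D x y} → Congruent D x y → (+ D) Unsigned.∣ x → (+ D) Unsigned.∣ y
congruent-∣ {D} {x} (by t refl) p =
  Signed.∣⇒∣ᵤ (Signed.∣m∣n⇒∣m+n (Signed.∣ᵤ⇒∣ {+ D} {x} p) (Signed.∣n⇒∣m*n t Signed.∣-refl))

dvd-invariant : ∀ S m ν d 2≤d t → (∀ {x} → OccT x t → ν x < m) → d ∣ Sys.D S → ∀ {σ σ′} →
  σ ≋[ S , m ] σ′ → Sat (σ ∘ ν) (dvd d 2≤d t) → Sat (σ′ ∘ ν) (dvd d 2≤d t)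
dvd-invariant S m ν d 2≤d t ν< d∣D (c & _) =
  congruent-∣ (evalT-congruent ν m t ν< (λ i<m → cong-weaken d∣D (c i<m)))

-- Definable predicates and decidability

update-cong : ∀ (ρ ρ′ : Env) {x y} v → (y ≢ x → ρ y ≡ ρ′ y) → (ρ [ x ↦ v ]) y ≡ (ρ′ [ x ↦ v ]) y
update-cong ρ ρ′ {x} {y} v eq with y ℕₚ.≟ x
... | yes refl = trans (update-same ρ x v) (sym (update-same ρ′ x v))
... | no y≢x   = trans (update-other ρ v y≢x) (trans (eq y≢x) (sym (update-other ρ′ v y≢x)))

evalT-cong : ∀ t {ρ ρ′} → (∀ {x} → OccT x t → ρ x ≡ ρ′ x) → evalT ρ t ≡ evalT ρ′ t
evalT-cong `0      eq = refl
evalT-cong `1      eq = refl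
evalT-cong (var x) eq = eq refl
evalT-cong (- t)   eq = cong -ᶻ_ (evalT-cong t eq)
evalT-cong (t ⊕ u) eq = cong₂ _+ᶻ_ (evalT-cong t (eq ∘ inj₁)) (evalT-cong u (eq ∘ inj₂))

Sat-cong : ∀ φ {ρ ρ′} → (∀ {x} → Free x φ → ρ x ≡ ρ′ x) → Sat ρ φ → Sat ρ′ φ
Sat-cong (atom R t u) eq = subst₂ (evalR R) (evalT-cong t (eq ∘ inj₁)) (evalT-cong u (eq ∘ inj₂))
-- Satisfaction of `dvd` at `var 0` serves as the predicate of the value along which to substitute.
Sat-cong (dvd d 2≤d t) eq = subst (λ z → Sat (λ _ → z) (dvd d 2≤d (var 0))) (evalT-cong t eq)
Sat-cong (¬' φ) eq ¬s s = ¬s (Sat-cong φ (sym ∘ eq) s)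
Sat-cong (φ ∧' ψ) eq (s , s′) = Sat-cong φ (eq ∘ inj₁) s , Sat-cong ψ (eq ∘ inj₂) s′
Sat-cong (φ ∨' ψ) eq (inj₁ s) = inj₁ (Sat-cong φ (eq ∘ inj₁) s)
Sat-cong (φ ∨' ψ) eq (inj₂ s) = inj₂ (Sat-cong ψ (eq ∘ inj₂) s)
Sat-cong (φ ⇒' ψ) eq f s = Sat-cong ψ (eq ∘ inj₂) (f (Sat-cong φ (sym ∘ eq ∘ inj₁) s))
Sat-cong (φ ⇔' ψ) eq (f , g) =
  (λ s → Sat-cong ψ (eq ∘ inj₂) (f (Sat-cong φ (sym ∘ eq ∘ inj₁) s))) ,
  (λ s → Sat-cong φ (eq ∘ inj₁) (g (Sat-cong ψ (sym ∘ eq ∘ inj₂) s)))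
Sat-cong (∃' x φ) {ρ} {ρ′} eq (v , s) = v , Sat-cong φ (λ fr → update-cong ρ ρ′ v (λ y≢x → eq (y≢x , fr))) s
Sat-cong (∀' x φ) {ρ} {ρ′} eq f v = Sat-cong φ (λ fr → update-cong ρ ρ′ v (λ y≢x → eq (y≢x , fr))) (f v)

-- ν assigns to each variable the slot that holds its value.
_⟨_↦_⟩ : (Var → ℕ) → Var → ℕ → Var → ℕ
(ν ⟨ x ↦ p ⟩) y = if y ℕ.≡ᵇ x then p else ν y

FreeBelow : (Var → ℕ) → ℕ → Formula → Set
FreeBelow ν m φ = ∀ {x} → Free x φ → ν x < m

-- A bound variable moves to slot `p`, above the slots of the other free variables. Thus the
-- variables of a whole block coexist even if the formula reuses their names.
module _ (ν : Var → ℕ) (x : Var) (p : ℕ) where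

  bind-same : (ν ⟨ x ↦ p ⟩) x ≡ p
  bind-same = cong (if_then p else ν x) (dec-true (x ℕₚ.≟ x) refl)

  bind-other : ∀ {y} → y ≢ x → (ν ⟨ x ↦ p ⟩) y ≡ ν y
  bind-other {y} y≢x = cong (if_then p else ν y) (dec-false (y ℕₚ.≟ x) y≢x)

  bind-below : ∀ {φ} → (∀ {y} → y ≢ x × Free y φ → ν y < p) → FreeBelow (ν ⟨ x ↦ p ⟩) (suc p) φ
  bind-below ν< {y} fr with y ℕₚ.≟ x
  ... | yes refl = subst (_< suc p) (sym bind-same) ≤-refl
  ... | no y≢x   = subst (_< suc p) (sym (bind-other y≢x)) (m<n⇒m<1+n (ν< (y≢x , fr)))

  bind-eval : ∀ φ {σ σ′} → (∀ {y} → y ≢ x × Free y φ → ν y < p) → AgreeBelow p σ σ′ →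
    ∀ {y} → Free y φ → σ′ ((ν ⟨ x ↦ p ⟩) y) ≡ ((σ ∘ ν) [ x ↦ σ′ p ]) y
  bind-eval φ {σ} {σ′} ν< agree {y} fr with y ℕₚ.≟ x
  ... | yes refl = trans (cong σ′ bind-same) (sym (update-same (σ ∘ ν) x (σ′ p)))
  ... | no y≢x   = trans (cong σ′ (bind-other y≢x))
    (trans (sym (agree (ν< (y≢x , fr)))) (sym (update-other (σ ∘ ν) (σ′ p) y≢x)))

  Sat-open : ∀ φ {σ v} → (∀ {y} → y ≢ x × Free y φ → ν y < p) →
    Sat ((σ ∘ ν) [ x ↦ v ]) φ → Sat ((σ [ p ↦ v ]) ∘ (ν ⟨ x ↦ p ⟩)) φ
  Sat-open φ {σ} {v} ν< s = Sat-cong φ (λ fr → sym (bind-eval φ ν< (update-below σ p v) fr))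
    (subst (λ w → Sat ((σ ∘ ν) [ x ↦ w ]) φ) (sym (update-same σ p v)) s)

  Sat-close : ∀ φ {σ σ′} → (∀ {y} → y ≢ x × Free y φ → ν y < p) → AgreeBelow p σ σ′ →
    Sat (σ′ ∘ (ν ⟨ x ↦ p ⟩)) φ → Sat ((σ ∘ ν) [ x ↦ σ′ p ]) φ
  Sat-close φ ν< agree = Sat-cong φ (bind-eval φ ν< agree)

  Sat-close-update : ∀ φ {σ v} → (∀ {y} → y ≢ x × Free y φ → ν y < p) →
    Sat ((σ [ p ↦ v ]) ∘ (ν ⟨ x ↦ p ⟩)) φ → Sat ((σ ∘ ν) [ x ↦ v ]) φ
  Sat-close-update φ {σ} {v} ν< s = subst (λ w → Sat ((σ ∘ ν) [ x ↦ w ]) φ) (update-same σ p v)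
    (Sat-close φ ν< (update-below σ p v) s)

-- Decidability and invariance are proved together, because the search for a value of a quantified
-- variable is finite only by invariance. Sizes are ignored: the record supplies case distinctions,
-- not bounds.
record Definable (m : ℕ) (P : Env → Set) : Set₁ where
  field
    system    : Sys
    good      : Good system
    invariant : ∀ {σ σ′} → σ ≋[ system , m ] σ′ → P σ → P σ′
    decide    : ∀ σ → Dec (P σ)

open Definable

definable-⇔ : ∀ {m P Q} → (∀ σ → P σ ⇔ Q σ) → Definable m P → Definable m Q
definable-⇔ P⇔Q d = record
  { system = system d ; good = good d
  ; invariant = λ {σ} {σ′} σ≋σ′ q → to (P⇔Q σ′) (invariant d σ≋σ′ (from (P⇔Q σ) q))
  ; decide = λ σ → map′ (to (P⇔Q σ)) (from (P⇔Q σ)) (decide d σ) }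
  where open Equivalence

definable-¬ : ∀ {m P} → Definable m P → Definable m (λ σ → ¬ P σ)
definable-¬ d = record
  { system = system d ; good = good d
  ; invariant = λ σ≋σ′ ¬p p → ¬p (invariant d (≋-sym σ≋σ′) p)
  ; decide = λ σ → ¬? (decide d σ) }

module _ (S₁ S₂ : Sys) where
  open Sys

  merge : Sys
  merge = sys (forms S₁ ++ forms S₂) (α S₁ + α S₂) (w S₁ + w S₂) (D S₁ * D S₂)

  merge-good : Good S₁ → Good S₂ → Good merge
  merge-good g₁ g₂ = record
    { norm≤ = norm-bound
    ; 1≤D = *-mono-≤ (Good.1≤D g₁) (Good.1≤D g₂)
    ; D≤ = ≤-trans (*-mono-≤ (Good.D≤ g₁) (Good.D≤ g₂)) (≤-reflexive (sym (^-distribˡ-+-* 2 (w S₁) (w S₂)))) }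
    where
    norm-bound : ∀ {h} → h ∈ forms S₁ ++ forms S₂ → ∀ m → norm m h ≤ 2 ^ (α S₁ + α S₂)
    norm-bound h∈ m with ∈-++⁻ (forms S₁) h∈
    ... | inj₁ h∈₁ = ≤-trans (Good.norm≤ g₁ h∈₁ m) (^-monoʳ-≤ 2 (m≤m+n (α S₁) (α S₂)))
    ... | inj₂ h∈₂ = ≤-trans (Good.norm≤ g₂ h∈₂ m) (^-monoʳ-≤ 2 (m≤n+m (α S₂) (α S₁)))

  merge-left : ∀ {m σ σ′} → σ ≋[ merge , m ] σ′ → σ ≋[ S₁ , m ] σ′
  merge-left (c & f) = (λ i<m → cong-weaken (∣.m∣m*n (D S₂)) (c i<m)) &
    (λ h∈ → ≈-weaken (^-monoʳ-≤ 2 (m≤m+n (w S₁) (w S₂))) (f (∈-++⁺ˡ h∈)))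

  merge-right : ∀ {m σ σ′} → σ ≋[ merge , m ] σ′ → σ ≋[ S₂ , m ] σ′
  merge-right (c & f) = (λ i<m → cong-weaken (∣.n∣m*n (D S₁)) (c i<m)) &
    (λ h∈ → ≈-weaken (^-monoʳ-≤ 2 (m≤n+m (w S₂) (w S₁))) (f (∈-++⁺ʳ (forms S₁) h∈)))

definable-× : ∀ {m P Q} → Definable m P → Definable m Q → Definable m (λ σ → P σ × Q σ)
definable-× d e = record
  { system = merge (system d) (system e) ; good = merge-good _ _ (good d) (good e)
  ; invariant = λ { σ≋σ′ (p , q) → invariant d (merge-left _ (system e) σ≋σ′) p , invariant e (merge-right (system d) _ σ≋σ′) q }
  ; decide = λ σ → decide d σ ×-dec decide e σ }

definable-⊎ : ∀ {m P Q} → Definable m P → Definable m Q → Definable m (λ σ → P σ ⊎ Q σ)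
definable-⊎ d e = record
  { system = merge (system d) (system e) ; good = merge-good _ _ (good d) (good e)
  ; invariant = λ { σ≋σ′ (inj₁ p) → inj₁ (invariant d (merge-left _ (system e) σ≋σ′) p)
                  ; σ≋σ′ (inj₂ q) → inj₂ (invariant e (merge-right (system d) _ σ≋σ′) q) }
  ; decide = λ σ → decide d σ ⊎-dec decide e σ }

definable-→ : ∀ {m P Q} → Definable m P → Definable m Q → Definable m (λ σ → P σ → Q σ)
definable-→ d e = record
  { system = merge (system d) (system e) ; good = merge-good _ _ (good d) (good e)
  ; invariant = λ σ≋σ′ f p → invariant e (merge-right (system d) _ σ≋σ′)
                              (f (invariant d (≋-sym (merge-left _ (system e) σ≋σ′)) p))
  ; decide = λ σ → decide d σ →-dec decide e σ }

∣x±D∣<∣x∣ : ∀ {D} x → 1 ≤ D → D ≤ ∣ x ∣ → Σ ℤ λ δ → ∣ δ ∣ ≡ D × Congruent D x (x +ᶻ δ) × ∣ x +ᶻ δ ∣ < ∣ x ∣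
∣x±D∣<∣x∣ {D} (+ n) 1≤D D≤n = -ᶻ + D , ℤₚ.∣-i∣≡∣i∣ (+ D) , by (-ᶻ + 1) (cong (+ n +ᶻ_) (-i≡-1*i (+ D))) ,
  subst (_< n) (sym (cong ∣_∣ (trans (ℤₚ.m-n≡m⊖n n D) (ℤₚ.⊖-≥ D≤n)))) (∸-monoʳ-< {n} 1≤D D≤n)
∣x±D∣<∣x∣ {D} -[1+ n ] 1≤D D≤ = + D , refl , by (+ 1) (cong (-[1+ n ] +ᶻ_) (sym (ℤₚ.*-identityˡ (+ D)))) ,
  subst (_< suc n) (sym (ℤₚ.∣⊖∣-≤ D≤)) (∸-monoʳ-< {suc n} 1≤D D≤)

-- Outside a bounded window all forms involving slot m are saturated, so its value can be moved towards 0 by D.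
module _ (m : ℕ) (S : Sys) (good : Good S) (σ : Env) where
  open Sys S

  window : ℕ
  window = D + (2 ^ w + sum (map (λ h → ∣ ev m h σ ∣) forms))

  private
    ∈⇒≤sum : ∀ (g : Form → ℕ) {T h} → h ∈ T → g h ≤ sum (map g T)
    ∈⇒≤sum g (here refl) = m≤m+n _ _
    ∈⇒≤sum g {f ∷ T} (there i) = ≤-trans (∈⇒≤sum g i) (m≤n+m (sum (map g T)) (g f))

    -- The slots below `m` contribute at most the sum in `window` to any form, so a value outside
    -- the window dominates.
    large : ∀ v → window ≤ ∣ v ∣ → ∀ {h} → h ∈ forms → h m ≢ 0ℤ → ∣ h m ∣ * D + 2 ^ w ≤ ∣ evAt m h σ v ∣
    large v ≤v {h} h∈ h≢0 = +-cancelʳ-≤ ∣ ev m h σ ∣ _ _ (begin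
      ∣ h m ∣ * D + 2 ^ w + ∣ ev m h σ ∣          ≡⟨ +-assoc (∣ h m ∣ * D) (2 ^ w) _ ⟩
      ∣ h m ∣ * D + (2 ^ w + ∣ ev m h σ ∣)        ≤⟨ +-monoʳ-≤ (∣ h m ∣ * D) (≤-trans (+-monoʳ-≤ (2 ^ w) (∈⇒≤sum (λ h → ∣ ev m h σ ∣) h∈))
                                                      (m≤n*m rest ∣ h m ∣ {{ℕ.>-nonZero (≢0⇒1≤∣i∣ h≢0)}})) ⟩
      ∣ h m ∣ * D + ∣ h m ∣ * rest                ≡⟨ sym (*-distribˡ-+ ∣ h m ∣ D rest) ⟩
      ∣ h m ∣ * window                           ≤⟨ *-monoʳ-≤ ∣ h m ∣ ≤v ⟩
      ∣ h m ∣ * ∣ v ∣                             ≡⟨ sym (ℤₚ.abs-* (h m) v) ⟩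
      ∣ h m *ᶻ v ∣                               ≡⟨ cong ∣_∣ (lem (ev m h σ) (h m *ᶻ v)) ⟩
      ∣ evAt m h σ v -ᶻ ev m h σ ∣               ≤⟨ ℤₚ.∣i-j∣≤∣i∣+∣j∣ (evAt m h σ v) (ev m h σ) ⟩
      ∣ evAt m h σ v ∣ + ∣ ev m h σ ∣             ∎)
      where
      open ≤-Reasoning
      rest = 2 ^ w + sum (map (λ h → ∣ ev m h σ ∣) forms)
      lem : ∀ e x → x ≡ (e +ᶻ x) -ᶻ e
      lem = solve-∀

  shrink : ∀ v → Σ ℤ λ v₁ → ∣ v₁ ∣ ≤ window × (σ [ m ↦ v ]) ≋[ S , suc m ] (σ [ m ↦ v₁ ])
  shrink v = package (go _ v ≤-refl)
    where
    Close : ℤ → ℤ → Set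
    Close v v₁ = Congruent D v v₁ × (∀ {h} → h ∈ forms → evAt m h σ v ≈[ 2 ^ w ] evAt m h σ v₁)
    go : ∀ n v → ∣ v ∣ < n → Σ ℤ λ v₁ → ∣ v₁ ∣ ≤ window × Close v v₁
    go (suc n) v (s≤s v≤n) with ∣ v ∣ ℕ.≤? window
    ... | yes small = v , small , cong-reflexive refl , λ _ → same refl
    ... | no ¬small with ∣x±D∣<∣x∣ v (Good.1≤D good) (≤-trans (m≤m+n D _) (≰⇒≥ ¬small))
    ...   | δ , δ≡D , v≡v′ , smaller with go n (v +ᶻ δ) (<-≤-trans smaller v≤n)
    ...     | v₁ , small , v′≡v₁ , v′≈v₁ = v₁ , small , cong-trans v≡v′ v′≡v₁ ,
      λ {h} h∈ → ≈-trans (1≤2^ w) (shift-≈ m h σ v δ δ≡D (large v (≰⇒≥ ¬small) h∈)) (v′≈v₁ h∈)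
    package : (Σ ℤ λ v₁ → ∣ v₁ ∣ ≤ window × Close v v₁) →
              Σ ℤ λ v₁ → ∣ v₁ ∣ ≤ window × (σ [ m ↦ v ]) ≋[ S , suc m ] (σ [ m ↦ v₁ ])
    package (v₁ , small , v≡v₁ , v≈v₁) = v₁ , small , (λ {i} _ → congruent′ i) &
      (λ {h} h∈ → subst₂ (_≈[ 2 ^ w ]_) (ev-update m h σ v) (ev-update m h σ v₁) (v≈v₁ h∈))
      where
      congruent′ : ∀ i → Congruent D ((σ [ m ↦ v ]) i) ((σ [ m ↦ v₁ ]) i)
      congruent′ i with i ℕₚ.≟ m
      ... | yes refl = subst₂ (Congruent D) (sym (update-same σ m v)) (sym (update-same σ m v₁)) v≡v₁
      ... | no i≢m   = cong-reflexive (trans (update-other σ v i≢m) (sym (update-other σ v₁ i≢m)))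

bounded-∃? : ∀ {P : ℤ → Set} → (∀ v → Dec (P v)) → ∀ n → Dec (Σ ℤ λ v → ∣ v ∣ ≤ n × P v)
bounded-∃? P? zero = map′ (λ p → + 0 , z≤n , p) (λ { (+ zero , _ , p) → p ; (+ suc _ , () , _) ; (-[1+ _ ] , () , _) }) (P? (+ 0))
bounded-∃? {P} P? (suc n) = map′ to from (P? (+ suc n) ⊎-dec P? -[1+ n ] ⊎-dec bounded-∃? P? n)
  where
  to : P (+ suc n) ⊎ P -[1+ n ] ⊎ Σ ℤ (λ v → ∣ v ∣ ≤ n × P v) → Σ ℤ λ v → ∣ v ∣ ≤ suc n × P v
  to (inj₁ p)                    = + suc n , ≤-refl , p
  to (inj₂ (inj₁ p))             = -[1+ n ] , ≤-refl , p
  to (inj₂ (inj₂ (v , v≤n , p))) = v , m≤n⇒m≤1+n v≤n , p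
  from : Σ ℤ (λ v → ∣ v ∣ ≤ suc n × P v) → P (+ suc n) ⊎ P -[1+ n ] ⊎ Σ ℤ (λ v → ∣ v ∣ ≤ n × P v)
  from (v , v≤ , p) with m≤n⇒m<n∨m≡n v≤
  from (v , _ , p)        | inj₁ (s≤s v≤n) = inj₂ (inj₂ (v , v≤n , p))
  from (+ _ , _ , p)      | inj₂ refl      = inj₁ p
  from (-[1+ _ ] , _ , p) | inj₂ refl      = inj₂ (inj₁ p)

definable-∃ : ∀ {m P} → Definable (suc m) P → Definable m (λ σ → Σ ℤ λ v → P (σ [ m ↦ v ]))
definable-∃ {m} {P} d = record
  { system = block 1 m (system d) ; good = block-good 1 m (system d) (good d)
  ; invariant = inv
  ; decide = λ σ → map′ (λ { (v , _ , p) → v , p })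
      (λ { (v , p) → let v₁ , small , v≋v₁ = shrink m (system d) (good d) σ v in v₁ , small , invariant d v≋v₁ p })
      (bounded-∃? (λ v → decide d (σ [ m ↦ v ])) (window m (system d) (good d) σ)) }
  where
  inv : ∀ {σ σ′} → σ ≋[ block 1 m (system d) , m ] σ′ → Σ ℤ (λ v → P (σ [ m ↦ v ])) → Σ ℤ (λ v → P (σ′ [ m ↦ v ]))
  inv {σ} {σ′} σ≋σ′ (v , p) = conclude (block-transfers 1 m (system d) (good d) (σ [ m ↦ v ]) σ′
                                         (≋-agree (λ i<m → sym (update-below σ m v i<m)) σ≋σ′))
    where
    conclude : (Σ Env λ σ″ → AgreeBelow m σ′ σ″ × (σ [ m ↦ v ]) ≋[ system d , suc m ] σ″) → Σ ℤ λ v → P (σ′ [ m ↦ v ])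
    conclude (σ″ , σ′~σ″ , σ≋σ″) = σ″ m , invariant d (≋-sym (≋-agree agree (≋-sym σ≋σ″))) p
      where
      agree : AgreeBelow (suc m) (σ′ [ m ↦ σ″ m ]) σ″
      agree {i} i<sm with i ℕₚ.≟ m
      ... | yes refl = update-same σ′ m (σ″ m)
      ... | no i≢m   = trans (update-other σ′ (σ″ m) i≢m) (σ′~σ″ (≤∧≢⇒< (ℕ.s≤s⁻¹ i<sm) i≢m))

definable-∀ : ∀ {m P} → Definable (suc m) P → Definable m (λ σ → ∀ v → P (σ [ m ↦ v ]))
definable-∀ {m} {P} d = definable-⇔ (λ σ → mk⇔ (stable σ) (λ { f (v , ¬p) → ¬p (f v) }))
                                   (definable-¬ (definable-∃ (definable-¬ d)))
  where
  stable : ∀ σ → ¬ (Σ ℤ λ v → ¬ P (σ [ m ↦ v ])) → ∀ v → P (σ [ m ↦ v ])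
  stable σ none v with decide d (σ [ m ↦ v ])
  ... | yes p = p
  ... | no ¬p = ⊥-elim (none (v , ¬p))

Sat-definable : ∀ φ {m ν} → FreeBelow ν m φ → Definable m (λ σ → Sat (σ ∘ ν) φ)
Sat-definable (atom R t u) {m} {ν} ν< = record
  { system = S
  ; good = record { norm≤ = λ { (here refl) k → ≤-trans (norm≤leaves ν (difference t u) k) (<⇒≤ (n<2^n n)) }
                  ; 1≤D = ≤-refl ; D≤ = 1≤2^ n }
  ; invariant = atom-invariant S m ν R t u ν< (here refl) ≤-refl
  ; decide = λ σ → evalR? R (evalT (σ ∘ ν) t) (evalT (σ ∘ ν) u) }
  where
  n = leaves t + leaves u
  S = sys (coefficients ν (difference t u) ∷ []) n n 1
Sat-definable (dvd d 2≤d t) {m} {ν} ν< = record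
  { system = S
  ; good = record { norm≤ = λ () ; 1≤D = ≤-trans (s≤s z≤n) 2≤d ; D≤ = <⇒≤ (n<2^n d) }
  ; invariant = dvd-invariant S m ν d 2≤d t ν< ∣.∣-refl
  ; decide = λ σ → d ∣.∣? ∣ evalT (σ ∘ ν) t ∣ }
  where S = sys [] 0 d d
Sat-definable (¬' φ) ν< = definable-¬ (Sat-definable φ ν<)
Sat-definable (φ ∧' ψ) ν< = definable-× (Sat-definable φ (ν< ∘ inj₁)) (Sat-definable ψ (ν< ∘ inj₂))
Sat-definable (φ ∨' ψ) ν< = definable-⊎ (Sat-definable φ (ν< ∘ inj₁)) (Sat-definable ψ (ν< ∘ inj₂))
Sat-definable (φ ⇒' ψ) ν< = definable-→ (Sat-definable φ (ν< ∘ inj₁)) (Sat-definable ψ (ν< ∘ inj₂))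
Sat-definable (φ ⇔' ψ) ν< = definable-× (definable-→ dφ dψ) (definable-→ dψ dφ)
  where
  dφ = Sat-definable φ (ν< ∘ inj₁)
  dψ = Sat-definable ψ (ν< ∘ inj₂)
Sat-definable (∃' x φ) {m} {ν} ν< = definable-⇔
  (λ σ → mk⇔ (λ { (v , s) → v , Sat-close-update ν x m φ {σ} {v} ν< s }) (λ { (v , s) → v , Sat-open ν x m φ {σ} {v} ν< s }))
  (definable-∃ (Sat-definable φ (bind-below ν x m {φ} ν<)))
Sat-definable (∀' x φ) {m} {ν} ν< = definable-⇔
  (λ σ → mk⇔ (λ f v → Sat-close-update ν x m φ {σ} {v} ν< (f v)) (λ f v → Sat-open ν x m φ {σ} {v} ν< (f v)))
  (definable-∀ (Sat-definable φ (bind-below ν x m {φ} ν<)))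

-- Over zero slots all environments are equivalent, so testing the zero environment decides; further
-- slots are quantified away from the top.
satisfiable? : ∀ m {P} → Definable m P → Dec (Σ Env P)
satisfiable? zero {P} d = map′ (λ p → _ , p) (λ { (σ , p) → invariant d ((λ ()) & (λ _ → same refl)) p }) (decide d (λ _ → 0ℤ))
satisfiable? (suc m) {P} d = map′ (λ { (σ , v , p) → σ [ m ↦ v ] , p })
  (λ { (σ , p) → σ , σ m , invariant d (≋-agree (agree σ) (≋-refl {m = suc m})) p })
  (satisfiable? m (definable-∃ d))
  where
  agree : ∀ σ → AgreeBelow (suc m) σ (σ [ m ↦ σ m ])
  agree σ {i} i<sm with i ℕₚ.≟ m
  ... | yes refl = sym (update-same σ m (σ m))
  ... | no i≢m   = sym (update-other σ (σ m) i≢m)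

-- Certificates for quantifier blocks

-- The forms and the modulus that the atoms of a formula of length n demand from a system.
record Requirement (n : ℕ) : Set where
  field
    forms     : List Form
    modulus   : ℕ
    -- Strict, so that `n` bounds the number of forms plus one, the quantity that `block-forms`
    -- raises to a power.
    count     : length forms < n
    norm≤     : ∀ {h} → h ∈ forms → ∀ m → norm m h ≤ n
    1≤modulus : 1 ≤ modulus
    modulus≤  : modulus ≤ 2 ^ n

-- Results about subformulas hold for every system that meets their requirement, because all parts
-- of a formula must finally share one system, which is known only at the top.
record Meets {n : ℕ} (S : Sys) (R : Requirement n) : Set where
  field
    good-system : Good S
    included    : ∀ {h} → h ∈ Requirement.forms R → h ∈ Sys.forms S
    divisible   : Requirement.modulus R ∣ Sys.D S
    length≤w    : n ≤ Sys.w S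

module _ {m n : ℕ} (m≤n : m ≤ n) (R : Requirement m) where
  open Requirement R

  relax : Requirement n
  relax = record
    { forms = forms ; modulus = modulus ; count = <-≤-trans count m≤n
    ; norm≤ = λ h∈ k → ≤-trans (norm≤ h∈ k) m≤n
    ; 1≤modulus = 1≤modulus ; modulus≤ = ≤-trans modulus≤ (^-monoʳ-≤ 2 m≤n) }

  meets-relax : ∀ {S} → Meets S relax → Meets S R
  meets-relax M = record { good-system = good-system ; included = included ; divisible = divisible ; length≤w = ≤-trans m≤n length≤w }
    where open Meets M

module _ {m n : ℕ} (R : Requirement m) (R′ : Requirement n) where
  private
    module R  = Requirement R
    module R′ = Requirement R′

  join : Requirement (m + 1 + n)
  join = record
    { forms = R.forms ++ R′.forms ; modulus = R.modulus * R′.modulus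
    ; count = subst₂ _<_ (sym (length-++ R.forms)) (cong (_+ n) (+-comm 1 m))
                (≤-trans (+-mono-≤ R.count (<⇒≤ R′.count)) (n≤1+n (m + n)))
    ; norm≤ = norms
    ; 1≤modulus = *-mono-≤ R.1≤modulus R′.1≤modulus
    ; modulus≤ = ≤-trans (*-mono-≤ R.modulus≤ R′.modulus≤)
        (≤-trans (≤-reflexive (sym (^-distribˡ-+-* 2 m n))) (^-monoʳ-≤ 2 (+-monoˡ-≤ n (m≤m+n m 1)))) }
    where
    norms : ∀ {h} → h ∈ R.forms ++ R′.forms → ∀ k → norm k h ≤ m + 1 + n
    norms h∈ k with ∈-++⁻ R.forms h∈
    ... | inj₁ h∈R  = ≤-trans (R.norm≤ h∈R k) (≤-trans (m≤m+n m 1) (m≤m+n (m + 1) n))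
    ... | inj₂ h∈R′ = ≤-trans (R′.norm≤ h∈R′ k) (m≤n+m n (m + 1))

  meets-left : ∀ {S} → Meets S join → Meets S R
  meets-left M = record
    { good-system = good-system ; included = included ∘ ∈-++⁺ˡ ; divisible = ∣.∣-trans (∣.m∣m*n R′.modulus) divisible
    ; length≤w = ≤-trans (≤-trans (m≤m+n m 1) (m≤m+n (m + 1) n)) length≤w }
    where open Meets M

  meets-right : ∀ {S} → Meets S join → Meets S R′
  meets-right M = record
    { good-system = good-system ; included = included ∘ ∈-++⁺ʳ R.forms ; divisible = ∣.∣-trans (∣.n∣m*n R.modulus) divisible
    ; length≤w = ≤-trans (m≤n+m n (m + 1)) length≤w }
    where open Meets M

-- Unlike qaQ, this does not count an innermost block of the matching kind.
alternations : Q → Formula → ℕ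
alternations q (atom _ _ _) = 0
alternations q (dvd _ _ _)  = 0
alternations q (¬' φ)   = alternations (dual q) φ
alternations q (φ ∧' ψ) = alternations q φ ⊔ alternations q ψ
alternations q (φ ∨' ψ) = alternations q φ ⊔ alternations q ψ
alternations q (φ ⇒' ψ) = alternations (dual q) φ ⊔ alternations q ψ
alternations q (φ ⇔' ψ) = (alternations (dual q) φ ⊔ alternations q ψ) ⊔ (alternations (dual q) ψ ⊔ alternations q φ)
alternations E (∃' x φ) = alternations E φ
alternations A (∃' x φ) = suc (alternations E φ)
alternations A (∀' x φ) = alternations A φ
alternations E (∀' x φ) = suc (alternations A φ)

alternations≤qaQ : ∀ q φ → alternations q φ ≤ qaQ q φ
alternations≤qaQ q (atom _ _ _) = z≤n
alternations≤qaQ q (dvd _ _ _)  = z≤n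
alternations≤qaQ q (¬' φ)   = alternations≤qaQ (dual q) φ
alternations≤qaQ q (φ ∧' ψ) = ⊔-mono-≤ (alternations≤qaQ q φ) (alternations≤qaQ q ψ)
alternations≤qaQ q (φ ∨' ψ) = ⊔-mono-≤ (alternations≤qaQ q φ) (alternations≤qaQ q ψ)
alternations≤qaQ q (φ ⇒' ψ) = ⊔-mono-≤ (alternations≤qaQ (dual q) φ) (alternations≤qaQ q ψ)
alternations≤qaQ q (φ ⇔' ψ) = ⊔-mono-≤ (⊔-mono-≤ (alternations≤qaQ (dual q) φ) (alternations≤qaQ q ψ))
                                       (⊔-mono-≤ (alternations≤qaQ (dual q) ψ) (alternations≤qaQ q φ))
alternations≤qaQ E (∃' x φ) = ≤-trans (alternations≤qaQ E φ) (m≤n⊔m 1 (qaQ E φ))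
alternations≤qaQ A (∃' x φ) = s≤s (alternations≤qaQ E φ)
alternations≤qaQ A (∀' x φ) = ≤-trans (alternations≤qaQ A φ) (m≤n⊔m 1 (qaQ A φ))
alternations≤qaQ E (∀' x φ) = s≤s (alternations≤qaQ A φ)

Holds : Q → (Var → ℕ) → Formula → Env → Set
Holds E ν φ σ = Sat (σ ∘ ν) φ
Holds A ν φ σ = ¬ Sat (σ ∘ ν) φ

Holds-local : ∀ q {ν p φ} → FreeBelow ν p φ → ∀ {σ σ′} → AgreeBelow p σ σ′ → Holds q ν φ σ → Holds q ν φ σ′
Holds-local E {φ = φ} ν< agree = Sat-cong φ (λ fr → agree (ν< fr))
Holds-local A {φ = φ} ν< agree ¬s = ¬s ∘ Sat-cong φ (λ fr → sym (agree (ν< fr)))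

leaves≤lenT : ∀ t → leaves t ≤ lenT t
leaves≤lenT `0      = ≤-refl
leaves≤lenT `1      = ≤-refl
leaves≤lenT (var x) = ≤-refl
leaves≤lenT (- t)   = m≤n⇒m≤1+n (leaves≤lenT t)
leaves≤lenT (t ⊕ u) = +-mono-≤ (≤-trans (leaves≤lenT t) (m≤m+n (lenT t) 1)) (leaves≤lenT u)

1≤lenT : ∀ t → 1 ≤ lenT t
1≤lenT `0      = ≤-refl
1≤lenT `1      = ≤-refl
1≤lenT (var x) = ≤-refl
1≤lenT (- t)   = s≤s z≤n
1≤lenT (t ⊕ u) = ≤-trans (1≤lenT t) (≤-trans (m≤m+n (lenT t) 1) (m≤m+n (lenT t + 1) (lenT u)))

-- Each part of an equivalence occurs with both polarities, so the same four numbers enter both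
-- maxima.
⇔-alternations : ∀ q φ ψ → alternations (dual q) (φ ⇔' ψ) ≤ alternations q (φ ⇔' ψ)
⇔-alternations E φ ψ = ⊔-lub (⊔-lub (≤-trans (m≤n⊔m d a) (m≤n⊔m (c ⊔ b′) (d ⊔ a))) (≤-trans (m≤m⊔n d a) (m≤n⊔m (c ⊔ b′) (d ⊔ a))))
                             (⊔-lub (≤-trans (m≤n⊔m c b′) (m≤m⊔n (c ⊔ b′) (d ⊔ a))) (≤-trans (m≤m⊔n c b′) (m≤m⊔n (c ⊔ b′) (d ⊔ a))))
  where
  a = alternations E φ
  b′ = alternations E ψ
  c = alternations A φ
  d = alternations A ψ
⇔-alternations A φ ψ = ⊔-lub (⊔-lub (≤-trans (m≤n⊔m d a) (m≤n⊔m (c ⊔ b′) (d ⊔ a))) (≤-trans (m≤m⊔n d a) (m≤n⊔m (c ⊔ b′) (d ⊔ a))))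
                             (⊔-lub (≤-trans (m≤n⊔m c b′) (m≤m⊔n (c ⊔ b′) (d ⊔ a))) (≤-trans (m≤m⊔n c b′) (m≤m⊔n (c ⊔ b′) (d ⊔ a))))
  where
  a = alternations A φ
  b′ = alternations A ψ
  c = alternations E φ
  d = alternations E ψ

agree-mono : ∀ {m n σ σ′} → m ≤ n → AgreeBelow n σ σ′ → AgreeBelow m σ σ′
agree-mono m≤n agree i<m = agree (<-≤-trans i<m m≤n)

shuffle : ∀ p c c′ → c′ + (c + p) ≡ c + c′ + p
shuffle p c c′ = trans (sym (+-assoc c′ c p)) (cong (_+ p) (+-comm c′ c))

module _ (b : ℕ) where

  Invariant : Sys → ℕ → ℕ → (Env → Set) → Set
  Invariant S k m P = ∀ {σ σ′} → σ ≋[ level b S k m , m ] σ′ → P σ → P σ′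

  -- P holds at σ because of values for the c slots from p on; given these values, it depends
  -- only on the type of level k over the slots below e.
  Certified : Sys → (k e p c : ℕ) → (Env → Set) → Set
  Certified S k e p c P = ∀ σ → P σ → Σ Env λ σ₁ → AgreeBelow p σ σ₁ ×
    (∀ σ₂ σ′ → AgreeBelow (c + p) σ₁ σ₂ → σ₂ ≋[ level b S k e , e ] σ′ → P σ′)

  module _ {S : Sys} {k e p : ℕ} where

    certified-⇔ : ∀ {c P P′} → (∀ σ → P σ ⇔ P′ σ) → Certified S k e p c P → Certified S k e p c P′
    certified-⇔ P⇔P′ cert σ q with cert σ (Equivalence.from (P⇔P′ σ) q)
    ... | σ₁ , agree , holds = σ₁ , agree , λ σ₂ σ′ a r → Equivalence.to (P⇔P′ σ′) (holds σ₂ σ′ a r)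

    certified-left : ∀ {c P} c′ → Certified S k e p c P → Certified S k e p (c + c′) P
    certified-left {c} c′ cert σ q with cert σ q
    ... | σ₁ , agree , holds = σ₁ , agree , λ σ₂ σ′ a r → holds σ₂ σ′ (agree-mono (+-monoˡ-≤ p (m≤m+n c c′)) a) r

    -- The first `c` slots are reserved for the other part: `qblQ` adds up over disjunctions as
    -- well.
    certified-right : ∀ {c′ P} c → Certified S k e (c + p) c′ P → Certified S k e p (c + c′) P
    certified-right {c′} c cert σ q with cert σ q
    ... | σ₁ , agree , holds = σ₁ , agree-mono (m≤n+m p c) agree ,
      λ σ₂ σ′ a r → holds σ₂ σ′ (agree-mono (≤-reflexive (shuffle p c c′)) a) r

    certified-⊎ : ∀ {c P P′} → Certified S k e p c P → Certified S k e p c P′ → Certified S k e p c (λ σ → P σ ⊎ P′ σ)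
    certified-⊎ cert cert′ σ (inj₁ q) with cert σ q
    ... | σ₁ , agree , holds = σ₁ , agree , λ σ₂ σ′ a r → inj₁ (holds σ₂ σ′ a r)
    certified-⊎ cert cert′ σ (inj₂ q) with cert′ σ q
    ... | σ₁ , agree , holds = σ₁ , agree , λ σ₂ σ′ a r → inj₂ (holds σ₂ σ′ a r)

    -- The witnesses of both parts must be present together, so those of the second part start `c`
    -- slots later. The second part survives the first choice because `P′` depends only on the slots
    -- below `p`.
    certified-× : ∀ {c c′ P P′} → (∀ {σ σ′} → AgreeBelow p σ σ′ → P′ σ → P′ σ′) →
      Certified S k e p c P → Certified S k e (c + p) c′ P′ → Certified S k e p (c + c′) (λ σ → P σ × P′ σ)
    certified-× {c} {c′} local cert cert′ σ (q , q′) with cert σ q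
    ... | σ₁ , agree , holds with cert′ σ₁ (local agree q′)
    ...   | σ₂ , agree′ , holds′ = σ₂ , (λ i<p → trans (agree i<p) (agree′ (<-≤-trans i<p (m≤n+m p c)))) ,
      λ σ₃ σ′ a r →
        holds σ₃ σ′ (λ i< → trans (agree′ i<) (a (<-≤-trans i< (+-monoˡ-≤ p (m≤m+n c c′))))) r ,
        holds′ σ₃ σ′ (agree-mono (≤-reflexive (shuffle p c c′)) a) r

    invariant⇒certified : ∀ {P} c → (∀ {σ σ′} → AgreeBelow p σ σ′ → P σ → P σ′) →
      Invariant S k e P → Certified S k e p c P
    invariant⇒certified c local inv σ q = σ , (λ _ → refl) ,
      λ σ₂ σ′ a r → inv r (local (agree-mono (m≤n+m p c) a) q)

  -- The `b` extra slots lie outside those on which `P` depends. This pads atoms that lie under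
  -- fewer than `k` blocks.
  invariant-raise : ∀ {S k m P} → Good S → (∀ {σ σ′} → AgreeBelow m σ σ′ → P σ → P σ′) →
    Invariant S k (b + m) P → Invariant S (suc k) m P
  invariant-raise {S} {k} {m} good local inv {σ} {σ′} σ≋σ′ p =
    let σ″ , agree , σ≋σ″ = block-transfers b m _ (level-good b S k (b + m) good) σ σ′ σ≋σ′
    in local (sym ∘ agree) (inv σ≋σ″ p)

  -- One round of the game: `P` at `σ` provides values for the block, `block-transfers` matches them
  -- over `σ′`, and the certificate yields `P` there. Finally the slots of the block are forgotten
  -- by locality.
  certified⇒invariant : ∀ {S k m c P} → Good S → (∀ {σ σ′} → AgreeBelow m σ σ′ → P σ → P σ′) →
    Certified S k (b + m) m c P → Invariant S (suc k) m P
  certified⇒invariant {S} {k} {m} good local cert {σ} {σ′} σ≋σ′ p =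
    let σ₁ , agree , holds = cert σ p
        σ″ , agree′ , σ₁≋σ″ = block-transfers b m _ (level-good b S k (b + m) good) σ₁ σ′
                                (≋-agree (sym ∘ agree) σ≋σ′)
    in local (sym ∘ agree′) (holds σ₁ σ″ (λ _ → refl) σ₁≋σ″)

  BlockResult : Q → (e p : ℕ) → (Var → ℕ) → Formula → Set
  BlockResult q e p ν φ = Σ (Requirement (len φ)) λ R → ∀ {S k} → Meets S R → alternations q φ ≤ k →
    Certified S k e p (qblQ q φ) (Holds q ν φ)

  LeafResult : (m : ℕ) → (Var → ℕ) → Formula → Set
  LeafResult m ν φ = Σ (Requirement (len φ)) λ R → ∀ {S k} → Meets S R →
    alternations E φ ≤ k → alternations A φ ≤ k → Invariant S k m (Holds E ν φ)

  invariant-Holds : ∀ q {S k m ν φ} → Invariant S k m (Holds E ν φ) → Invariant S k m (Holds q ν φ)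
  invariant-Holds E inv = inv
  invariant-Holds A inv σ≋σ′ ¬s s = ¬s (inv (≋-sym σ≋σ′) s)

  Holds-invariant : ∀ q {S k m ν φ} → FreeBelow ν m φ → Invariant S k m (Holds q ν φ) → Invariant S k m (Holds E ν φ)
  Holds-invariant E ν< inv = inv
  Holds-invariant A {φ = φ} ν< inv {σ} {σ′} σ≋σ′ s with Definable.decide (Sat-definable φ ν<) σ′
  ... | yes s′ = s′
  ... | no ¬s′ = ⊥-elim (inv (≋-sym σ≋σ′) ¬s′ s)

  -- A leaf result needs the counts of both kinds, whereas a block knows only its own. The
  -- inequality holds for atoms, for equivalences and for formulas that start with a quantifier of
  -- the other kind, which are the leaves of a block.
  leaf⇒block : ∀ q {e p ν φ} → FreeBelow ν p φ → alternations (dual q) φ ≤ alternations q φ →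
    LeafResult e ν φ → BlockResult q e p ν φ
  leaf⇒block q {e} {p} {ν} {φ} ν< alt≤ (R , result) = R , λ {S} {k} M alt≤k →
    invariant⇒certified {S} {k} (qblQ q φ) (Holds-local q {φ = φ} ν<)
      (invariant-Holds q {S} {k} (inv q M alt≤k (≤-trans alt≤ alt≤k)))
    where
    inv : ∀ q {S k} → Meets S R → alternations q φ ≤ k → alternations (dual q) φ ≤ k → Invariant S k e (Holds E ν φ)
    inv E M a b = result M a b
    inv A M a b = result M b a

  block⇒invariant : ∀ q {m ν φ} → FreeBelow ν m φ → (r : BlockResult q (b + m) m ν φ) →
    ∀ S k → Meets S (proj₁ r) → alternations q φ ≤ k → Invariant S (suc k) m (Holds E ν φ)
  block⇒invariant q {φ = φ} ν< (R , result) S k M alt≤ =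
    Holds-invariant q {S} {suc k} ν< (certified⇒invariant {S} {k} (Meets.good-system M) (Holds-local q {φ = φ} ν<) (result M alt≤))

  -- A quantifier met as a leaf opens a new block. The dual count exceeds its own by one, so a level
  -- is available for it.
  block⇒leaf : ∀ q {m ν φ} → FreeBelow ν m φ → alternations (dual q) φ ≡ suc (alternations q φ) →
    BlockResult q (b + m) m ν φ → LeafResult m ν φ
  block⇒leaf q {m} {ν} {φ} ν< alt≡ r = proj₁ r , λ {S} {k} M altE altA → raise S k M (dual-≤ q altE altA)
    where
    dual-≤ : ∀ q {k} → alternations E φ ≤ k → alternations A φ ≤ k → alternations (dual q) φ ≤ k
    dual-≤ E altE altA = altA
    dual-≤ A altE altA = altE
    raise : ∀ S k → Meets S (proj₁ r) → alternations (dual q) φ ≤ k → Invariant S k m (Holds E ν φ)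
    raise S zero    M alt≤ with subst (_≤ 0) alt≡ alt≤
    ... | ()
    raise S (suc k) M alt≤ = block⇒invariant q ν< r S k M (ℕ.s≤s⁻¹ (subst (_≤ suc k) alt≡ alt≤))

  atomic-leaf : ∀ {m ν} φ (R : Requirement (len φ)) → FreeBelow ν m φ →
    (∀ {S m′} → Meets S R → FreeBelow ν m′ φ → Invariant S 0 m′ (Holds E ν φ)) → LeafResult m ν φ
  atomic-leaf {m} {ν} φ R ν< base = R , λ {S} {k} M _ _ → go k {S} M ν<
    where
    go : ∀ k {S m} → Meets S R → FreeBelow ν m φ → Invariant S k m (Holds E ν φ)
    go zero M ν< = base M ν<
    go (suc k) {S} {m} M ν< = invariant-raise {S} {k} (Meets.good-system M) (Holds-local E {φ = φ} ν<)
      (go k {S} M (λ fr → <-≤-trans (ν< fr) (m≤n+m m b)))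

  atom-leaf : ∀ {m ν} R t u → FreeBelow ν m (atom R t u) → LeafResult m ν (atom R t u)
  atom-leaf {m} {ν} R t u ν< = atomic-leaf (atom R t u) req ν< λ {S} {m′} M ν<′ →
    atom-invariant S m′ ν R t u ν<′ (Meets.included M (here refl)) (≤-trans leaves≤ (Meets.length≤w M))
    where
    leaves≤ : leaves t + leaves u ≤ lenT t + 1 + lenT u
    leaves≤ = +-mono-≤ (≤-trans (leaves≤lenT t) (m≤m+n (lenT t) 1)) (leaves≤lenT u)
    req : Requirement (lenT t + 1 + lenT u)
    req = record
      { forms = coefficients ν (difference t u) ∷ [] ; modulus = 1
      ; count = +-mono-≤ (≤-trans (1≤lenT t) (m≤m+n (lenT t) 1)) (1≤lenT u)
      ; norm≤ = λ { (here refl) k → ≤-trans (norm≤leaves ν (difference t u) k) leaves≤ }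
      ; 1≤modulus = ≤-refl ; modulus≤ = 1≤2^ (lenT t + 1 + lenT u) }

  dvd-leaf : ∀ {m ν} d 2≤d t → FreeBelow ν m (dvd d 2≤d t) → LeafResult m ν (dvd d 2≤d t)
  dvd-leaf {m} {ν} d 2≤d t ν< = atomic-leaf (dvd d 2≤d t) req ν< λ {S} {m′} M ν<′ →
    dvd-invariant S m′ ν d 2≤d t ν<′ (Meets.divisible M)
    where
    d≤ : d ≤ lenT t + (d + 1)
    d≤ = ≤-trans (m≤m+n d 1) (m≤n+m (d + 1) (lenT t))
    req : Requirement (lenT t + (d + 1))
    req = record
      { forms = [] ; modulus = d ; count = ≤-trans (≤-trans (s≤s z≤n) 2≤d) d≤ ; norm≤ = λ ()
      ; 1≤modulus = ≤-trans (s≤s z≤n) 2≤d ; modulus≤ = ≤-trans (<⇒≤ (n<2^n d)) (^-monoʳ-≤ 2 d≤) }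

-- Propositional laws for decidable propositions

¬×⇔⊎ : ∀ {P P′ : Set} → Dec P → (¬ P ⊎ ¬ P′) ⇔ (¬ (P × P′))
¬×⇔⊎ {P} {P′} P? = mk⇔ (λ { (inj₁ ¬p) (p , _) → ¬p p ; (inj₂ ¬p′) (_ , p′) → ¬p′ p′ }) (go P?)
  where
  go : Dec P → ¬ (P × P′) → ¬ P ⊎ ¬ P′
  go (yes p) ¬pp = inj₂ (λ p′ → ¬pp (p , p′))
  go (no ¬p) ¬pp = inj₁ ¬p

×⇔¬⊎ : ∀ {P P′ : Set} → (¬ P × ¬ P′) ⇔ (¬ (P ⊎ P′))
×⇔¬⊎ = mk⇔ (λ { (¬p , ¬p′) (inj₁ p) → ¬p p ; (¬p , ¬p′) (inj₂ p′) → ¬p′ p′ })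
           (λ n → n ∘ inj₁ , n ∘ inj₂)

⊎⇔→ : ∀ {P P′ : Set} → Dec P → (¬ P ⊎ P′) ⇔ (P → P′)
⊎⇔→ {P} {P′} P? = mk⇔ (λ { (inj₁ ¬p) p → ⊥-elim (¬p p) ; (inj₂ p′) _ → p′ }) (go P?)
  where
  go : Dec P → (P → P′) → ¬ P ⊎ P′
  go (yes p) f = inj₂ (f p)
  go (no ¬p) f = inj₁ ¬p

×⇔¬→ : ∀ {P P′ : Set} → Dec P → (P × ¬ P′) ⇔ (¬ (P → P′))
×⇔¬→ {P} {P′} P? = mk⇔ (λ { (p , ¬p′) f → ¬p′ (f p) }) (go P?)
  where
  go : Dec P → ¬ (P → P′) → P × ¬ P′
  go (yes p) n = p , λ p′ → n (λ _ → p′)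
  go (no ¬p) n = ⊥-elim (n (λ p → ⊥-elim (¬p p)))

qblQ≤qbl : ∀ q φ → qblQ q φ ≤ qbl φ
qblQ≤qbl E φ = ≤-trans (m≤m⊔n (qblQ E φ) (qblQ A φ)) (m≤m⊔n _ _)
qblQ≤qbl A φ = ≤-trans (m≤n⊔m (qblQ E φ) (qblQ A φ)) (m≤m⊔n _ _)

free-mono : ∀ {ν p q} φ → p ≤ q → FreeBelow ν p φ → FreeBelow ν q φ
free-mono φ p≤q ν< fr = <-≤-trans (ν< fr) p≤q

-- Formulas as blocks and leaves

module _ (b : ℕ) where

  bind-∃ : ∀ {e p ν} x φ → FreeBelow ν p (∃' x φ) →
    BlockResult b E e (suc p) (ν ⟨ x ↦ p ⟩) φ → BlockResult b E e p ν (∃' x φ)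
  bind-∃ {e} {p} {ν} x φ ν< (R , result) = relax (m≤n+m (len φ) 2) R , λ {S} {k} M alt≤ →
    λ { σ (v , s) →
      let σ₁ , agree , holds = result {S} {k} (meets-relax _ R M) alt≤ (σ [ p ↦ v ]) (Sat-open ν x p φ {σ} {v} ν< s)
      in σ₁ ,
         (λ i<p → trans (update-below σ p v i<p) (agree (m<n⇒m<1+n i<p))) ,
         -- Slot `p` belongs to the block, so its content in `σ′` is the witness.
         λ σ₂ σ′ a r → σ′ p ,
           Sat-close ν x p φ {σ′} {σ′} ν< (λ _ → refl)
             (holds σ₂ σ′ (agree-mono (≤-reflexive (+-suc (qblQ E φ) p)) a) r) }

  bind-∀ : ∀ {e p ν} x φ → FreeBelow ν p (∀' x φ) →
    BlockResult b A e (suc p) (ν ⟨ x ↦ p ⟩) φ → BlockResult b A e p ν (∀' x φ)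
  bind-∀ {e} {p} {ν} x φ ν< (R , result) = relax (m≤n+m (len φ) 2) R , λ {S} {k} M alt≤ →
    λ σ ¬all →
      let v , ¬s = counterexample σ ¬all
          σ₁ , agree , holds = result {S} {k} (meets-relax _ R M) alt≤ (σ [ p ↦ v ]) (¬s ∘ Sat-close-update ν x p φ {σ} {v} ν<)
      in σ₁ ,
         (λ i<p → trans (update-below σ p v i<p) (agree (m<n⇒m<1+n i<p))) ,
         λ σ₂ σ′ a r all → holds σ₂ σ′ (agree-mono (≤-reflexive (+-suc (qblQ A φ) p)) a) r
           (Sat-cong φ (λ fr → sym (bind-eval ν x p φ {σ′} {σ′} ν< (λ _ → refl) fr)) (all (σ′ p)))
    where
    -- Constructively, a counterexample comes from deciding `∃' x (¬' φ)`.
    counterexample : ∀ σ → ¬ (∀ v → Sat ((σ ∘ ν) [ x ↦ v ]) φ) → Σ ℤ λ v → ¬ Sat ((σ ∘ ν) [ x ↦ v ]) φ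
    counterexample σ ¬all with Definable.decide (Sat-definable (∃' x (¬' φ)) {ν = ν} ν<) σ
    ... | yes (v , ¬s) = v , ¬s
    ... | no none = ⊥-elim (¬all stable)
      where
      stable : ∀ v → Sat ((σ ∘ ν) [ x ↦ v ]) φ
      stable v with Definable.decide (Sat-definable φ {ν = ν ⟨ x ↦ p ⟩} (bind-below ν x p {φ} ν<)) (σ [ p ↦ v ])
      ... | yes s = Sat-close-update ν x p φ {σ} {v} ν< s
      ... | no ¬s = ⊥-elim (none (v , ¬s ∘ Sat-open ν x p φ {σ} {v} ν<))

  qbl-child : ∀ χ φ → (qblQ E χ ⊔ qblQ A χ) ⊔ qbl φ ≤ b → qbl φ ≤ b
  qbl-child χ φ = m⊔n≤o⇒n≤o (qblQ E χ ⊔ qblQ A χ) (qbl φ)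

  qbl-left : ∀ χ φ ψ → (qblQ E χ ⊔ qblQ A χ) ⊔ (qbl φ ⊔ qbl ψ) ≤ b → qbl φ ≤ b
  qbl-left χ φ ψ small = m⊔n≤o⇒m≤o (qbl φ) (qbl ψ) (m⊔n≤o⇒n≤o (qblQ E χ ⊔ qblQ A χ) (qbl φ ⊔ qbl ψ) small)

  qbl-right : ∀ χ φ ψ → (qblQ E χ ⊔ qblQ A χ) ⊔ (qbl φ ⊔ qbl ψ) ≤ b → qbl ψ ≤ b
  qbl-right χ φ ψ small = m⊔n≤o⇒n≤o (qbl φ) (qbl ψ) (m⊔n≤o⇒n≤o (qblQ E χ ⊔ qblQ A χ) (qbl φ ⊔ qbl ψ) small)

  join-results : ∀ q₁ q {e p ν φ ψ c P} →
    BlockResult b q₁ e p ν φ × BlockResult b q e (qblQ q₁ φ + p) ν ψ →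
    (∀ {S k} → Certified b S k e p (qblQ q₁ φ) (Holds q₁ ν φ) →
      Certified b S k e (qblQ q₁ φ + p) (qblQ q ψ) (Holds q ν ψ) → Certified b S k e p c P) →
    Σ (Requirement (len φ + 1 + len ψ)) λ R → ∀ {S k} → Meets S R →
      alternations q₁ φ ⊔ alternations q ψ ≤ k → Certified b S k e p c P
  join-results q₁ q {φ = φ} {ψ} ((R , result) , (R′ , result′)) assemble = join R R′ , λ {S} {k} M alt≤ → assemble {S} {k}
    (result {S} {k} (meets-left R R′ M) (≤-trans (m≤m⊔n (alternations q₁ φ) (alternations q ψ)) alt≤))
    (result′ {S} {k} (meets-right R R′ M) (≤-trans (m≤n⊔m (alternations q₁ φ) (alternations q ψ)) alt≤))

  analyse-pair  : ∀ φ ψ q₁ q {e p ν} → FreeBelow ν p φ → FreeBelow ν p ψ → qblQ q₁ φ + qblQ q ψ + p ≤ e →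
    qbl φ ≤ b → qbl ψ ≤ b → BlockResult b q₁ e p ν φ × BlockResult b q e (qblQ q₁ φ + p) ν ψ
  analyse-block : ∀ φ q {e p ν} → FreeBelow ν p φ → qblQ q φ + p ≤ e → qbl φ ≤ b → BlockResult b q e p ν φ
  analyse-leaf  : ∀ φ {m ν} → FreeBelow ν m φ → qbl φ ≤ b → LeafResult b m ν φ

  analyse-pair φ ψ q₁ q {e} {p} {ν} ν<φ ν<ψ fits smallφ smallψ =
    analyse-block φ q₁ ν<φ (≤-trans (+-monoˡ-≤ p (m≤m+n (qblQ q₁ φ) (qblQ q ψ))) fits) smallφ ,
    analyse-block ψ q (free-mono ψ (m≤n+m p (qblQ q₁ φ)) ν<ψ)
      (≤-trans (≤-reflexive (shuffle p (qblQ q₁ φ) (qblQ q ψ))) fits) smallψ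

  analyse-block φ@(atom R t u) q ν< fits small =
    leaf⇒block b q {φ = φ} ν< z≤n (analyse-leaf φ (free-mono φ (≤-trans (m≤n+m _ (qblQ q φ)) fits) ν<) small)
  analyse-block φ@(dvd d 2≤d t) q ν< fits small =
    leaf⇒block b q {φ = φ} ν< z≤n (analyse-leaf φ (free-mono φ (≤-trans (m≤n+m _ (qblQ q φ)) fits) ν<) small)
  analyse-block (¬' φ) E {ν = ν} ν< fits small with analyse-block φ A {ν = ν} ν< fits (qbl-child (¬' φ) φ small)
  ... | R , result = relax (n≤1+n _) R , λ {S} {k} M alt≤ → result {S} {k} (meets-relax _ R M) alt≤
  analyse-block (¬' φ) A {ν = ν} ν< fits small with analyse-block φ E {ν = ν} ν< fits (qbl-child (¬' φ) φ small)
  ... | R , result = relax (n≤1+n _) R , λ {S} {k} M alt≤ →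
    certified-⇔ b {S} {k} (λ σ → mk⇔ (λ s ¬s → ¬s s) (stable σ)) (result {S} {k} (meets-relax _ R M) alt≤)
    where
    stable : ∀ σ → ¬ ¬ Sat (σ ∘ ν) φ → Sat (σ ∘ ν) φ
    stable σ ¬¬s with Definable.decide (Sat-definable φ {ν = ν} ν<) σ
    ... | yes s = s
    ... | no ¬s = ⊥-elim (¬¬s ¬s)
  analyse-block (φ ∧' ψ) q {e} {p} {ν} ν< fits small =
    join-results q q {φ = φ} {ψ} (analyse-pair φ ψ q q (ν< ∘ inj₁) (ν< ∘ inj₂) fits
      (qbl-left (φ ∧' ψ) φ ψ small) (qbl-right (φ ∧' ψ) φ ψ small)) (λ {S} {k} → assemble q {S} {k} ν<)
    where
    assemble : ∀ q {S k e p ν} → FreeBelow ν p (φ ∧' ψ) → Certified b S k e p (qblQ q φ) (Holds q ν φ) →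
      Certified b S k e (qblQ q φ + p) (qblQ q ψ) (Holds q ν ψ) →
      Certified b S k e p (qblQ q φ + qblQ q ψ) (Holds q ν (φ ∧' ψ))
    assemble E {S} {k} {ν = ν} ν< cert cert′ = certified-× b {S} {k} (Holds-local E {φ = ψ} (ν< ∘ inj₂)) cert cert′
    assemble A {S} {k} {ν = ν} ν< cert cert′ = certified-⇔ b {S} {k}
      (λ σ → ¬×⇔⊎ (Definable.decide (Sat-definable φ {ν = ν} (ν< ∘ inj₁)) σ))
      (certified-⊎ b {S} {k} (certified-left b {S} {k} (qblQ A ψ) cert) (certified-right b {S} {k} (qblQ A φ) cert′))
  analyse-block (φ ∨' ψ) q {e} {p} {ν} ν< fits small =
    join-results q q {φ = φ} {ψ} (analyse-pair φ ψ q q (ν< ∘ inj₁) (ν< ∘ inj₂) fits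
      (qbl-left (φ ∨' ψ) φ ψ small) (qbl-right (φ ∨' ψ) φ ψ small)) (λ {S} {k} → assemble q {S} {k} ν<)
    where
    assemble : ∀ q {S k e p ν} → FreeBelow ν p (φ ∨' ψ) → Certified b S k e p (qblQ q φ) (Holds q ν φ) →
      Certified b S k e (qblQ q φ + p) (qblQ q ψ) (Holds q ν ψ) →
      Certified b S k e p (qblQ q φ + qblQ q ψ) (Holds q ν (φ ∨' ψ))
    assemble E {S} {k} {ν = ν} ν< cert cert′ =
      certified-⊎ b {S} {k} (certified-left b {S} {k} (qblQ E ψ) cert) (certified-right b {S} {k} (qblQ E φ) cert′)
    assemble A {S} {k} {ν = ν} ν< cert cert′ = certified-⇔ b {S} {k} (λ σ → ×⇔¬⊎)
      (certified-× b {S} {k} (Holds-local A {φ = ψ} (ν< ∘ inj₂)) cert cert′)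
  analyse-block (φ ⇒' ψ) q {e} {p} {ν} ν< fits small =
    join-results (dual q) q {φ = φ} {ψ} (analyse-pair φ ψ (dual q) q (ν< ∘ inj₁) (ν< ∘ inj₂) fits
      (qbl-left (φ ⇒' ψ) φ ψ small) (qbl-right (φ ⇒' ψ) φ ψ small)) (λ {S} {k} → assemble q {S} {k} ν<)
    where
    assemble : ∀ q {S k e p ν} → FreeBelow ν p (φ ⇒' ψ) → Certified b S k e p (qblQ (dual q) φ) (Holds (dual q) ν φ) →
      Certified b S k e (qblQ (dual q) φ + p) (qblQ q ψ) (Holds q ν ψ) →
      Certified b S k e p (qblQ (dual q) φ + qblQ q ψ) (Holds q ν (φ ⇒' ψ))
    assemble E {S} {k} {ν = ν} ν< cert cert′ = certified-⇔ b {S} {k}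
      (λ σ → ⊎⇔→ (Definable.decide (Sat-definable φ {ν = ν} (ν< ∘ inj₁)) σ))
      (certified-⊎ b {S} {k} (certified-left b {S} {k} (qblQ E ψ) cert) (certified-right b {S} {k} (qblQ A φ) cert′))
    assemble A {S} {k} {ν = ν} ν< cert cert′ = certified-⇔ b {S} {k}
      (λ σ → ×⇔¬→ (Definable.decide (Sat-definable φ {ν = ν} (ν< ∘ inj₁)) σ))
      (certified-× b {S} {k} (Holds-local A {φ = ψ} (ν< ∘ inj₂)) cert cert′)
  -- The quantifiers inside get blocks of their own. A quantified side is already charged for this,
  -- since with one of its two polarities its outermost quantifier counts as an alternation.
  analyse-block φ@(φ₁ ⇔' φ₂) q ν< fits small =
    leaf⇒block b q {φ = φ} ν< (⇔-alternations q φ₁ φ₂)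
      (analyse-leaf φ (free-mono φ (≤-trans (m≤n+m _ (qblQ q φ)) fits) ν<) small)
  analyse-block (∃' x φ) E {e} {p} {ν} ν< fits small =
    bind-∃ x φ ν< (analyse-block φ E (bind-below ν x p {φ} ν<)
      (≤-trans (≤-reflexive (+-suc (qblQ E φ) p)) fits) (qbl-child (∃' x φ) φ small))
  analyse-block φ@(∃' _ _) A ν< fits small =
    leaf⇒block b A {φ = φ} ν< (n≤1+n _) (analyse-leaf φ (free-mono φ fits ν<) small)
  analyse-block φ@(∀' _ _) E ν< fits small =
    leaf⇒block b E {φ = φ} ν< (n≤1+n _) (analyse-leaf φ (free-mono φ fits ν<) small)
  analyse-block (∀' x φ) A {e} {p} {ν} ν< fits small =
    bind-∀ x φ ν< (analyse-block φ A (bind-below ν x p {φ} ν<)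
      (≤-trans (≤-reflexive (+-suc (qblQ A φ) p)) fits) (qbl-child (∀' x φ) φ small))

  analyse-leaf (atom R t u) ν< small = atom-leaf b R t u ν<
  analyse-leaf (dvd d 2≤d t) ν< small = dvd-leaf b d 2≤d t ν<
  analyse-leaf (¬' φ) {m} {ν} ν< small with analyse-leaf φ {m} {ν} ν< (qbl-child (¬' φ) φ small)
  ... | R , result = relax (n≤1+n _) R , λ {S} {k} M altE altA σ≋σ′ ¬s s →
    ¬s (result {S} {k} (meets-relax _ R M) altA altE (≋-sym σ≋σ′) s)
  analyse-leaf (φ ∧' ψ) {m} {ν} ν< small
    with analyse-leaf φ {m} {ν} (ν< ∘ inj₁) (qbl-left (φ ∧' ψ) φ ψ small)
       | analyse-leaf ψ {m} {ν} (ν< ∘ inj₂) (qbl-right (φ ∧' ψ) φ ψ small)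
  ... | R , result | R′ , result′ = join R R′ , λ { {S} {k} M altE altA σ≋σ′ (s , s′) →
    result {S} {k} (meets-left R R′ M) (≤-trans (m≤m⊔n (alternations E φ) (alternations E ψ)) altE) (≤-trans (m≤m⊔n (alternations A φ) (alternations A ψ)) altA) σ≋σ′ s ,
    result′ {S} {k} (meets-right R R′ M) (≤-trans (m≤n⊔m (alternations E φ) (alternations E ψ)) altE) (≤-trans (m≤n⊔m (alternations A φ) (alternations A ψ)) altA) σ≋σ′ s′ }
  analyse-leaf (φ ∨' ψ) {m} {ν} ν< small
    with analyse-leaf φ {m} {ν} (ν< ∘ inj₁) (qbl-left (φ ∨' ψ) φ ψ small)
       | analyse-leaf ψ {m} {ν} (ν< ∘ inj₂) (qbl-right (φ ∨' ψ) φ ψ small)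
  ... | R , result | R′ , result′ = join R R′ , λ
    { {S} {k} M altE altA σ≋σ′ (inj₁ s) →
        inj₁ (result {S} {k} (meets-left R R′ M) (≤-trans (m≤m⊔n (alternations E φ) (alternations E ψ)) altE) (≤-trans (m≤m⊔n (alternations A φ) (alternations A ψ)) altA) σ≋σ′ s)
    ; {S} {k} M altE altA σ≋σ′ (inj₂ s′) →
        inj₂ (result′ {S} {k} (meets-right R R′ M) (≤-trans (m≤n⊔m (alternations E φ) (alternations E ψ)) altE) (≤-trans (m≤n⊔m (alternations A φ) (alternations A ψ)) altA) σ≋σ′ s′) }
  analyse-leaf (φ ⇒' ψ) {m} {ν} ν< small
    with analyse-leaf φ {m} {ν} (ν< ∘ inj₁) (qbl-left (φ ⇒' ψ) φ ψ small)
       | analyse-leaf ψ {m} {ν} (ν< ∘ inj₂) (qbl-right (φ ⇒' ψ) φ ψ small)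
  ... | R , result | R′ , result′ = join R R′ , λ {S} {k} M altE altA σ≋σ′ f s →
    result′ {S} {k} (meets-right R R′ M) (≤-trans (m≤n⊔m (alternations A φ) (alternations E ψ)) altE) (≤-trans (m≤n⊔m (alternations E φ) (alternations A ψ)) altA) σ≋σ′
      (f (result {S} {k} (meets-left R R′ M) (≤-trans (m≤m⊔n (alternations E φ) (alternations A ψ)) altA) (≤-trans (m≤m⊔n (alternations A φ) (alternations E ψ)) altE) (≋-sym σ≋σ′) s))
  analyse-leaf (φ ⇔' ψ) {m} {ν} ν< small
    with analyse-leaf φ {m} {ν} (ν< ∘ inj₁) (qbl-left (φ ⇔' ψ) φ ψ small)
       | analyse-leaf ψ {m} {ν} (ν< ∘ inj₂) (qbl-right (φ ⇔' ψ) φ ψ small)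
  ... | R , result | R′ , result′ = join R R′ , λ { {S} {k} M altE altA σ≋σ′ (f , g) →
    let φA∨ψE = m⊔n≤o⇒m≤o (alternations A φ ⊔ alternations E ψ) (alternations A ψ ⊔ alternations E φ) altE
        ψA∨φE = m⊔n≤o⇒n≤o (alternations A φ ⊔ alternations E ψ) (alternations A ψ ⊔ alternations E φ) altE
        φE = m⊔n≤o⇒n≤o (alternations A ψ) (alternations E φ) ψA∨φE
        φA = m⊔n≤o⇒m≤o (alternations A φ) (alternations E ψ) φA∨ψE
        ψE = m⊔n≤o⇒n≤o (alternations A φ) (alternations E ψ) φA∨ψE
        ψA = m⊔n≤o⇒m≤o (alternations A ψ) (alternations E φ) ψA∨φE
        R-inv  = result {S} {k} (meets-left R R′ M) φE φA
        R′-inv = result′ {S} {k} (meets-right R R′ M) ψE ψA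
    in (λ s → R′-inv σ≋σ′ (f (R-inv (≋-sym σ≋σ′) s))) ,
       (λ s → R-inv σ≋σ′ (g (R′-inv (≋-sym σ≋σ′) s))) }
  analyse-leaf (∃' x φ) {m} {ν} ν< small = block⇒leaf b E {φ = ∃' x φ} ν< refl
    (bind-∃ x φ ν< (analyse-block φ E (bind-below ν x m {φ} ν<)
      (≤-trans (≤-reflexive (+-suc (qblQ E φ) m)) (+-monoˡ-≤ m (≤-trans (qblQ≤qbl E (∃' x φ)) small)))
      (qbl-child (∃' x φ) φ small)))
  analyse-leaf (∀' x φ) {m} {ν} ν< small = block⇒leaf b A {φ = ∀' x φ} ν< refl
    (bind-∀ x φ ν< (analyse-block φ A (bind-below ν x m {φ} ν<)
      (≤-trans (≤-reflexive (+-suc (qblQ A φ) m)) (+-monoˡ-≤ m (≤-trans (qblQ≤qbl A (∀' x φ)) small)))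
      (qbl-child (∀' x φ) φ small)))

  -- The outermost block is not counted by `alternations`, hence one level beyond `qa φ`. The
  -- smaller of the two counts decides whether the whole formula is read as an existential or a
  -- universal block.
  invariant-formula : ∀ φ {m ν} → FreeBelow ν m φ → qbl φ ≤ b → Σ (Requirement (len φ)) λ R →
    ∀ {S} → Meets S R → Invariant b S (suc (qa φ)) m (Holds E ν φ)
  invariant-formula φ {m} {ν} ν< small with ≤-total (qaQ E φ) (qaQ A φ)
  ... | inj₁ E≤A = proj₁ result , λ {S} M {σ} {σ′} → block⇒invariant b E {φ = φ} ν< result S (qa φ) M
        (≤-trans (alternations≤qaQ E φ) (≤-reflexive (sym (m≤n⇒m⊓n≡m E≤A)))) {σ} {σ′}
    where result = analyse-block φ E {b + m} ν< (+-monoˡ-≤ m (≤-trans (qblQ≤qbl E φ) small)) small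
  ... | inj₂ A≤E = proj₁ result , λ {S} M {σ} {σ′} → block⇒invariant b A {φ = φ} ν< result S (qa φ) M
        (≤-trans (alternations≤qaQ A φ) (≤-reflexive (sym (m≥n⇒m⊓n≡n A≤E)))) {σ} {σ′}
    where result = analyse-block φ A {b + m} ν< (+-monoˡ-≤ m (≤-trans (qblQ≤qbl A φ) small)) small

-- Trackers and automata

-- A finite quotient of the slot values that can be updated when one more digit is read in every slot.
record Tracker (ϱ : ℕ) : Set where
  field
    size : ℕ
    code : Env → Fin size
    step : Fin size → (ℕ → ℕ) → Fin size
    code-cong : ∀ {σ σ′} → (∀ i → σ i ≡ σ′ i) → code σ ≡ code σ′
    code-step : ∀ σ d → (∀ i → d i < ϱ) → code (λ i → σ i *ᶻ + ϱ +ᶻ + d i) ≡ step (code σ) d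

record Linear (v : Env → ℤ) : Set where
  field
    cong-v : ∀ {σ σ′} → (∀ i → σ i ≡ σ′ i) → v σ ≡ v σ′
    linear : ∀ k σ τ → v (λ i → σ i *ᶻ k +ᶻ τ i) ≡ v σ *ᶻ k +ᶻ v τ

ev-linear : ∀ m f → Linear (ev m f)
ev-linear m f = record { cong-v = λ eq → ev-agree m f (λ {i} _ → eq i) ; linear = go m }
  where
  go : ∀ m k σ τ → ev m f (λ i → σ i *ᶻ k +ᶻ τ i) ≡ ev m f σ *ᶻ k +ᶻ ev m f τ
  go zero    k σ τ = refl
  go (suc m) k σ τ = trans (cong (_+ᶻ f m *ᶻ (σ m *ᶻ k +ᶻ τ m)) (go m k σ τ))
                           (lem (ev m f σ) (ev m f τ) (f m) (σ m) (τ m) k)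
    where
    lem : ∀ e e′ c s t k → (e *ᶻ k +ᶻ e′) +ᶻ c *ᶻ (s *ᶻ k +ᶻ t) ≡ (e +ᶻ c *ᶻ s) *ᶻ k +ᶻ (e′ +ᶻ c *ᶻ t)
    lem = solve-∀

slot-linear : ∀ i → Linear (λ σ → σ i)
slot-linear i = record { cong-v = λ eq → eq i ; linear = λ _ _ _ → refl }

ev-digits : ∀ m f {B} (d : ℕ → ℕ) → (∀ i → d i ≤ B) → ∣ ev m f (λ i → + d i) ∣ ≤ B * norm m f
ev-digits zero    f {B} d d≤B = z≤n
ev-digits (suc m) f {B} d d≤B = begin
  ∣ ev m f (λ i → + d i) +ᶻ f m *ᶻ + d m ∣      ≤⟨ ℤₚ.∣i+j∣≤∣i∣+∣j∣ (ev m f (λ i → + d i)) (f m *ᶻ + d m) ⟩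
  ∣ ev m f (λ i → + d i) ∣ + ∣ f m *ᶻ + d m ∣   ≤⟨ +-mono-≤ (ev-digits m f d d≤B) (≤-trans (≤-reflexive (ℤₚ.abs-* (f m) (+ d m))) (*-monoʳ-≤ ∣ f m ∣ (d≤B m))) ⟩
  B * norm m f + ∣ f m ∣ * B                     ≡⟨ cong (λ k → B * norm m f + k) (*-comm ∣ f m ∣ B) ⟩
  B * norm m f + B * ∣ f m ∣                     ≡⟨ sym (*-distribˡ-+ B (norm m f) ∣ f m ∣) ⟩
  B * (norm m f + ∣ f m ∣)                      ∎
  where open ≤-Reasoning

module Clamp (K : ℕ) where

  clamp : ℤ → ℤ
  clamp x = (x ℤ.⊓ + K) ℤ.⊔ (-ᶻ + K)

  clamp-high : ∀ {x} → + K ≤ᶻ x → clamp x ≡ + K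
  clamp-high p = trans (cong (ℤ._⊔ (-ᶻ + K)) (ℤₚ.i≥j⇒i⊓j≡j p)) (ℤₚ.i≥j⇒i⊔j≡i (ℤₚ.neg-≤-pos {K} {K}))

  clamp-low : ∀ {x} → x ≤ᶻ -ᶻ + K → clamp x ≡ -ᶻ + K
  clamp-low p = trans (cong (ℤ._⊔ (-ᶻ + K)) (ℤₚ.i≤j⇒i⊓j≡i (ℤₚ.≤-trans p (ℤₚ.neg-≤-pos {K} {K})))) (ℤₚ.i≤j⇒i⊔j≡j p)

  clamp-≈ : ∀ x → clamp x ≈[ K ] x
  clamp-≈ x with ℤₚ.≤-total (+ K) x
  ... | inj₁ K≤x = high (ℤₚ.≤-reflexive (sym (clamp-high K≤x))) K≤x
  ... | inj₂ x≤K with ℤₚ.≤-total x (-ᶻ + K)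
  ...   | inj₁ x≤-K = low (ℤₚ.≤-reflexive (clamp-low x≤-K)) x≤-K
  ...   | inj₂ -K≤x = same (trans (cong (ℤ._⊔ (-ᶻ + K)) (ℤₚ.i≤j⇒i⊓j≡i x≤K)) (ℤₚ.i≥j⇒i⊔j≡i -K≤x))

  ≈⇒clamp≡ : ∀ {x y} → x ≈[ K ] y → clamp x ≡ clamp y
  ≈⇒clamp≡ (same e)   = cong clamp e
  ≈⇒clamp≡ (high p q) = trans (clamp-high p) (sym (clamp-high q))
  ≈⇒clamp≡ (low p q)  = trans (clamp-low p) (sym (clamp-low q))

  0≤clamp+K : ∀ x → 0ℤ ≤ᶻ clamp x +ᶻ + K
  0≤clamp+K x = subst (_≤ᶻ clamp x +ᶻ + K) (ℤₚ.+-inverseˡ (+ K)) (ℤₚ.+-monoˡ-≤ (+ K) (ℤₚ.i≤j⊔i (x ℤ.⊓ + K) (-ᶻ + K)))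

  clamp+K< : ∀ x → ∣ clamp x +ᶻ + K ∣ < suc (K + K)
  clamp+K< x = s≤s (ℤₚ.drop‿+≤+ (subst (_≤ᶻ + (K + K)) (sym (ℤₚ.0≤i⇒+∣i∣≡i (0≤clamp+K x)))
    (ℤₚ.+-monoˡ-≤ (+ K) (ℤₚ.⊔-lub (ℤₚ.i⊓j≤j x (+ K)) (ℤₚ.neg-≤-pos {K} {K})))))

  encode : ℤ → Fin (suc (K + K))
  encode x = fromℕ< (clamp+K< x)

  decodeᶻ : Fin (suc (K + K)) → ℤ
  decodeᶻ q = + toℕ q -ᶻ + K

  decode-encode : ∀ x → decodeᶻ (encode x) ≈[ K ] x
  decode-encode x = subst (_≈[ K ] x) (sym eq) (clamp-≈ x)
    where
    lem : ∀ a k → (a +ᶻ k) -ᶻ k ≡ a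
    lem = solve-∀
    eq : decodeᶻ (encode x) ≡ clamp x
    eq = trans (cong (λ n → + n -ᶻ + K) (toℕ-fromℕ< (clamp+K< x)))
           (trans (cong (_-ᶻ + K) (ℤₚ.0≤i⇒+∣i∣≡i (0≤clamp+K x))) (lem (clamp x) (+ K)))

  encode-≈ : ∀ {x y} → x ≈[ K ] y → encode x ≡ encode y
  encode-≈ {x} {y} p = fromℕ<-cong _ _ (cong (λ z → ∣ z +ᶻ + K ∣) (≈⇒clamp≡ p)) (clamp+K< x) (clamp+K< y)

-- If `K ≤ x`, then `ϱ * x + z` is at least `ϱ * K - (ϱ - 1) * K = K`, so saturated values stay
-- saturated when a digit is appended. By `ev-digits`, the condition on `z` holds as soon as `K`
-- bounds the norm.
≈-step : ∀ {K x y} ϱ z → 1 ≤ ϱ → ∣ z ∣ ≤ (ϱ ∸ 1) * K → x ≈[ K ] y → (x *ᶻ + ϱ +ᶻ z) ≈[ K ] (y *ᶻ + ϱ +ᶻ z)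
≈-step {K} {x} {y} ϱ z 1≤ϱ small x≈y = ≈-translate {(ϱ ∸ 1) * K} {K} {ϱ * K} z
  (≤-reflexive (trans (+-comm ((ϱ ∸ 1) * K) K) (cong (_* K) (m+[n∸m]≡n 1≤ϱ)))) small (scale x≈y)
  where
  instance _ = ℕ.>-nonZero 1≤ϱ
  scale : x ≈[ K ] y → (x *ᶻ + ϱ) ≈[ ϱ * K ] (y *ᶻ + ϱ)
  scale (same e) = same (cong (_*ᶻ + ϱ) e)
  scale (high p q) = high (go p) (go q)
    where
    go : ∀ {x} → + K ≤ᶻ x → + (ϱ * K) ≤ᶻ x *ᶻ + ϱ
    go {x} p = subst (_≤ᶻ x *ᶻ + ϱ) (trans (sym (ℤₚ.pos-* K ϱ)) (cong +_ (*-comm K ϱ))) (ℤₚ.*-monoʳ-≤-nonNeg (+ ϱ) p)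
  scale (low p q) = low (go p) (go q)
    where
    go : ∀ {x} → x ≤ᶻ -ᶻ + K → x *ᶻ + ϱ ≤ᶻ -ᶻ + (ϱ * K)
    go {x} p = subst (x *ᶻ + ϱ ≤ᶻ_) (trans (sym (ℤₚ.neg-distribˡ-* (+ K) (+ ϱ)))
      (cong -ᶻ_ (trans (sym (ℤₚ.pos-* K ϱ)) (cong +_ (*-comm K ϱ))))) (ℤₚ.*-monoʳ-≤-nonNeg (+ ϱ) p)

module _ {ϱ : ℕ} (1≤ϱ : 1 ≤ ϱ) where

  private
    ≤pred : ∀ {d} → d < ϱ → d ≤ ϱ ∸ 1
    ≤pred (s≤s d≤) = d≤

  clampTracker : ∀ m f K → norm m f ≤ K → Tracker ϱ
  clampTracker m f K norm≤K = record
    { size = suc (K + K)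
    ; code = encode ∘ ev m f
    ; step = λ q d → encode (decodeᶻ q *ᶻ + ϱ +ᶻ ev m f (λ i → + d i))
    ; code-cong = λ eq → cong encode (Linear.cong-v (ev-linear m f) eq)
    ; code-step = λ σ d d<ϱ → trans (cong encode (Linear.linear (ev-linear m f) (+ ϱ) σ (λ i → + d i)))
        (encode-≈ (≈-step ϱ (ev m f (λ i → + d i)) 1≤ϱ
          (≤-trans (ev-digits m f d (λ i → ≤pred (d<ϱ i))) (*-monoʳ-≤ (ϱ ∸ 1) norm≤K))
          (≈-sym (decode-encode (ev m f σ)))))
    }
    where open Clamp K

congruent-small : ∀ {D r s} → r < D → s < D → Congruent D (+ r) (+ s) → r ≡ s
congruent-small {D} {r} {s} r<D s<D (by t eq) = ℤₚ.+-injective (sym (trans eq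
  (trans (cong (λ u → + r +ᶻ u *ᶻ + D) t≡0) (ℤₚ.+-identityʳ (+ r)))))
  where
  lem : ∀ r x → x ≡ (r +ᶻ x) -ᶻ r
  lem = solve-∀
  small : ∣ t ∣ * D < 1 * D
  small = begin-strict
    ∣ t ∣ * D        ≡⟨ sym (ℤₚ.abs-* t (+ D)) ⟩
    ∣ t *ᶻ + D ∣     ≡⟨ cong ∣_∣ (trans (lem (+ r) (t *ᶻ + D)) (trans (cong (_-ᶻ + r) (sym eq)) (ℤₚ.m-n≡m⊖n s r))) ⟩
    ∣ s ℤ.⊖ r ∣      ≤⟨ ℤₚ.∣m⊝n∣≤m⊔n s r ⟩
    s ⊔ r           <⟨ ⊔-pres-<m s<D r<D ⟩
    D               ≡⟨ sym (*-identityˡ D) ⟩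
    1 * D           ∎
    where open ≤-Reasoning
  t≡0 : t ≡ 0ℤ
  t≡0 = ℤₚ.∣i∣≡0⇒i≡0 (n<1⇒n≡0 (*-cancelʳ-< D ∣ t ∣ 1 small))

module _ (D : ℕ) {{_ : NonZero D}} where

  %ℕ-congruent : ∀ x → Congruent D (+ (x %ℕ D)) x
  %ℕ-congruent x = by (x /ℕ D) (a≡a%ℕn+[a/ℕn]*n x D)

  residue : ℤ → Fin D
  residue x = fromℕ< (n%ℕd<d x D)

  residue-congruent : ∀ {x y} → Congruent D x y → residue x ≡ residue y
  residue-congruent {x} {y} c = fromℕ<-cong _ _
    (congruent-small (n%ℕd<d x D) (n%ℕd<d y D)
      (cong-trans (%ℕ-congruent x) (cong-trans c (cong-sym (%ℕ-congruent y))))) (n%ℕd<d x D) (n%ℕd<d y D)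

  congruent-residue : ∀ {x y} → residue x ≡ residue y → Congruent D x y
  congruent-residue {x} {y} e = cong-trans (cong-sym (%ℕ-congruent x))
    (cong-trans (cong-reflexive (cong +_ (trans (sym (toℕ-fromℕ< (n%ℕd<d x D))) (trans (cong toℕ e) (toℕ-fromℕ< (n%ℕd<d y D))))))
                (%ℕ-congruent y))

  residueTracker : ∀ {ϱ v} → Linear v → Tracker ϱ
  residueTracker {ϱ} {v} lin = record
    { size = D
    ; code = residue ∘ v
    ; step = λ q d → residue (+ toℕ q *ᶻ + ϱ +ᶻ v (λ i → + d i))
    ; code-cong = λ eq → cong residue (Linear.cong-v lin eq)
    ; code-step = λ σ d d<ϱ → trans (cong residue (Linear.linear lin (+ ϱ) σ (λ i → + d i)))
        (residue-congruent (cong-+ (subst₂ (Congruent D) (ℤₚ.*-comm (+ ϱ) (v σ)) (ℤₚ.*-comm (+ ϱ) (+ toℕ (residue (v σ))))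
            (cong-* (+ ϱ) (cong-trans (cong-sym (%ℕ-congruent (v σ))) (cong-reflexive (cong +_ (sym (toℕ-fromℕ< (n%ℕd<d (v σ) D))))))))
          (cong-reflexive refl)))
    }

unitTracker : ∀ {ϱ} → Tracker ϱ
unitTracker = record
  { size = 1 ; code = λ _ → Fin.zero ; step = λ q _ → q ; code-cong = λ _ → refl ; code-step = λ _ _ _ → refl }

module _ {ϱ : ℕ} (T T′ : Tracker ϱ) where
  private
    module T = Tracker T
    module T′ = Tracker T′

  productTracker : Tracker ϱ
  productTracker = record
    { size = T.size * T′.size
    ; code = λ σ → combine (T.code σ) (T′.code σ)
    ; step = λ q d → combine (T.step (proj₁ (remQuot {T.size} T′.size q)) d) (T′.step (proj₂ (remQuot {T.size} T′.size q)) d)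
    ; code-cong = λ eq → cong₂ combine (T.code-cong eq) (T′.code-cong eq)
    ; code-step = λ σ d d<ϱ → let e = remQuot-combine {T.size} (T.code σ) (T′.code σ) in cong₂ combine
        (trans (T.code-step σ d d<ϱ) (cong (λ p → T.step (proj₁ p) d) (sym e)))
        (trans (T′.code-step σ d d<ϱ) (cong (λ p → T′.step (proj₂ p) d) (sym e)))
    }

module Automaton {ϱ r : ℕ} (1≤ϱ : 1 ≤ ϱ) (T : Tracker ϱ) (μ : ℕ → Var) (accepting : Fin (Tracker.size T) → Bool) where
  open Tracker T

  -- Variables without a track have value 0, like in envOf.
  digitOf : Letter ϱ r → Var → ℕ
  digitOf l x with x ℕₚ.<? r
  ... | yes x<r = toℕ (l (fromℕ< x<r))
  ... | no _    = 0

  digitOf< : ∀ l x → digitOf l x < ϱ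
  digitOf< l x with x ℕₚ.<? r
  ... | yes x<r = toℕ<n (l (fromℕ< x<r))
  ... | no _    = 1≤ϱ

  -- A nonzero leading digit contributes `- ϱ ^ n`, whatever the digit is; this is Horner's scheme
  -- started at -1.
  sign : ℕ → ℤ
  sign zero    = 0ℤ
  sign (suc _) = ℤ.-1ℤ

  append : Env → Letter ϱ r → Env
  append σ l i = σ i *ᶻ + ϱ +ᶻ + digitOf l (μ i)

  start : Letter ϱ r → Env
  start l i = sign (digitOf l (μ i))

  -- The extra state is initial: the first letter is read as signs, and the empty word must be
  -- rejected.
  next-state : Fin (suc size) → Letter ϱ r → Fin (suc size)
  next-state Fin.zero    l = Fin.suc (code (start l))
  next-state (Fin.suc q) l = Fin.suc (step q (λ i → digitOf l (μ i)))

  is-final : Fin (suc size) → Bool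
  is-final Fin.zero    = false
  is-final (Fin.suc q) = accepting q

  automaton : DWA ϱ r
  automaton = record { size = suc size ; init = Fin.zero ; δ = next-state ; final = is-final }

  open DWA automaton using (δ*)

  δ*-code : ∀ w σ → δ* (Fin.suc (code σ)) w ≡ Fin.suc (code (foldl append σ w))
  δ*-code []      σ = refl
  δ*-code (l ∷ w) σ = trans (cong (λ q → δ* (Fin.suc q) w) (sym (code-step σ (λ i → digitOf l (μ i)) (λ i → digitOf< l (μ i)))))
                            (δ*-code w (append σ l))

  run : ℤ → List (Digit ϱ) → ℤ
  run = foldl (λ z d → z *ᶻ + ϱ +ᶻ + toℕ d)

  run-split : ∀ z ds → run z ds ≡ z *ᶻ + (ϱ ^ length ds) +ᶻ run 0ℤ ds
  run-split z [] = lem z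
    where
    lem : ∀ z → z ≡ z *ᶻ + 1 +ᶻ 0ℤ
    lem = solve-∀
  run-split z (d ∷ ds) = trans (run-split (z *ᶻ + ϱ +ᶻ + toℕ d) ds)
    (trans (lem z (+ ϱ) (+ toℕ d) (+ (ϱ ^ length ds)) (run 0ℤ ds))
      (cong₂ (λ a c → z *ᶻ a +ᶻ c) (sym (ℤₚ.pos-* ϱ (ϱ ^ length ds)))
        (sym (run-split (0ℤ *ᶻ + ϱ +ᶻ + toℕ d) ds))))
    where
    lem : ∀ z ϱ d p R → (z *ᶻ ϱ +ᶻ d) *ᶻ p +ᶻ R ≡ z *ᶻ (ϱ *ᶻ p) +ᶻ ((0ℤ *ᶻ ϱ +ᶻ d) *ᶻ p +ᶻ R)
    lem = solve-∀

  run-valℕ : ∀ n ds → run (+ n) ds ≡ + foldl (λ acc d → acc ℕ.* ϱ ℕ.+ toℕ d) n ds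
  run-valℕ n []       = refl
  run-valℕ n (d ∷ ds) = trans (cong (λ z → run (z +ᶻ + toℕ d) ds) (sym (ℤₚ.pos-* n ϱ))) (run-valℕ (n * ϱ + toℕ d) ds)

  valℤ-run : ∀ d ds → valℤ ϱ d ds ≡ run (sign (toℕ d)) ds
  valℤ-run d ds with toℕ d
  ... | zero  = sym (run-valℕ 0 ds)
  ... | suc _ = sym (trans (run-split ℤ.-1ℤ ds) (trans (cong (ℤ.-1ℤ *ᶻ + (ϱ ^ length ds) +ᶻ_) (run-valℕ 0 ds))
      (lem (+ (ϱ ^ length ds)) (+ valℕ ϱ ds))))
    where
    lem : ∀ p v → ℤ.-1ℤ *ᶻ p +ᶻ v ≡ v -ᶻ p
    lem = solve-∀

  foldl-append : ∀ w σ i → foldl append σ w i ≡ foldl (λ z l → z *ᶻ + ϱ +ᶻ + digitOf l (μ i)) (σ i) w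
  foldl-append []      σ i = refl
  foldl-append (l ∷ w) σ i = foldl-append w (append σ l) i

  envOf-decode : ∀ b w i → envOf (decode ϱ r b w) (μ i) ≡ foldl append (start b) w i
  envOf-decode b w i = trans (go (μ i)) (sym (foldl-append w (start b) i))
    where
    go : ∀ x → envOf (decode ϱ r b w) x ≡ foldl (λ z l → z *ᶻ + ϱ +ᶻ + digitOf l x) (sign (digitOf b x)) w
    go x with x ℕₚ.<? r
    ... | yes x<r = trans (valℤ-run (b (fromℕ< x<r)) (map (λ l → l (fromℕ< x<r)) w)) (unmap w (sign (toℕ (b (fromℕ< x<r)))))
      where
      unmap : ∀ w z → run z (map (λ l → l (fromℕ< x<r)) w) ≡ foldl (λ z l → z *ᶻ + ϱ +ᶻ + toℕ (l (fromℕ< x<r))) z w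
      unmap []      z = refl
      unmap (l ∷ w) z = unmap w _
    ... | no _ = zeros w
      where
      zeros : ∀ (w : List (Letter ϱ r)) → 0ℤ ≡ foldl (λ z l → z *ᶻ + ϱ +ᶻ 0ℤ) 0ℤ w
      zeros []      = refl
      zeros (l ∷ w) = zeros w

  represents : ∀ {U : (Fin r → ℤ) → Set} → (∀ a → accepting (code (envOf a ∘ μ)) ≡ true ⇔ U a) → Represents automaton U
  represents {U} accepting⇔ = (λ ()) , λ b w → mk⇔
    (λ acc → Equivalence.to (accepting⇔ (decode ϱ r b w)) (trans (sym (final≡ b w)) acc))
    (λ u → trans (final≡ b w) (Equivalence.from (accepting⇔ (decode ϱ r b w)) u))
    where
    final≡ : ∀ b w → is-final (δ* Fin.zero (b ∷ w)) ≡ accepting (code (envOf (decode ϱ r b w) ∘ μ))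
    final≡ b w = trans (cong is-final (δ*-code w (start b))) (cong accepting (code-cong (λ i → sym (envOf-decode b w i))))

-- Size bounds

length-branches : ∀ m T → length (branches m T) ≡ suc (length T)
length-branches m T = cong suc (length-map (λ f → map (elim m f) T) T)

module _ (N : ℕ) where

  Short : Stage → Set
  Short st = ∀ {T} → T ∈ Stage.alternatives st → length T ≤ N

  length-concat : ∀ (Ts : List (List Form)) → (∀ {T} → T ∈ Ts → length T ≤ N) → length (concat Ts) ≤ length Ts * N
  length-concat []       short = z≤n
  length-concat (T ∷ Ts) short = ≤-trans (≤-reflexive (length-++ T))
    (+-mono-≤ (short (here refl)) (length-concat Ts (λ i → short (there i))))

  length-concatMap : ∀ m (Ts : List (List Form)) → (∀ {T} → T ∈ Ts → length T ≤ N) →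
    length (concatMap (branches m) Ts) ≤ length Ts * suc N
  length-concatMap m []       short = z≤n
  length-concatMap m (T ∷ Ts) short = ≤-trans (≤-reflexive (length-++ (branches m T)))
    (+-mono-≤ (≤-trans (≤-reflexive (length-branches m T)) (s≤s (short (here refl))))
              (length-concatMap m Ts (λ i → short (there i))))

  next-short : ∀ m st → Short st → Short (next m st)
  next-short m st short {T₁} T₁∈ with ∈-concat⁻′ (map (branches m) (Stage.alternatives st)) T₁∈
  ... | Ts , T₁∈Ts , Ts∈ with ∈-map⁻ (branches m) Ts∈
  ...   | T , T∈ , refl with T₁∈Ts
  ...     | here refl = ≤-trans (length-filter (λ h → h m ℤ.≟ 0ℤ) T) (short T∈)
  ...     | there T₁∈′ with ∈-map⁻ (λ f → map (elim m f) T) T₁∈′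
  ...       | f , _ , refl = ≤-trans (≤-reflexive (length-map (elim m f) T)) (short T∈)

  stages-short : ∀ j m st → Short st → Short (stages j m st)
  stages-short zero    m st short = short
  stages-short (suc j) m st short = stages-short j m (next (j + m) st) (next-short (j + m) st short)

  stages-alternatives : ∀ j m st → Short st →
    length (Stage.alternatives (stages j m st)) ≤ length (Stage.alternatives st) * suc N ^ j
  stages-alternatives zero    m st short = ≤-reflexive (sym (*-identityʳ _))
  stages-alternatives (suc j) m st short = begin
    length (Stage.alternatives (stages j m (next (j + m) st)))
      ≤⟨ stages-alternatives j m (next (j + m) st) (next-short (j + m) st short) ⟩
    length (Stage.alternatives (next (j + m) st)) * suc N ^ j
      ≤⟨ *-monoˡ-≤ (suc N ^ j) (length-concatMap (j + m) (Stage.alternatives st) short) ⟩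
    length (Stage.alternatives st) * suc N * suc N ^ j
      ≡⟨ *-assoc (length (Stage.alternatives st)) (suc N) (suc N ^ j) ⟩
    length (Stage.alternatives st) * (suc N * suc N ^ j) ∎
    where open ≤-Reasoning

  stages-α : ∀ j m st → suc (Stage.α (stages j m st)) ≡ 2 ^ j * suc (Stage.α st)
  stages-α zero    m st = sym (*-identityˡ _)
  stages-α (suc j) m st = trans (stages-α j m (next (j + m) st)) (lem (2 ^ j) (Stage.α st))
    where
    lem : ∀ p a → p * suc (suc (a + a)) ≡ 2 * p * suc a
    lem = solveℕ-∀

  -- L bounds the number of alternatives; the summand a * L on the left makes the induction go through.
  stages-w : ∀ j m st → Short st → ∀ {L a} → length (Stage.alternatives st) ≤ L → 2 ^ j * suc (Stage.α st) ≤ a →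
    Stage.w (stages j m st) + a * L ≤ Stage.w st + a * (2 * j + L * suc N ^ j)
  stages-w zero    m st short {L} {a} _ _ = ≤-reflexive (cong (λ k → Stage.w st + a * k) (sym (*-identityʳ L)))
  -- Adding `a * (L * N)` turns `a * L` into `a * (L * suc N)`, the summand of the following stage,
  -- which has at most `L * suc N` lists.
  stages-w (suc j) m st short {L} {a} ≤L a-large = +-cancelʳ-≤ (a * (L * N)) _ _ (begin
    Stage.w (stages (suc j) m st) + a * L + a * (L * N)
      ≡⟨ lem₁ (Stage.w (stages (suc j) m st)) a L N ⟩
    Stage.w (stages j m (next (j + m) st)) + a * (L * suc N)
      ≤⟨ stages-w j m (next (j + m) st) (next-short (j + m) st short) {L * suc N} {a}
           (≤-trans (length-concatMap (j + m) (Stage.alternatives st) short) (*-monoˡ-≤ (suc N) ≤L))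
           (≤-trans (≤-reflexive (lem₂ (2 ^ j) α)) a-large) ⟩
    w + (α + α + 2) + α * length (Stage.all-forms st) + a * (2 * j + L * suc N * suc N ^ j)
      ≤⟨ +-monoˡ-≤ (a * (2 * j + L * suc N * suc N ^ j)) growth ⟩
    w + a * (2 + L * N) + a * (2 * j + L * suc N * suc N ^ j)
      ≡⟨ lem₃ w a L N j (suc N ^ j) ⟩
    w + a * (2 * suc j + L * (suc N * suc N ^ j)) + a * (L * N) ∎)
    where
    open ≤-Reasoning
    open Stage st using (w; α)
    lem₁ : ∀ w a L N → w + a * L + a * (L * N) ≡ w + a * (L * suc N)
    lem₁ = solveℕ-∀
    lem₂ : ∀ p a → p * suc (suc (a + a)) ≡ 2 * p * suc a
    lem₂ = solveℕ-∀
    lem₃ : ∀ w a L N j p → w + a * (2 + L * N) + a * (2 * j + L * suc N * p) ≡ w + a * (2 * suc j + L * (suc N * p)) + a * (L * N)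
    lem₃ = solveℕ-∀
    lem₄ : ∀ w a F → w + suc a * (2 + F) ≡ w + (a + a + 2) + a * F + F
    lem₄ = solveℕ-∀
    suc-α≤a : suc α ≤ a
    suc-α≤a = ≤-trans (m≤n*m (suc α) (2 ^ suc j) {{m^n≢0 2 (suc j)}}) a-large
    growth : w + (α + α + 2) + α * length (Stage.all-forms st) ≤ w + a * (2 + L * N)
    growth = begin
      w + (α + α + 2) + α * length (Stage.all-forms st)
        ≤⟨ +-monoʳ-≤ (w + (α + α + 2)) (*-monoʳ-≤ α (≤-trans (length-concat (Stage.alternatives st) short) (*-monoˡ-≤ N ≤L))) ⟩
      w + (α + α + 2) + α * (L * N)             ≤⟨ m≤m+n _ (L * N) ⟩
      w + (α + α + 2) + α * (L * N) + L * N     ≡⟨ sym (lem₄ w α (L * N)) ⟩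
      w + suc α * (2 + L * N)                   ≤⟨ +-monoʳ-≤ w (*-monoˡ-≤ (2 + L * N) suc-α≤a) ⟩
      w + a * (2 + L * N)                       ∎

module _ (b m : ℕ) (S : Sys) where
  open Sys S
  private
    N = length forms
    st = stage (forms ∷ []) α w D
    short : Short N st
    short (here refl) = ≤-refl

  -- Counting one form more makes the recursion a pure power: `(N + 1) ^ b * N + 1` is at most
  -- `(N + 1) ^ (b + 1)`.
  block-forms : suc (length (Sys.forms (block b m S))) ≤ suc N ^ suc b
  block-forms = begin
    suc (length (Sys.forms (block b m S)))
      ≤⟨ s≤s (≤-trans (length-concat N (Stage.alternatives (stages b m st)) (stages-short N b m st short))
           (*-monoˡ-≤ N (stages-alternatives N b m st short))) ⟩
    1 + 1 * suc N ^ b * N       ≤⟨ +-monoˡ-≤ (1 * suc N ^ b * N) (m^n>0 (suc N) b) ⟩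
    suc N ^ b + 1 * suc N ^ b * N ≡⟨ lem (suc N ^ b) N ⟩
    suc N * suc N ^ b            ∎
    where
    open ≤-Reasoning
    lem : ∀ p N → p + 1 * p * N ≡ suc N * p
    lem = solveℕ-∀

  block-α : suc (Sys.α (block b m S)) ≡ 2 ^ b * suc α
  block-α = stages-α N b m st

  block-w : ∀ {a} → 2 ^ b * suc α ≤ a → Sys.w (block b m S) ≤ w + a * (2 * b + suc N ^ b)
  block-w {a} a-large = ≤-trans (m≤m+n _ (a * 1))
    (≤-trans (stages-w N b m st short {1} {a} ≤-refl a-large)
      (≤-reflexive (cong (λ k → w + a * (2 * b + k)) (*-identityˡ (suc N ^ b)))))

-- Brings the exponent `b * k` of the coefficients, which grows linearly, below the power that
-- governs the forms.
bernoulli : ∀ b k → suc (b * k) ≤ suc b ^ k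
bernoulli b zero    = s≤s (≤-reflexive (*-zeroʳ b))
bernoulli b (suc k) = begin
  suc (b * suc k)             ≡⟨ cong suc (*-suc b k) ⟩
  suc (b + b * k)             ≡⟨ sym (+-suc b (b * k)) ⟩
  b + suc (b * k)             ≤⟨ +-mono-≤ (m≤m*n b (suc b ^ k) {{m^n≢0 (suc b) k}}) (bernoulli b k) ⟩
  b * suc b ^ k + suc b ^ k   ≡⟨ +-comm (b * suc b ^ k) (suc b ^ k) ⟩
  suc b ^ suc k               ∎
  where open ≤-Reasoning

module _ {n : ℕ} (3≤n : 3 ≤ n) where
  private
    instance _ = ℕ.>-nonZero (≤-trans (s≤s z≤n) 3≤n)

  3-absorb : ∀ e {x y z} → x ≤ n ^ e → y ≤ n ^ e → z ≤ n ^ e → x + y + z ≤ n ^ suc e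
  3-absorb e {x} {y} {z} p q r = begin
    x + y + z                   ≤⟨ +-mono-≤ (+-mono-≤ p q) r ⟩
    n ^ e + n ^ e + n ^ e       ≡⟨ lem (n ^ e) ⟩
    3 * n ^ e                   ≤⟨ *-monoˡ-≤ (n ^ e) 3≤n ⟩
    n ^ suc e                   ∎
    where
    open ≤-Reasoning
    lem : ∀ p → p + p + p ≡ 3 * p
    lem = solveℕ-∀

  2-absorb : ∀ e {x y} → x ≤ n ^ e → y ≤ n ^ e → x + y ≤ n ^ suc e
  2-absorb e {x} {y} p q = ≤-trans (≤-reflexive (sym (+-identityʳ (x + y)))) (3-absorb e {z = 0} p q z≤n)

  1≤n^ : ∀ e → 1 ≤ n ^ e
  1≤n^ e = m^n>0 n e

  2^≤n^ : ∀ e → 2 ^ e ≤ n ^ e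
  2^≤n^ e = ^-monoˡ-≤ e (≤-trans (n≤1+n 2) 3≤n)

  -- In every block the number of forms is raised to the power `b + 1`, and `suc α` is multiplied by
  -- `2 ^ b`, at most `n ^ b`. The increment of `w` is at most `n ^ (b * suc k + 2)` times
  -- `n ^ suc (b * suc b ^ k)`, and these exponents sum to at most `2 * suc b ^ suc k + 1`.
  record Bounded (b k : ℕ) (S : Sys) : Set where
    open Sys S
    field
      forms≤ : suc (length forms) ≤ n ^ (suc b ^ k)
      α≤     : suc α ≤ n ^ (b * k + 2)
      w≤     : w ≤ n ^ (2 * suc b ^ k + 2)

  module _ {b : ℕ} (1≤b : 1 ≤ b) where

    block-bounded : ∀ k m S → Bounded b k S → Bounded b (suc k) (block b m S)
    block-bounded k m S bounded = record
      { forms≤ = begin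
          suc (length (Sys.forms (block b m S)))  ≤⟨ block-forms b m S ⟩
          suc (length forms) ^ suc b              ≤⟨ ^-monoˡ-≤ (suc b) forms≤ ⟩
          (n ^ P) ^ suc b                         ≡⟨ ^-*-assoc n P (suc b) ⟩
          n ^ (P * suc b)                         ≡⟨ cong (n ^_) (*-comm P (suc b)) ⟩
          n ^ P′                                  ∎
      ; α≤ = ≤-trans (≤-reflexive (block-α b m S)) a-large
      ; w≤ = begin
          Sys.w (block b m S)                     ≤⟨ block-w b m S a-large ⟩
          w + n ^ (b * suc k + 2) * (2 * b + suc (length forms) ^ b)
            ≤⟨ 2-absorb (2 * P′ + 1) (≤-trans w≤ (^-monoʳ-≤ n e₁)) product-small ⟩
          n ^ suc (2 * P′ + 1)                    ≡⟨ cong (n ^_) (sym (+-suc (2 * P′) 1)) ⟩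
          n ^ (2 * P′ + 2)                        ∎ }
      where
      open ≤-Reasoning
      open Bounded bounded
      open Sys S
      P = suc b ^ k
      P′ = suc b ^ suc k
      1≤P : 1 ≤ P
      1≤P = m^n>0 (suc b) k
      lem : ∀ b k → b + (b * k + 2) ≡ b * suc k + 2
      lem = solveℕ-∀
      a-large : 2 ^ b * suc α ≤ n ^ (b * suc k + 2)
      a-large = begin
        2 ^ b * suc α                ≤⟨ *-mono-≤ (2^≤n^ b) α≤ ⟩
        n ^ b * n ^ (b * k + 2)      ≡⟨ sym (^-distribˡ-+-* n b (b * k + 2)) ⟩
        n ^ (b + (b * k + 2))        ≡⟨ cong (n ^_) (lem b k) ⟩
        n ^ (b * suc k + 2)          ∎
      -- Rests on `1 ≤ b`: the exponents must grow from block to block to absorb the sum.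
      e₁ : 2 * P + 2 ≤ 2 * P′ + 1
      e₁ = begin
        2 * P + 2            ≡⟨ lem′ P ⟩
        2 * (1 + P)          ≤⟨ *-monoʳ-≤ 2 (+-monoˡ-≤ P (*-mono-≤ 1≤b 1≤P)) ⟩
        2 * (b * P + P)      ≡⟨ cong (2 *_) (+-comm (b * P) P) ⟩
        2 * P′               ≤⟨ m≤m+n (2 * P′) 1 ⟩
        2 * P′ + 1           ∎
        where
        lem′ : ∀ P → 2 * P + 2 ≡ 2 * (1 + P)
        lem′ = solveℕ-∀
      b≤n^bP : b ≤ n ^ (b * P)
      b≤n^bP = begin
        b              ≤⟨ <⇒≤ (n<2^n b) ⟩
        2 ^ b          ≤⟨ 2^≤n^ b ⟩
        n ^ b          ≤⟨ ^-monoʳ-≤ n (m≤m*n b P {{ℕ.>-nonZero 1≤P}}) ⟩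
        n ^ (b * P)    ∎
      factor-small : 2 * b + suc (length forms) ^ b ≤ n ^ suc (b * P)
      factor-small = ≤-trans (≤-reflexive (cong (_+ suc (length forms) ^ b) (cong (λ k → b + k) (+-identityʳ b))))
        (3-absorb (b * P) b≤n^bP b≤n^bP (≤-trans (^-monoˡ-≤ b forms≤)
          (≤-reflexive (trans (^-*-assoc n P b) (cong (n ^_) (*-comm P b))))))
      product-small : n ^ (b * suc k + 2) * (2 * b + suc (length forms) ^ b) ≤ n ^ (2 * P′ + 1)
      product-small = begin
        n ^ (b * suc k + 2) * (2 * b + suc (length forms) ^ b)  ≤⟨ *-monoʳ-≤ (n ^ (b * suc k + 2)) factor-small ⟩
        n ^ (b * suc k + 2) * n ^ suc (b * P)                   ≡⟨ sym (^-distribˡ-+-* n (b * suc k + 2) (suc (b * P))) ⟩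
        n ^ (b * suc k + 2 + suc (b * P))                       ≤⟨ ^-monoʳ-≤ n (begin
          b * suc k + 2 + suc (b * P)      ≡⟨ lem₂ (b * suc k) (b * P) ⟩
          suc (b * suc k) + (1 + b * P) + 1 ≤⟨ +-monoˡ-≤ 1 (+-mono-≤ (bernoulli b (suc k)) (+-monoˡ-≤ (b * P) 1≤P)) ⟩
          P′ + P′ + 1                      ≡⟨ cong (λ k → P′ + k + 1) (sym (+-identityʳ P′)) ⟩
          2 * P′ + 1                       ∎) ⟩
        n ^ (2 * P′ + 1)                                        ∎
        where
        lem₂ : ∀ x y → x + 2 + suc y ≡ suc x + (1 + y) + 1
        lem₂ = solveℕ-∀

    level-bounded : ∀ S k m → Bounded b 0 S → Bounded b k (level b S k m)
    level-bounded S zero    m bounded = bounded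
    level-bounded S (suc k) m bounded = block-bounded k m _ (level-bounded S k (b + m) bounded)

    -- The left-hand side is the binary logarithm of the bound in systemTracker-size.
    states-bounded : ∀ {k u S} → Bounded b k S → 1 ≤ k → u ≤ n →
      suc ((Sys.w S + Sys.α S + 2) * (length (Sys.forms S) + u)) ≤ n ^ (suc b ^ (k + 3))
    states-bounded {k} {u} {S} bounded 1≤k u≤n = begin
      1 + (w + α + 2) * (length forms + u)
        ≤⟨ 2-absorb (2 * P + 3 + suc P) (1≤n^ (2 * P + 3 + suc P)) (begin
             (w + α + 2) * (length forms + u)      ≤⟨ *-mono-≤ first second ⟩
             n ^ (2 * P + 3) * n ^ suc P           ≡⟨ sym (^-distribˡ-+-* n (2 * P + 3) (suc P)) ⟩
             n ^ (2 * P + 3 + suc P)               ∎) ⟩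
      n ^ suc (2 * P + 3 + suc P)   ≤⟨ ^-monoʳ-≤ n (begin
        suc (2 * P + 3 + suc P)     ≡⟨ lem₁ P ⟩
        3 * P + 5                   ≤⟨ +-monoʳ-≤ (3 * P) (≤-trans (n≤1+n 5) (*-monoʳ-≤ 3 2≤P)) ⟩
        3 * P + 3 * P               ≤⟨ m≤m+n (3 * P + 3 * P) (2 * P) ⟩
        3 * P + 3 * P + 2 * P       ≡⟨ lem₂ P ⟩
        -- Absorbing the factor 8 costs three in the outer exponent; with the extra level of
        -- `invariant-formula` this gives the 4 of the bound.
        P * 2 ^ 3                   ≤⟨ *-monoʳ-≤ P (^-monoˡ-≤ 3 (s≤s 1≤b)) ⟩
        P * suc b ^ 3               ≡⟨ sym (^-distribˡ-+-* (suc b) k 3) ⟩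
        suc b ^ (k + 3)             ∎) ⟩
      n ^ (suc b ^ (k + 3))         ∎
      where
      open ≤-Reasoning
      open Bounded bounded
      open Sys S
      P = suc b ^ k
      lem₁ : ∀ P → suc (2 * P + 3 + suc P) ≡ 3 * P + 5
      lem₁ = solveℕ-∀
      lem₂ : ∀ P → 3 * P + 3 * P + 2 * P ≡ P * 8
      lem₂ = solveℕ-∀
      2≤P : 2 ≤ P
      2≤P = ≤-trans (s≤s 1≤b) (≤-trans (≤-reflexive (sym (*-identityʳ (suc b)))) (^-monoʳ-≤ (suc b) 1≤k))
      lem₃ : ∀ w a → w + a + 2 ≡ w + suc a + 1
      lem₃ = solveℕ-∀
      first : w + α + 2 ≤ n ^ (2 * P + 3)
      first = ≤-trans (≤-reflexive (lem₃ w α)) (≤-trans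
        (3-absorb (2 * P + 2) w≤ (≤-trans α≤ (^-monoʳ-≤ n (+-monoˡ-≤ 2
          (≤-trans (n≤1+n _) (≤-trans (bernoulli b k) (m≤m+n P (P + 0))))))) (1≤n^ (2 * P + 2)))
        (≤-reflexive (cong (n ^_) (sym (+-suc (2 * P) 2)))))
      second : length forms + u ≤ n ^ suc P
      second = 2-absorb P (≤-trans (n≤1+n _) forms≤)
        (≤-trans u≤n (≤-trans (≤-reflexive (sym (*-identityʳ n))) (^-monoʳ-≤ n (≤-trans (s≤s z≤n) 2≤P))))

-- The automata of the theorem

-- The successor in `small` reserves the initial state of the automaton. Products respect it, since
-- `suc (s * s′)` is at most `suc s * suc s′`.
record Recogniser (ϱ n : ℕ) (P : Env → Set) : Set where
  field
    tracker  : Tracker ϱ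
    verdict  : Fin (Tracker.size tracker) → Bool
    correct  : ∀ σ → Reflects (P σ) (verdict (Tracker.code tracker σ))
    small    : suc (Tracker.size tracker) ≤ 2 ^ n

product-small : ∀ {s s′ m n} → suc s ≤ 2 ^ m → suc s′ ≤ 2 ^ n → suc (s * s′) ≤ 2 ^ (m + 1 + n)
product-small {s} {s′} {m} {n} p q = begin
  suc (s * s′)         ≤⟨ s≤s (≤-trans (*-monoʳ-≤ s (n≤1+n s′)) (m≤n+m (s * suc s′) s′)) ⟩
  suc s * suc s′       ≤⟨ *-mono-≤ p q ⟩
  2 ^ m * 2 ^ n        ≡⟨ sym (^-distribˡ-+-* 2 m n) ⟩
  2 ^ (m + n)          ≤⟨ ^-monoʳ-≤ 2 (+-monoˡ-≤ n (m≤m+n m 1)) ⟩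
  2 ^ (m + 1 + n)      ∎
  where open ≤-Reasoning

combineRecognisers : ∀ {ϱ m n P P′} {R : Set → Set → Set} (f : Bool → Bool → Bool) →
  (∀ {A B a b} → Reflects A a → Reflects B b → Reflects (R A B) (f a b)) →
  Recogniser ϱ m P → Recogniser ϱ n P′ → Recogniser ϱ (m + 1 + n) (λ σ → R (P σ) (P′ σ))
combineRecognisers {m = m} {n} {P} {P′} {R} f reflects r r′ = record
  { tracker = productTracker r.tracker r′.tracker
  ; verdict = λ q → f (r.verdict (proj₁ (remQuot {s} s′ q))) (r′.verdict (proj₂ (remQuot {s} s′ q)))
  ; correct = λ σ → subst
      (λ p → Reflects (R (P σ) (P′ σ)) (f (r.verdict (proj₁ p)) (r′.verdict (proj₂ p))))
      (sym (remQuot-combine {s} (Tracker.code r.tracker σ) (Tracker.code r′.tracker σ)))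
      (reflects (r.correct σ) (r′.correct σ))
  ; small = product-small {s} {s′} {m} {n} r.small r′.small }
  where
  module r = Recogniser r
  module r′ = Recogniser r′
  s = Tracker.size r.tracker
  s′ = Tracker.size r′.tracker

QuantifierFree : Formula → Set
QuantifierFree (atom _ _ _) = ⊤
QuantifierFree (dvd _ _ _)  = ⊤
QuantifierFree (¬' φ)   = QuantifierFree φ
QuantifierFree (φ ∧' ψ) = QuantifierFree φ × QuantifierFree ψ
QuantifierFree (φ ∨' ψ) = QuantifierFree φ × QuantifierFree ψ
QuantifierFree (φ ⇒' ψ) = QuantifierFree φ × QuantifierFree ψ
QuantifierFree (φ ⇔' ψ) = QuantifierFree φ × QuantifierFree ψ
QuantifierFree (∃' _ _) = ⊥
QuantifierFree (∀' _ _) = ⊥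

quantifierFree⊎ : ∀ φ → QuantifierFree φ ⊎ 1 ≤ qbl φ
quantifierFree⊎² : ∀ φ ψ → (QuantifierFree φ × QuantifierFree ψ) ⊎ 1 ≤ qbl φ ⊔ qbl ψ

quantifierFree⊎² φ ψ with quantifierFree⊎ φ | quantifierFree⊎ ψ
... | inj₁ p | inj₁ q = inj₁ (p , q)
... | inj₂ p | _      = inj₂ (≤-trans p (m≤m⊔n (qbl φ) (qbl ψ)))
... | inj₁ _ | inj₂ q = inj₂ (≤-trans q (m≤n⊔m (qbl φ) (qbl ψ)))

lift-⊎ : ∀ {P : Set} {s} χ → P ⊎ 1 ≤ s → P ⊎ 1 ≤ (qblQ E χ ⊔ qblQ A χ) ⊔ s
lift-⊎ χ (inj₁ p) = inj₁ p
lift-⊎ {s = s} χ (inj₂ p) = inj₂ (≤-trans p (m≤n⊔m (qblQ E χ ⊔ qblQ A χ) s))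

quantifierFree⊎ (atom _ _ _) = inj₁ tt
quantifierFree⊎ (dvd _ _ _)  = inj₁ tt
quantifierFree⊎ χ@(¬' φ)   = lift-⊎ χ (quantifierFree⊎ φ)
quantifierFree⊎ χ@(φ ∧' ψ) = lift-⊎ χ (quantifierFree⊎² φ ψ)
quantifierFree⊎ χ@(φ ∨' ψ) = lift-⊎ χ (quantifierFree⊎² φ ψ)
quantifierFree⊎ χ@(φ ⇒' ψ) = lift-⊎ χ (quantifierFree⊎² φ ψ)
quantifierFree⊎ χ@(φ ⇔' ψ) = lift-⊎ χ (quantifierFree⊎² φ ψ)
quantifierFree⊎ (∃' x φ) = inj₂ (≤-trans (s≤s z≤n) (qblQ≤qbl E (∃' x φ)))
quantifierFree⊎ (∀' x φ) = inj₂ (≤-trans (s≤s z≤n) (qblQ≤qbl A (∀' x φ)))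

2*leaves : ∀ t → leaves t + leaves t ≤ suc (lenT t)
2*leaves `0      = ≤-refl
2*leaves `1      = ≤-refl
2*leaves (var x) = ≤-refl
2*leaves (- t)   = m≤n⇒m≤1+n (2*leaves t)
2*leaves (t ⊕ u) = begin
  leaves t + leaves u + (leaves t + leaves u)   ≡⟨ lem (leaves t) (leaves u) ⟩
  leaves t + leaves t + (leaves u + leaves u)   ≤⟨ +-mono-≤ (2*leaves t) (2*leaves u) ⟩
  suc (lenT t) + suc (lenT u)                   ≡⟨ cong suc (trans (+-suc (lenT t) (lenT u)) (cong (_+ lenT u) (+-comm 1 (lenT t)))) ⟩
  suc (lenT t + 1 + lenT u)                     ∎
  where
  open ≤-Reasoning
  lem : ∀ a b → a + b + (a + b) ≡ a + a + (b + b)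
  lem = solveℕ-∀

-- An equality for `n = 3`, the length of the shortest atoms, whose state count has no slack.
n+5≤2^n : ∀ n → 3 ≤ n → n + 5 ≤ 2 ^ n
n+5≤2^n n 3≤n with m≤n⇒∃[o]m+o≡n 3≤n
... | k , refl = begin
  3 + k + 5        ≡⟨ lem k ⟩
  8 + k            ≤⟨ +-monoʳ-≤ 8 (m≤n*m k 8) ⟩
  8 + 8 * k        ≡⟨ lem′ k ⟩
  8 * suc k        ≤⟨ *-monoʳ-≤ 8 (n<2^n k) ⟩
  8 * 2 ^ k        ≡⟨ sym (^-distribˡ-+-* 2 3 k) ⟩
  2 ^ (3 + k)      ∎
  where
  open ≤-Reasoning
  lem : ∀ k → 3 + k + 5 ≡ 8 + k
  lem = solveℕ-∀
  lem′ : ∀ k → 8 + 8 * k ≡ 8 * suc k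
  lem′ = solveℕ-∀

module _ {ϱ : ℕ} (1≤ϱ : 1 ≤ ϱ) (m : ℕ) (ν : Var → ℕ) where

  atomRecogniser : ∀ R t u → FreeBelow ν m (atom R t u) → Recogniser ϱ (len (atom R t u)) (Holds E ν (atom R t u))
  atomRecogniser R t u ν< = record
    { tracker = clampTracker 1≤ϱ m h K (≤-trans (norm≤leaves ν (difference t u) m) (n≤1+n L))
    ; verdict = λ q → does (evalR? R (decodeᶻ q +ᶻ c) 0ℤ)
    ; correct = λ σ → proof (map′ (to σ) (from σ) (evalR? R (decodeᶻ (encode (ev m h σ)) +ᶻ c) 0ℤ))
    ; small = begin
        suc (suc (K + K))                                       ≡⟨ lem (leaves t) (leaves u) ⟩
        leaves t + leaves t + (leaves u + leaves u) + 4         ≤⟨ +-monoˡ-≤ 4 (+-mono-≤ (2*leaves t) (2*leaves u)) ⟩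
        suc (lenT t) + suc (lenT u) + 4                         ≡⟨ lem′ (lenT t) (lenT u) ⟩
        lenT t + 1 + lenT u + 5                                 ≤⟨ n+5≤2^n _ (+-mono-≤ (+-mono-≤ (1≤lenT t) ≤-refl) (1≤lenT u)) ⟩
        2 ^ (lenT t + 1 + lenT u)                               ∎ }
    where
    open ≤-Reasoning
    L = leaves t + leaves u
    -- Translation by `c` costs at most `L`, and a threshold of 1 must remain for the sign.
    K = suc L
    h = coefficients ν (difference t u)
    c = constant (difference t u)
    open Clamp K
    lem : ∀ a b → suc (suc (suc (a + b) + suc (a + b))) ≡ a + a + (b + b) + 4
    lem = solveℕ-∀
    lem′ : ∀ a b → suc a + suc b + 4 ≡ a + 1 + b + 5
    lem′ = solveℕ-∀
    shifted : ∀ σ → (decodeᶻ (encode (ev m h σ)) +ᶻ c) ≈[ 1 ] (ev m h σ +ᶻ c)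
    shifted σ = ≈-translate c (≤-trans (+-monoˡ-≤ 1 (constant≤leaves (difference t u))) (≤-reflexive (+-comm L 1)))
                            ≤-refl (decode-encode (ev m h σ))
    to : ∀ σ → evalR R (decodeᶻ (encode (ev m h σ)) +ᶻ c) 0ℤ → Sat (σ ∘ ν) (atom R t u)
    to σ r = difference-evalR R (subst (λ z → evalR R z 0ℤ) (sym (ev-coefficients m ν (difference t u) ν<))
                                  (evalR-≈ R (shifted σ) r))
    from : ∀ σ → Sat (σ ∘ ν) (atom R t u) → evalR R (decodeᶻ (encode (ev m h σ)) +ᶻ c) 0ℤ
    from σ r = evalR-≈ R (≈-sym (shifted σ)) (subst (λ z → evalR R z 0ℤ) (ev-coefficients m ν (difference t u) ν<)
                                  (evalR-difference R r))

  dvdRecogniser : ∀ d 2≤d t → FreeBelow ν m (dvd d 2≤d t) → Recogniser ϱ (len (dvd d 2≤d t)) (Holds E ν (dvd d 2≤d t))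
  dvdRecogniser d 2≤d t ν< = record
    { tracker = residueTracker d (ev-linear m h)
    ; verdict = λ q → does (d ∣.∣? ∣ + toℕ q +ᶻ c ∣)
    ; correct = λ σ → proof (map′ (congruent-∣ (same-residue σ)) (congruent-∣ (cong-sym (same-residue σ)))
        (d ∣.∣? ∣ + toℕ (residue d (ev m h σ)) +ᶻ c ∣))
    ; small = ≤-trans (n<2^n d) (^-monoʳ-≤ 2 (≤-trans (m≤m+n d 1) (m≤n+m (d + 1) (lenT t)))) }
    where
    instance _ = ℕ.>-nonZero (≤-trans (s≤s z≤n) 2≤d)
    h = coefficients ν t
    c = constant t
    same-residue : ∀ σ → Congruent d (+ toℕ (residue d (ev m h σ)) +ᶻ c) (evalT (σ ∘ ν) t)
    same-residue σ = cong-trans (cong-+ (cong-trans (cong-reflexive (cong +_ (toℕ-fromℕ< (n%ℕd<d (ev m h σ) d))))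
                                                    (%ℕ-congruent d (ev m h σ))) (cong-reflexive refl))
                                (cong-reflexive (sym (ev-coefficients m ν t ν<)))

  quantifierFreeRecogniser : ∀ φ → QuantifierFree φ → FreeBelow ν m φ → Recogniser ϱ (len φ) (Holds E ν φ)
  quantifierFreeRecogniser (atom R t u) _ ν< = atomRecogniser R t u ν<
  quantifierFreeRecogniser (dvd d 2≤d t) _ ν< = dvdRecogniser d 2≤d t ν<
  quantifierFreeRecogniser (¬' φ) qf ν< = record
    { tracker = tracker ; verdict = not ∘ verdict ; correct = λ σ → ¬-reflects (correct σ)
    ; small = ≤-trans small (^-monoʳ-≤ 2 (n≤1+n (len φ))) }
    where open Recogniser (quantifierFreeRecogniser φ qf ν<)
  quantifierFreeRecogniser (φ ∧' ψ) (qf , qf′) ν< = combineRecognisers _∧_ _×-reflects_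
    (quantifierFreeRecogniser φ qf (ν< ∘ inj₁)) (quantifierFreeRecogniser ψ qf′ (ν< ∘ inj₂))
  quantifierFreeRecogniser (φ ∨' ψ) (qf , qf′) ν< = combineRecognisers _∨_ _⊎-reflects_
    (quantifierFreeRecogniser φ qf (ν< ∘ inj₁)) (quantifierFreeRecogniser ψ qf′ (ν< ∘ inj₂))
  quantifierFreeRecogniser (φ ⇒' ψ) (qf , qf′) ν< = combineRecognisers (λ a b → not a ∨ b) _→-reflects_
    (quantifierFreeRecogniser φ qf (ν< ∘ inj₁)) (quantifierFreeRecogniser ψ qf′ (ν< ∘ inj₂))
  -- Both directions share the two trackers, so each side is paid for once, as in `len`.
  quantifierFreeRecogniser (φ ⇔' ψ) (qf , qf′) ν< = combineRecognisers
    {R = λ A B → (A → B) × (B → A)} (λ a b → (not a ∨ b) ∧ (not b ∨ a))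
    (λ r s → (r →-reflects s) ×-reflects (s →-reflects r))
    (quantifierFreeRecogniser φ qf (ν< ∘ inj₁)) (quantifierFreeRecogniser ψ qf′ (ν< ∘ inj₂))

-- The tracker of a system

module SystemTracker {ϱ : ℕ} (1≤ϱ : 1 ≤ ϱ) (S : Sys) (good : Good S) (u : ℕ) where
  open Sys S
  open Good good

  -- At least `2 ^ w`, so that codes determine the equivalence, and at least `2 ^ α`, so that
  -- clamped values can be updated.
  K : ℕ
  K = 2 ^ (w + α)

  open Clamp K

  formsTracker : ∀ T → (∀ {h} → h ∈ T → h ∈ forms) → Tracker ϱ
  formsTracker []      _  = unitTracker
  formsTracker (h ∷ T) T⊆ = productTracker
    (clampTracker 1≤ϱ u h K (≤-trans (norm≤ (T⊆ (here refl)) u) (^-monoʳ-≤ 2 (m≤n+m α w))))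
    (formsTracker T (T⊆ ∘ there))

  instance
    D-nonZero : NonZero D
    D-nonZero = ℕ.>-nonZero 1≤D

  residuesTracker : ℕ → Tracker ϱ
  residuesTracker zero    = unitTracker
  residuesTracker (suc i) = productTracker (residueTracker D (slot-linear i)) (residuesTracker i)

  systemTracker : Tracker ϱ
  systemTracker = productTracker (formsTracker forms id) (residuesTracker u)

  open Tracker using (code; size)

  -- Equality of codes lies between two equivalences: it follows from that of `clamped` and implies
  -- that of `S`. The first makes the fibres of the code definable, the second makes every predicate
  -- invariant under `S` a function of the code.
  clamped : Sys
  clamped = sys forms α (w + α) D

  clamped-good : Good clamped
  clamped-good = record { norm≤ = norm≤ ; 1≤D = 1≤D ; D≤ = ≤-trans D≤ (^-monoʳ-≤ 2 (m≤m+n w α)) }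

  formsTracker-≋ : ∀ T (T⊆ : ∀ {h} → h ∈ T → h ∈ forms) {σ σ′} → (∀ {h} → h ∈ T → ev u h σ ≈[ K ] ev u h σ′) →
    code (formsTracker T T⊆) σ ≡ code (formsTracker T T⊆) σ′
  formsTracker-≋ []      T⊆ close = refl
  formsTracker-≋ (h ∷ T) T⊆ close = cong₂ combine (encode-≈ (close (here refl))) (formsTracker-≋ T (T⊆ ∘ there) (close ∘ there))

  residuesTracker-≋ : ∀ m {σ σ′} → CongruentBelow D m σ σ′ → code (residuesTracker m) σ ≡ code (residuesTracker m) σ′
  residuesTracker-≋ zero    c = refl
  residuesTracker-≋ (suc m) c = cong₂ combine (residue-congruent D (c ≤-refl)) (residuesTracker-≋ m (λ i<m → c (m<n⇒m<1+n i<m)))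

  ≋⇒code≡ : ∀ {σ σ′} → σ ≋[ clamped , u ] σ′ → code systemTracker σ ≡ code systemTracker σ′
  ≋⇒code≡ (c & f) = cong₂ combine (formsTracker-≋ forms id f) (residuesTracker-≋ u c)

  formsTracker-≡ : ∀ T (T⊆ : ∀ {h} → h ∈ T → h ∈ forms) {σ σ′} →
    code (formsTracker T T⊆) σ ≡ code (formsTracker T T⊆) σ′ → ∀ {h} → h ∈ T → ev u h σ ≈[ K ] ev u h σ′
  formsTracker-≡ (h ∷ T) T⊆ {σ} {σ′} e (here refl) = ≈-trans (1≤2^ (w + α)) (≈-sym (decode-encode (ev u h σ)))
    (subst (λ q → decodeᶻ q ≈[ K ] ev u h σ′) (sym (combine-injectiveˡ _ _ _ _ e)) (decode-encode (ev u h σ′)))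
  formsTracker-≡ (h ∷ T) T⊆ {σ} {σ′} e (there i) = formsTracker-≡ T (T⊆ ∘ there) {σ} {σ′}
    (combine-injectiveʳ (encode (ev u h σ)) _ (encode (ev u h σ′)) _ e) i

  residuesTracker-≡ : ∀ m {σ σ′} → code (residuesTracker m) σ ≡ code (residuesTracker m) σ′ → CongruentBelow D m σ σ′
  residuesTracker-≡ (suc m) {σ} {σ′} e {i} i<sm with i ℕₚ.≟ m
  ... | yes refl = congruent-residue D (combine-injectiveˡ _ _ _ _ e)
  ... | no i≢m   = residuesTracker-≡ m {σ} {σ′} (combine-injectiveʳ (residue D (σ m)) _ (residue D (σ′ m)) _ e)
                                     (≤∧≢⇒< (ℕ.s≤s⁻¹ i<sm) i≢m)

  code≡⇒≋ : ∀ {σ σ′} → code systemTracker σ ≡ code systemTracker σ′ → σ ≋[ S , u ] σ′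
  code≡⇒≋ {σ} {σ′} e =
    residuesTracker-≡ u {σ} {σ′} (combine-injectiveʳ (code (formsTracker forms id) σ) _ (code (formsTracker forms id) σ′) _ e) &
    (λ h∈ → ≈-weaken (^-monoʳ-≤ 2 (m≤m+n w α))
      (formsTracker-≡ forms id {σ} {σ′} (combine-injectiveˡ (code (formsTracker forms id) σ) _ (code (formsTracker forms id) σ′) _ e) h∈))

  code-definable : ∀ q → Definable u (λ σ → code systemTracker σ ≡ q)
  code-definable q = record
    { system = clamped ; good = clamped-good
    ; invariant = λ σ≋σ′ e → trans (sym (≋⇒code≡ σ≋σ′)) e
    ; decide = λ σ → code systemTracker σ Fin.≟ q }

  formsTracker-size : ∀ T (T⊆ : ∀ {h} → h ∈ T → h ∈ forms) → size (formsTracker T T⊆) ≤ 2 ^ ((w + α + 2) * length T)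
  formsTracker-size [] T⊆ = 1≤2^ ((w + α + 2) * 0)
  formsTracker-size (h ∷ T) T⊆ = begin
    suc (K + K) * size (formsTracker T (T⊆ ∘ there))   ≤⟨ *-mono-≤ 2K<4K (formsTracker-size T (T⊆ ∘ there)) ⟩
    2 ^ (w + α + 2) * 2 ^ ((w + α + 2) * length T)     ≡⟨ sym (^-distribˡ-+-* 2 (w + α + 2) _) ⟩
    2 ^ (w + α + 2 + (w + α + 2) * length T)           ≡⟨ cong (2 ^_) (sym (*-suc (w + α + 2) (length T))) ⟩
    2 ^ ((w + α + 2) * suc (length T))                 ∎
    where
    open ≤-Reasoning
    lem : ∀ k → k + (k + k) + k ≡ k * 4
    lem = solveℕ-∀
    2K<4K : suc (K + K) ≤ 2 ^ (w + α + 2)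
    2K<4K = begin
      1 + (K + K)        ≤⟨ +-monoˡ-≤ (K + K) (1≤2^ (w + α)) ⟩
      K + (K + K)        ≤⟨ m≤m+n _ K ⟩
      K + (K + K) + K    ≡⟨ lem K ⟩
      K * 4              ≡⟨ sym (^-distribˡ-+-* 2 (w + α) 2) ⟩
      2 ^ (w + α + 2)    ∎

  residuesTracker-size : ∀ m → size (residuesTracker m) ≤ 2 ^ (w * m)
  residuesTracker-size zero    = 1≤2^ (w * 0)
  residuesTracker-size (suc m) = begin
    D * size (residuesTracker m)    ≤⟨ *-mono-≤ D≤ (residuesTracker-size m) ⟩
    2 ^ w * 2 ^ (w * m)             ≡⟨ sym (^-distribˡ-+-* 2 w (w * m)) ⟩
    2 ^ (w + w * m)                 ≡⟨ cong (2 ^_) (sym (*-suc w m)) ⟩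
    2 ^ (w * suc m)                 ∎
    where open ≤-Reasoning

  systemTracker-size : suc (size systemTracker) ≤ 2 ^ suc ((w + α + 2) * (length forms + u))
  systemTracker-size = begin
    1 + size systemTracker                    ≤⟨ +-mono-≤ (1≤2^ X) product≤ ⟩
    2 ^ X + 2 ^ X                             ≡⟨ cong (λ k → 2 ^ X + k) (sym (+-identityʳ (2 ^ X))) ⟩
    2 ^ suc X                                 ∎
    where
    open ≤-Reasoning
    X = (w + α + 2) * (length forms + u)
    product≤ : size systemTracker ≤ 2 ^ X
    product≤ = begin
      size (formsTracker forms id) * size (residuesTracker u)
        ≤⟨ *-mono-≤ (formsTracker-size forms id) (residuesTracker-size u) ⟩
      2 ^ ((w + α + 2) * length forms) * 2 ^ (w * u)
        ≡⟨ sym (^-distribˡ-+-* 2 ((w + α + 2) * length forms) (w * u)) ⟩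
      2 ^ ((w + α + 2) * length forms + w * u)
        ≤⟨ ^-monoʳ-≤ 2 (+-monoʳ-≤ ((w + α + 2) * length forms) (*-monoˡ-≤ u (≤-trans (m≤m+n w α) (m≤m+n (w + α) 2)))) ⟩
      2 ^ ((w + α + 2) * length forms + (w + α + 2) * u)
        ≡⟨ cong (2 ^_) (sym (*-distribˡ-+ (w + α + 2) (length forms) u)) ⟩
      2 ^ X ∎

-- Occurring variables and their slots

varsT : Term → List Var
varsT `0      = []
varsT `1      = []
varsT (var x) = x ∷ []
varsT (- t)   = varsT t
varsT (t ⊕ u) = varsT t ++ varsT u

-- The number `r` of tracks may exceed the length of the formula, so slots are given to occurrences
-- of variables instead. Bound and repeated ones are kept, as the list is still no longer than
-- `len φ`.
vars : Formula → List Var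
vars (atom _ t u) = varsT t ++ varsT u
vars (dvd _ _ t)  = varsT t
vars (¬' φ)   = vars φ
vars (φ ∧' ψ) = vars φ ++ vars ψ
vars (φ ∨' ψ) = vars φ ++ vars ψ
vars (φ ⇒' ψ) = vars φ ++ vars ψ
vars (φ ⇔' ψ) = vars φ ++ vars ψ
vars (∃' _ φ) = vars φ
vars (∀' _ φ) = vars φ

length-++-≤ : ∀ (xs ys : List Var) {m n} → length xs ≤ m → length ys ≤ n → length (xs ++ ys) ≤ m + 1 + n
length-++-≤ xs ys {m} p q = ≤-trans (≤-reflexive (length-++ xs)) (+-mono-≤ (≤-trans p (m≤m+n m 1)) q)

length-varsT : ∀ t → length (varsT t) ≤ lenT t
length-varsT `0      = z≤n
length-varsT `1      = z≤n
length-varsT (var x) = ≤-refl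
length-varsT (- t)   = m≤n⇒m≤1+n (length-varsT t)
length-varsT (t ⊕ u) = length-++-≤ (varsT t) (varsT u) (length-varsT t) (length-varsT u)

length-vars : ∀ φ → length (vars φ) ≤ len φ
length-vars (atom _ t u) = length-++-≤ (varsT t) (varsT u) (length-varsT t) (length-varsT u)
length-vars (dvd d _ t)  = ≤-trans (length-varsT t) (m≤m+n (lenT t) (d + 1))
length-vars (¬' φ)   = m≤n⇒m≤1+n (length-vars φ)
length-vars (φ ∧' ψ) = length-++-≤ (vars φ) (vars ψ) (length-vars φ) (length-vars ψ)
length-vars (φ ∨' ψ) = length-++-≤ (vars φ) (vars ψ) (length-vars φ) (length-vars ψ)
length-vars (φ ⇒' ψ) = length-++-≤ (vars φ) (vars ψ) (length-vars φ) (length-vars ψ)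
length-vars (φ ⇔' ψ) = length-++-≤ (vars φ) (vars ψ) (length-vars φ) (length-vars ψ)
length-vars (∃' _ φ) = m≤n⇒m≤1+n (m≤n⇒m≤1+n (length-vars φ))
length-vars (∀' _ φ) = m≤n⇒m≤1+n (m≤n⇒m≤1+n (length-vars φ))

OccT⇒∈ : ∀ t {x} → OccT x t → x ∈ varsT t
OccT⇒∈ (var y) refl     = here refl
OccT⇒∈ (- t) o          = OccT⇒∈ t o
OccT⇒∈ (t ⊕ u) (inj₁ o) = ∈-++⁺ˡ (OccT⇒∈ t o)
OccT⇒∈ (t ⊕ u) (inj₂ o) = ∈-++⁺ʳ (varsT t) (OccT⇒∈ u o)

Free⇒∈ : ∀ φ {x} → Free x φ → x ∈ vars φ
Free⇒∈ (atom _ t u) (inj₁ o) = ∈-++⁺ˡ (OccT⇒∈ t o)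
Free⇒∈ (atom _ t u) (inj₂ o) = ∈-++⁺ʳ (varsT t) (OccT⇒∈ u o)
Free⇒∈ (dvd _ _ t) o     = OccT⇒∈ t o
Free⇒∈ (¬' φ) f          = Free⇒∈ φ f
Free⇒∈ (φ ∧' ψ) (inj₁ f) = ∈-++⁺ˡ (Free⇒∈ φ f)
Free⇒∈ (φ ∧' ψ) (inj₂ f) = ∈-++⁺ʳ (vars φ) (Free⇒∈ ψ f)
Free⇒∈ (φ ∨' ψ) (inj₁ f) = ∈-++⁺ˡ (Free⇒∈ φ f)
Free⇒∈ (φ ∨' ψ) (inj₂ f) = ∈-++⁺ʳ (vars φ) (Free⇒∈ ψ f)
Free⇒∈ (φ ⇒' ψ) (inj₁ f) = ∈-++⁺ˡ (Free⇒∈ φ f)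
Free⇒∈ (φ ⇒' ψ) (inj₂ f) = ∈-++⁺ʳ (vars φ) (Free⇒∈ ψ f)
Free⇒∈ (φ ⇔' ψ) (inj₁ f) = ∈-++⁺ˡ (Free⇒∈ φ f)
Free⇒∈ (φ ⇔' ψ) (inj₂ f) = ∈-++⁺ʳ (vars φ) (Free⇒∈ ψ f)
Free⇒∈ (∃' _ φ) (_ , f)  = Free⇒∈ φ f
Free⇒∈ (∀' _ φ) (_ , f)  = Free⇒∈ φ f

nth : List Var → ℕ → Var
-- A default for slots from `length (vars φ)` on, which the trackers do not read.
nth []       _       = 0
nth (x ∷ xs) zero    = x
nth (x ∷ xs) (suc i) = nth xs i

position : List Var → Var → ℕ
position []       x = 0
position (y ∷ ys) x with x ℕₚ.≟ y
... | yes _ = 0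
... | no _  = suc (position ys x)

position-< : ∀ xs {x} → x ∈ xs → position xs x < length xs
position-< (y ∷ ys) {x} x∈ with x ℕₚ.≟ y | x∈
... | yes _  | _        = s≤s z≤n
... | no x≢y | here x≡y = ⊥-elim (x≢y x≡y)
... | no _   | there i  = s≤s (position-< ys i)

nth-position : ∀ xs {x} → x ∈ xs → nth xs (position xs x) ≡ x
nth-position (y ∷ ys) {x} x∈ with x ℕₚ.≟ y | x∈
... | yes x≡y | _        = sym x≡y
... | no x≢y  | here x≡y = ⊥-elim (x≢y x≡y)
... | no _    | there i  = nth-position ys i

3≤len : ∀ φ → 3 ≤ len φ
3≤len (atom _ t u)  = +-mono-≤ (+-mono-≤ (1≤lenT t) ≤-refl) (1≤lenT u)
3≤len (dvd d 2≤d t) = +-mono-≤ (1≤lenT t) (≤-trans 2≤d (m≤m+n d 1))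
3≤len (¬' φ)   = m≤n⇒m≤1+n (3≤len φ)
3≤len (φ ∧' ψ) = ≤-trans (3≤len φ) (≤-trans (m≤m+n (len φ) 1) (m≤m+n (len φ + 1) (len ψ)))
3≤len (φ ∨' ψ) = ≤-trans (3≤len φ) (≤-trans (m≤m+n (len φ) 1) (m≤m+n (len φ + 1) (len ψ)))
3≤len (φ ⇒' ψ) = ≤-trans (3≤len φ) (≤-trans (m≤m+n (len φ) 1) (m≤m+n (len φ + 1) (len ψ)))
3≤len (φ ⇔' ψ) = ≤-trans (3≤len φ) (≤-trans (m≤m+n (len φ) 1) (m≤m+n (len φ + 1) (len ψ)))
3≤len (∃' _ φ) = m≤n⇒m≤1+n (m≤n⇒m≤1+n (3≤len φ))
3≤len (∀' _ φ) = m≤n⇒m≤1+n (m≤n⇒m≤1+n (3≤len φ))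

true-reflects : ∀ {P : Set} {b} → Reflects P b → (b ≡ true) ⇔ P
true-reflects (ofʸ p)  = mk⇔ (λ _ → p) (λ _ → refl)
true-reflects (ofⁿ ¬p) = mk⇔ (λ ()) (λ p → ⊥-elim (¬p p))

slots : Formula → Var → ℕ
slots φ = position (vars φ)

slots-below : ∀ φ → FreeBelow (slots φ) (length (vars φ)) φ
slots-below φ f = position-< (vars φ) (Free⇒∈ φ f)

module _ {ϱ r : ℕ} (1≤ϱ : 1 ≤ ϱ) (φ : Formula) (T : Tracker ϱ) (verdict : Fin (Tracker.size T) → Bool)
  (correct : ∀ σ → Reflects (Sat (σ ∘ slots φ) φ) (verdict (Tracker.code T σ))) where

  open Automaton {ϱ} {r} 1≤ϱ T (nth (vars φ)) verdict

  trackerAutomaton : Σ (DWA ϱ r) λ 𝒜 → Represents 𝒜 ⟦ φ ⟧ × DWA.size 𝒜 ≡ suc (Tracker.size T)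
  trackerAutomaton = automaton , represents (λ a → mk⇔
      (λ acc → Sat-cong φ (slot-value a) (Equivalence.to (true-reflects (correct (envOf a ∘ nth (vars φ)))) acc))
      (λ s → Equivalence.from (true-reflects (correct (envOf a ∘ nth (vars φ)))) (Sat-cong φ (λ f → sym (slot-value a f)) s))) ,
    refl
    where
    slot-value : ∀ (a : Fin r → ℤ) {x} → Free x φ → envOf a (nth (vars φ) (slots φ x)) ≡ envOf a x
    slot-value a f = cong (envOf a) (nth-position (vars φ) (Free⇒∈ φ f))

module Quantified {ϱ : ℕ} (1≤ϱ : 1 ≤ ϱ) (φ : Formula) (1≤qbl : 1 ≤ qbl φ) where

  b = qbl φ
  n = len φ
  u = length (vars φ)
  levels = suc (qa φ)

  analysis = invariant-formula b φ (slots-below φ) ≤-refl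
  module R = Requirement (proj₁ analysis)

  base : Sys
  base = sys R.forms n n R.modulus

  base-good : Good base
  base-good = record { norm≤ = λ h∈ m → ≤-trans (R.norm≤ h∈ m) (<⇒≤ (n<2^n n)) ; 1≤D = R.1≤modulus ; D≤ = R.modulus≤ }

  final : Sys
  final = level b base levels u

  open SystemTracker {ϱ} 1≤ϱ final (level-good b base levels u base-good) u public

  sat-invariant : ∀ {σ σ′} → σ ≋[ final , u ] σ′ → Sat (σ ∘ slots φ) φ → Sat (σ′ ∘ slots φ) φ
  sat-invariant = proj₂ analysis
    (record { good-system = base-good ; included = id ; divisible = ∣.∣-refl ; length≤w = ≤-refl })

  -- Whether some model of φ has the given code is decided by eliminating all slots.
  reachable? : ∀ q → Dec (Σ Env λ σ → Tracker.code systemTracker σ ≡ q × Sat (σ ∘ slots φ) φ)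
  reachable? q = satisfiable? u (definable-× (code-definable q) (Sat-definable φ (slots-below φ)))

  -- The verdict asks for some model with this code; by `sat-invariant` every environment with the
  -- code is then a model.
  recognised : ∀ σ → Reflects (Sat (σ ∘ slots φ) φ) (does (reachable? (Tracker.code systemTracker σ)))
  recognised σ = proof (map′ (λ { (τ , e , s) → sat-invariant (code≡⇒≋ e) s }) (λ s → σ , refl , s)
    (reachable? (Tracker.code systemTracker σ)))

  base-bounded : Bounded (3≤len φ) b 0 base
  base-bounded = record
    { forms≤ = ≤-trans R.count (≤-reflexive (sym (*-identityʳ n)))
    ; α≤ = begin
        suc n              ≤⟨ +-monoˡ-≤ n 1≤n ⟩
        n + n              ≤⟨ +-monoʳ-≤ n (m≤m+n n 0) ⟩
        2 * n              ≤⟨ *-monoˡ-≤ n (≤-trans (n≤1+n 2) (3≤len φ)) ⟩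
        n * n              ≡⟨ cong (n *_) (sym (*-identityʳ n)) ⟩
        n ^ 2              ≡⟨ cong (λ k → n ^ (k + 2)) (sym (*-zeroʳ b)) ⟩
        n ^ (b * 0 + 2)    ∎
    ; w≤ = ≤-trans (≤-reflexive (sym (*-identityʳ n))) (^-monoʳ-≤ n {1} {4} (s≤s z≤n)) }
    where
    open ≤-Reasoning
    1≤n : 1 ≤ n
    1≤n = ≤-trans (s≤s z≤n) (3≤len φ)
    instance _ = ℕ.>-nonZero 1≤n

  tracker-small : suc (Tracker.size systemTracker) ≤ bound φ
  tracker-small = ≤-trans systemTracker-size (^-monoʳ-≤ 2 (≤-trans
    (states-bounded (3≤len φ) 1≤qbl (level-bounded (3≤len φ) 1≤qbl base levels u base-bounded) (s≤s z≤n) (length-vars φ))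
    (≤-reflexive (cong (n ^_) (cong₂ _^_ (+-comm 1 b) (sym (+-suc (qa φ) 3)))))))

theorem4p6 : (ϱ : ℕ) → 2 ≤ ϱ → (r : ℕ) (φ : Formula) → FreeVarsAmong r φ →
    Σ (DWA ϱ r) λ 𝒜 → Represents 𝒜 ⟦ φ ⟧ × DWA.size 𝒜 ≤ bound φ
theorem4p6 ϱ 2≤ϱ r φ _ with quantifierFree⊎ φ
... | inj₁ qf = proj₁ 𝒜 , proj₁ (proj₂ 𝒜) ,
  ≤-trans (≤-reflexive (proj₂ (proj₂ 𝒜))) (≤-trans small (^-monoʳ-≤ 2 (≤-trans
    (≤-reflexive (sym (*-identityʳ (len φ))))
    (^-monoʳ-≤ (len φ) {{ℕ.>-nonZero (≤-trans (s≤s z≤n) (3≤len φ))}}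
      (m^n>0 (qbl φ + 1) {{ℕ.>-nonZero (m≤n+m 1 (qbl φ))}} (qa φ + 4))))))
  where
  open Recogniser (quantifierFreeRecogniser {ϱ} (≤-trans (s≤s z≤n) 2≤ϱ) (length (vars φ)) (slots φ) φ qf (slots-below φ))
  𝒜 = trackerAutomaton {r = r} (≤-trans (s≤s z≤n) 2≤ϱ) φ tracker verdict correct
... | inj₂ 1≤qbl = proj₁ 𝒜 , proj₁ (proj₂ 𝒜) , ≤-trans (≤-reflexive (proj₂ (proj₂ 𝒜))) tracker-small
  where
  open Quantified {ϱ} (≤-trans (s≤s z≤n) 2≤ϱ) φ 1≤qbl
  𝒜 = trackerAutomaton {r = r} (≤-trans (s≤s z≤n) 2≤ϱ) φ systemTracker (does ∘ reachable?) recognised
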